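{- Let $d\ge1$ and let $\Delta$ be a $d$-dimensional simplicial complex with $f_d(\Delta)=s$ and $H_d(\Delta;\mathbb{Z})=0$. Then the symmetric homology polytope $\mathcal{P}_\Delta$ is reflexive if and only if one of the following holds: (1) $H_{d-1}(\Delta;\mathbb{Z})=0$; (2) $d$ is even and $H_{d-1}(\Delta;\mathbb{Z})\cong\mathbb{Z}^\ell\oplus\mathbb{Z}_2\oplus\dots\oplus\mathbb{Z}_2$ for some $\ell\in\mathbb{N}$; (3) $d$ is odd, $H_{d-1}(\Delta;\mathbb{Z})\cong\mathbb{Z}^\ell\oplus\mathbb{Z}_2\oplus\dots\oplus\mathbb{Z}_2$ (with $r$ copies of $\mathbb{Z}_2$) for some $\ell\in\mathbb{N}$, and there exist $\mathbf{v}_{\Delta,1},\dots,\mathbf{v}_{\Delta,r}\in\{\pm\tfrac12,0\}^s\setminus\{\mathbf{0}\}$, each having an even number of nonzero entries, such that the classes $\partial_d\mathbf{v}_{\Delta,1}+\operatorname{im}_{\mathbb{Z}}\partial_d,\dots,\partial_d\mathbf{v}_{\Delta,r}+\operatorname{im}_{\mathbb{Z}}\partial_d$ generate the torsion subgroup of $H_{d-1}(\Delta;\mathbb{Z})$.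
   Context: For $j\ge1$ the boundary map $\partial_j$ of a simplicial complex on $[n]$ sends $\{i_1<\dots<i_{j+1}\}$ to $\sum_k(-1)^{k+1}(\sigma\setminus\{i_k\})$, identified with its integer matrix; $H_j(\Delta;\mathbb{Z})=\ker_{\mathbb{Z}}\partial_j/\operatorname{im}_{\mathbb{Z}}\partial_{j+1}$. $f_d(\Delta)$ is the number of $d$-faces, and $\mathbb{Z}^s$ is identified with $d$-chains. $\mathcal{P}_\Delta=\operatorname{conv}$ of the columns of $\partial_d$ and $-\partial_d$ for $d=\dim\Delta$. In (3), $\partial_d\mathbf{v}_{\Delta,i}$ is required to be an integral vector, hence a $(d-1)$-cycle, and its class modulo $\operatorname{im}_{\mathbb{Z}}\partial_d$ lies in $H_{d-1}(\Delta;\mathbb{Z})$. A centrally symmetric lattice polytope $P\subseteq\mathbb{R}^m$ is reflexive if for every facet $\mathcal{F}$ of $P$ there is $\mathbf{w}\in\mathbb{Z}^m$ with $P\subseteq\{\mathbf{w}^\top\mathbf{x}\le1\}$ and $\mathcal{F}=P\cap\{\mathbf{w}^\top\mathbf{x}=1\}$.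
   Formalization: The symmetric homology polytope is taken as the set of rational convex combinations of the columns of ±∂_d, and its facets are cut out by rational hyperplanes, instead of as a polytope in real space; for a lattice polytope this gives the same notion of reflexive. -}

module Defs where

open import Data.Nat as ℕ using (ℕ; zero; suc; _≤_)
open import Data.Bool using (Bool; true; false; _∧_; if_then_else_)
open import Data.Fin using (Fin; zero; suc)
open import Data.Vec using (Vec; []; _∷_)
import Data.Vec as Vec
open import Data.List as List using (List; []; _∷_; _++_; length)
open import Data.Integer as ℤ using (ℤ)
open import Data.Rational as ℚ using (ℚ; ½; -½; 0ℚ; 1ℚ)
import Data.Rational.Properties as ℚP
open import Data.Product using (Σ; ∃; ∃-syntax; _×_; _,_)
open import Data.Sum using (_⊎_)
open import Data.Unit using (⊤)
open import Relation.Nullary using (¬_; yes; no)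
open import Relation.Binary.PropositionalEquality using (_≡_; _≢_)

-- Faces: subsets of [n] = {0,…,n-1} encoded as characteristic vectors.

Face : ℕ → Set
Face n = Vec Bool n

_⊆F_ : ∀ {n} → Face n → Face n → Set
τ ⊆F σ = ∀ i → Vec.lookup τ i ≡ true → Vec.lookup σ i ≡ true

size : ∀ {n} → Face n → ℕ
size [] = 0
size (true ∷ σ) = suc (size σ)
size (false ∷ σ) = size σ

allFaces : (n : ℕ) → List (Face n)
allFaces zero = [] ∷ []
allFaces (suc n) = List.map (true ∷_) (allFaces n) ++ List.map (false ∷_) (allFaces n)

keep : ∀ {A : Set} → (A → Bool) → List A → List A
keep p [] = []
keep p (x ∷ xs) = if p x then x ∷ keep p xs else keep p xs

eqFace : ∀ {n} → Face n → Face n → Bool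
eqFace [] [] = true
eqFace (true ∷ σ) (true ∷ τ) = eqFace σ τ
eqFace (false ∷ σ) (false ∷ τ) = eqFace σ τ
eqFace (true ∷ σ) (false ∷ τ) = false
eqFace (false ∷ σ) (true ∷ τ) = false

-- Incidence coefficient [σ : τ] of the boundary map: if σ = {i₁<…<i_{j+1}}
-- and τ = σ ∖ {i_k} it is (-1)^(k+1), otherwise 0.  (Every vertex of σ
-- before the removed one flips the sign.)
coef : ∀ {n} → Face n → Face n → ℤ
coef [] [] = ℤ.0ℤ
coef (true ∷ σ) (true ∷ τ) = ℤ.- coef σ τ
coef (true ∷ σ) (false ∷ τ) = if eqFace σ τ then ℤ.1ℤ else ℤ.0ℤ
coef (false ∷ σ) (false ∷ τ) = coef σ τ
coef (false ∷ σ) (true ∷ τ) = ℤ.0ℤ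

record SimplicialComplex : Set where
  field
    n      : ℕ
    mem    : Face n → Bool
    closed : ∀ σ τ → τ ⊆F σ → mem σ ≡ true → mem τ ≡ true

open SimplicialComplex public

IsDim : SimplicialComplex → ℕ → Set
IsDim Δ d = (∃[ σ ] (mem Δ σ ≡ true × size σ ≡ suc d))
          × (∀ σ → mem Δ σ ≡ true → size σ ≤ suc d)

faces : (Δ : SimplicialComplex) → ℕ → List (Face (n Δ))
faces Δ j = keep (λ σ → mem Δ σ ∧ (size σ ℕ.≡ᵇ suc j)) (allFaces (n Δ))

f : SimplicialComplex → ℕ → ℕ
f Δ j = length (faces Δ j)

face : (Δ : SimplicialComplex) (j : ℕ) → Fin (f Δ j) → Face (n Δ)
face Δ j = List.lookup (faces Δ j)

sumℤ : ∀ {m} → (Fin m → ℤ) → ℤ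
sumℤ {zero} g = ℤ.0ℤ
sumℤ {suc m} g = g zero ℤ.+ sumℤ (λ i → g (suc i))

sumℚ : ∀ {m} → (Fin m → ℚ) → ℚ
sumℚ {zero} g = 0ℚ
sumℚ {suc m} g = g zero ℚ.+ sumℚ (λ i → g (suc i))

Chain : SimplicialComplex → ℕ → Set
Chain Δ j = Fin (f Δ j) → ℤ

bdEntry : (Δ : SimplicialComplex) (j : ℕ) → Fin (f Δ (suc j)) → Fin (f Δ j) → ℤ
bdEntry Δ j i t = coef (face Δ (suc j) i) (face Δ j t)

∂ : (Δ : SimplicialComplex) (j : ℕ) → Chain Δ (suc j) → Chain Δ j
∂ Δ j c t = sumℤ (λ i → bdEntry Δ j i t ℤ.* c i)

∂ℚ : (Δ : SimplicialComplex) (j : ℕ) → (Fin (f Δ (suc j)) → ℚ) → Fin (f Δ j) → ℚ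
∂ℚ Δ j v t = sumℚ (λ i → (bdEntry Δ j i t ℚ./ 1) ℚ.* v i)

-- k-cycles (ker ∂_k; for k = 0 every chain is a cycle, ∂_0 = 0)
IsCycle : (Δ : SimplicialComplex) (k : ℕ) → Chain Δ k → Set
IsCycle Δ zero z = ⊤
IsCycle Δ (suc k) z = ∀ t → ∂ Δ k z t ≡ ℤ.0ℤ

IsBoundary : (Δ : SimplicialComplex) (k : ℕ) → Chain Δ k → Set
IsBoundary Δ k z = ∃[ c ] (∀ t → ∂ Δ k c t ≡ z t)

-- Homology conditions, for d = suc k

-- H_{k+1}(Δ;ℤ) = 0, i.e. ker_ℤ ∂_{k+1} = 0 (Δ has no (k+2)-faces)
TopHomologyVanishes : SimplicialComplex → ℕ → Set
TopHomologyVanishes Δ k =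
  ∀ (c : Chain Δ (suc k)) → (∀ t → ∂ Δ k c t ≡ ℤ.0ℤ) → ∀ i → c i ≡ ℤ.0ℤ

HomologyVanishes : SimplicialComplex → ℕ → Set
HomologyVanishes Δ k = ∀ z → IsCycle Δ k z → IsBoundary Δ k z

-- H_k(Δ;ℤ) ≅ ℤ^ℓ ⊕ (ℤ₂)^r: a group homomorphism from the k-cycles onto
-- ℤ^ℓ × (ℤ₂)^r (ℤ₂ = Bool with xor) whose kernel is exactly the
-- boundaries (first isomorphism theorem).
HomologyIso : SimplicialComplex → ℕ → ℕ → ℕ → Set
HomologyIso Δ k ℓ r =
  Σ (Chain Δ k → Fin ℓ → ℤ) λ φ →
  Σ (Chain Δ k → Fin r → Bool) λ ψ →
    (∀ a b → IsCycle Δ k a → IsCycle Δ k b →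
       (∀ i → φ (λ t → a t ℤ.+ b t) i ≡ φ a i ℤ.+ φ b i)
     × (∀ i → ψ (λ t → a t ℤ.+ b t) i ≡ Data.Bool._xor_ (ψ a i) (ψ b i)))
  × (∀ (x : Fin ℓ → ℤ) (y : Fin r → Bool) →
       ∃[ z ] (IsCycle Δ k z × (∀ i → φ z i ≡ x i) × (∀ i → ψ z i ≡ y i)))
  × (∀ z → IsCycle Δ k z →
       ((∀ i → φ z i ≡ ℤ.0ℤ) × (∀ i → ψ z i ≡ false)) → IsBoundary Δ k z)
  × (∀ z → IsCycle Δ k z → IsBoundary Δ k z →
       ((∀ i → φ z i ≡ ℤ.0ℤ) × (∀ i → ψ z i ≡ false)))
  where import Data.Bool

IsTorsion : (Δ : SimplicialComplex) (k : ℕ) → Chain Δ k → Set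
IsTorsion Δ k z = IsCycle Δ k z × Σ ℕ λ m → IsBoundary Δ k (λ t → ℤ.+ (suc m) ℤ.* z t)

GeneratesTorsion : (Δ : SimplicialComplex) (k r : ℕ) → (Fin r → Chain Δ k) → Set
GeneratesTorsion Δ k r w =
  (∀ j → IsTorsion Δ k (w j))
  × (∀ z → IsTorsion Δ k z →
       Σ (Fin r → ℤ) λ a → IsBoundary Δ k (λ t → z t ℤ.- sumℤ (λ j → a j ℤ.* w j t)))

EvenN : ℕ → Set
EvenN m = ∃[ q ] m ≡ q ℕ.+ q

OddN : ℕ → Set
OddN m = ∃[ q ] m ≡ suc (q ℕ.+ q)

nnz : ∀ {s} → (Fin s → ℚ) → ℕ
nnz {zero} v = 0
nnz {suc s} v with v zero ℚP.≟ 0ℚ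
... | yes _ = nnz (λ i → v (suc i))
... | no _ = suc (nnz (λ i → v (suc i)))

GoodHalfVector : ∀ {s} → (Fin s → ℚ) → Set
GoodHalfVector v =
  (∀ i → v i ≡ ½ ⊎ v i ≡ -½ ⊎ v i ≡ 0ℚ)
  × ¬ (∀ i → v i ≡ 0ℚ)
  × EvenN (nnz v)

Cond1 Cond2 Cond3 : SimplicialComplex → ℕ → Set
Cond1 Δ k = HomologyVanishes Δ k
Cond2 Δ k = EvenN (suc k) × ∃[ ℓ ] ∃[ r ] HomologyIso Δ k ℓ r
Cond3 Δ k = OddN (suc k) × ∃[ ℓ ] ∃[ r ] (HomologyIso Δ k ℓ r ×
  Σ (Fin r → Fin (f Δ (suc k)) → ℚ) λ v → Σ (Fin r → Chain Δ k) λ w →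
    ((∀ j → GoodHalfVector {f Δ (suc k)} (v j)
          × (∀ t → ∂ℚ Δ k (v j) t ≡ (w j t ℚ./ 1)))
     × GeneratesTorsion Δ k r w))

-- The symmetric homology polytope P_Δ = conv(±columns of ∂_d) ⊆ ℚ^{f_{d-1}}

Point : SimplicialComplex → ℕ → Set
Point Δ k = Fin (f Δ k) → ℚ

dot : ∀ {m} → (Fin m → ℚ) → (Fin m → ℚ) → ℚ
dot c x = sumℚ (λ t → c t ℚ.* x t)

InP : (Δ : SimplicialComplex) (k : ℕ) → Point Δ k → Set
InP Δ k x =
  Σ (Fin (f Δ (suc k)) → ℚ) λ λp → Σ (Fin (f Δ (suc k)) → ℚ) λ λn →
    (∀ i → 0ℚ ℚ.≤ λp i) × (∀ i → 0ℚ ℚ.≤ λn i)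
    × (sumℚ λp ℚ.+ sumℚ λn ≡ 1ℚ)
    × (∀ t → x t ≡ sumℚ (λ i → (λp i ℚ.- λn i) ℚ.* (bdEntry Δ k i t ℚ./ 1)))

AffinelyIndependent : ∀ {m N} → (Fin N → Fin m → ℚ) → Set
AffinelyIndependent {m} {N} p =
  ∀ (μ : Fin N → ℚ) → sumℚ μ ≡ 0ℚ →
    (∀ t → sumℚ (λ a → μ a ℚ.* p a t) ≡ 0ℚ) → ∀ a → μ a ≡ 0ℚ

HasAffIndep : ∀ {m} → ((Fin m → ℚ) → Set) → ℕ → Set
HasAffIndep {m} S N =
  Σ (Fin N → Fin m → ℚ) λ p → (∀ a → S (p a)) × AffinelyIndependent p

HasDim : ∀ {m} → ((Fin m → ℚ) → Set) → ℕ → Set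
HasDim S D = HasAffIndep S (suc D) × ¬ HasAffIndep S (suc (suc D))

FaceOf : (Δ : SimplicialComplex) (k : ℕ) → Point Δ k → ℚ → Point Δ k → Set
FaceOf Δ k c h x = InP Δ k x × dot c x ≡ h

IsFacet : (Δ : SimplicialComplex) (k : ℕ) → Point Δ k → ℚ → Set
IsFacet Δ k c h =
  (∀ x → InP Δ k x → dot c x ℚ.≤ h)
  × ∃[ D ] (HasDim (InP Δ k) (suc D) × HasDim (FaceOf Δ k c h) D)

Reflexive : SimplicialComplex → ℕ → Set
Reflexive Δ k =
  ∀ (c : Point Δ k) (h : ℚ) → IsFacet Δ k c h →
    Σ (Fin (f Δ k) → ℤ) λ w → let wq = λ t → (w t ℚ./ 1) in
      (∀ x → InP Δ k x → dot wq x ℚ.≤ 1ℚ)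
      × (∀ x → FaceOf Δ k c h x → InP Δ k x × dot wq x ≡ 1ℚ)
      × (∀ x → InP Δ k x → dot wq x ≡ 1ℚ → FaceOf Δ k c h x)

{-# OPTIONS --safe #-}

-- Let B be the matrix of ∂_d.  Its columns B_i are independent, so the polytope is a cross-polytope whose facets
-- correspond to sign vectors ε, and it is reflexive iff wᵀB = ε has an integral solution w for every ε.
-- By Kronecker's criterion, solvability for ε means that n divides εᵀc whenever Bc = nz with z integral; such z are
-- the torsion chains.  Since all signs are allowed, this says that 2z = Bg with Σ g even for every torsion chain z.
-- For d even the parity is automatic, because a d-simplex then has boundary coefficients of sum 1; for d odd it
-- can be tested on generators B(g/2) of the torsion.
-- Conversely, solutions for all sign vectors yield integral w_i with w_iᵀB_j = 2δ_ij.  The pairings w_iᵀz reduced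
-- mod 2 map the torsion isomorphically onto the kernel of B mod 2, which splits it off the homology, and
-- z ↦ 2z − Σ (w_iᵀz) B_i maps the cycles onto a free group with the torsion cycles as kernel.
module Submission where

open import Defs
open import Algebra.Core using (Op₁; Op₂)
open import Algebra.Bundles using (AbelianGroup; CommutativeRing)
import Algebra.Properties.Group
open import Algebra.Structures using (IsCommutativeRing)
open import Data.Bool using (Bool; true; false; if_then_else_; not; T; _xor_; _∧_)
import Data.Bool.Properties as BoolP
open import Data.Empty using (⊥; ⊥-elim)
open import Data.Fin using (Fin; zero; suc)
open import Data.Integer as ℤ using (ℤ; -[1+_]; 0ℤ; 1ℤ; -1ℤ)
import Data.Integer.Properties as ℤP
import Data.Integer.Tactic.RingSolver as ℤS
open import Data.List as List using (List; []; _∷_; _++_)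
open import Data.List.Membership.Propositional using (_∈_)
open import Data.List.Membership.Propositional.Properties using (∈-map⁺; ∈-++⁺ˡ; ∈-++⁺ʳ)
open import Data.List.Relation.Unary.Any using (here; there; index)
open import Data.Nat as ℕ using (ℕ; zero; suc; _≤_; z≤n; s≤s)
open import Data.Nat.Divisibility using (divides)
open import Data.Nat.GCD using (module Bézout; mkGCD; GCD)
import Data.Nat.Properties as ℕP
open import Data.Product using (Σ; ∃; ∃-syntax; _×_; _,_; proj₁; proj₂)
open import Data.Rational as ℚ using (ℚ; 0ℚ; 1ℚ; ½; -½)
import Data.Rational.Properties as ℚP
open import Data.Rational.Unnormalised as ℚᵘ using (mkℚᵘ; *≡*)
import Data.Rational.Unnormalised.Properties as ℚᵘP
open import Data.Sum using (_⊎_; inj₁; inj₂)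
open import Data.Unit using (tt)
open import Data.Vec as Vec using (Vec; []; _∷_; head; tail; lookup; tabulate; replicate; zipWith)
import Data.Vec.Properties as VecP
open import Function using (_∘_; id)
open import Function.Bundles using (_⇔_; mk⇔)
open import Level using (0ℓ)
open import Relation.Binary.PropositionalEquality
open import Relation.Nullary using (¬_; Dec; yes; no)
open import Relation.Nullary.Decidable.Core using (dec⇒maybe)
import Tactic.RingSolver as RingSolver
import Tactic.RingSolver.Core.AlmostCommutativeRing as ACR
open ≡-Reasoning

-- The same elimination serves three rings, which is why it is carried out over a Bézout domain:
-- over ℚ it yields the facet normal of a sign vector and bounds the number of affinely independent
-- points; over ℤ it solves for w and gives coordinates on the cycles; over the field with two
-- elements it describes the kernel of B mod 2. The number 2 enters through sign vectors that differ
-- in one place i: their solutions differ by a w with values ± 2 at the i-th column and 0 at the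
-- others. So a torsion chain z, being a rational combination of columns, satisfies 2z = Σ (w_iᵀz)
-- B_i, and no torsion beyond ℤ₂ can occur. The isomorphism of homology has to be given by functions
-- on chains whose kernel on the cycles is the group of boundaries. Both components are therefore
-- additive maps defined on all chains, built from the coordinates in `FreeKernel`, and no quotient
-- group is formed. In particular the ℤ₂-component makes sense beyond the torsion chains, which is
-- what splits the homology.

module ℤG = Algebra.Properties.Group (AbelianGroup.group ℤP.+-0-abelianGroup)

-- Linear algebra over Bézout domains

-- Summation is a field so that the instances can use the very sums of the theorem. `bezout` asks
-- for coprime quotients instead of a gcd combination: this form gives a matrix of determinant 1
-- even when both elements are 0.
record BezoutDomain : Set₁ where
  infixl 6 _+_
  infixl 7 _*_
  infix  8 -_
  field
    A                 : Set
    _+_ _*_           : Op₂ A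
    -_                : Op₁ A
    0# 1#             : A
    isCommutativeRing : IsCommutativeRing _≡_ _+_ _*_ -_ 0# 1#
    _≟0               : ∀ x → Dec (x ≡ 0#)
    1≢0               : 1# ≢ 0#
    cancel            : ∀ x {y} → x ≢ 0# → x * y ≡ 0# → y ≡ 0#
    ∑                 : ∀ {n} → (Fin n → A) → A
    ∑-zero            : ∀ (x : Fin 0 → A) → ∑ x ≡ 0#
    ∑-suc             : ∀ {n} (x : Fin (suc n) → A) → ∑ x ≡ x zero + ∑ (x ∘ suc)
    bezout            : ∀ x y → ∃[ g ] ∃[ x′ ] ∃[ y′ ] ∃[ u ] ∃[ v ]
                        (x ≡ x′ * g × y ≡ y′ * g × x′ * u + y′ * v ≡ 1#)

  commutativeRing : CommutativeRing _ _
  commutativeRing = record { isCommutativeRing = isCommutativeRing }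

module LinearAlgebra (D : BezoutDomain) where
  open BezoutDomain D public using (A; _+_; _*_; -_; 0#; 1#; _≟0; 1≢0; cancel; ∑; ∑-zero; ∑-suc; bezout)
  open CommutativeRing (BezoutDomain.commutativeRing D) public
    using (+-identityˡ; +-identityʳ; +-comm; +-assoc; *-comm; *-assoc; *-identityˡ; *-identityʳ;
           distribˡ; distribʳ; zeroˡ; zeroʳ; -‿inverseˡ; -‿inverseʳ; semiring; commutativeSemiring)
  import Algebra.Properties.Semiring.Sum semiring as Sum
  open import Algebra.Solver.Ring.NaturalCoefficients.Default commutativeSemiring public
    using (solve; _:=_; _:+_; _:*_)

  ∑≡sum : ∀ {n} (x : Fin n → A) → ∑ x ≡ Sum.sum x
  ∑≡sum {zero} x = ∑-zero x
  ∑≡sum {suc n} x = trans (∑-suc x) (cong (x zero +_) (∑≡sum (x ∘ suc)))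

  ∑-cong : ∀ {n} {x y : Fin n → A} → (∀ i → x i ≡ y i) → ∑ x ≡ ∑ y
  ∑-cong {x = x} {y} e = trans (∑≡sum x) (trans (Sum.sum-cong-≗ e) (sym (∑≡sum y)))

  ∑-+ : ∀ {n} (x y : Fin n → A) → ∑ (λ i → x i + y i) ≡ ∑ x + ∑ y
  ∑-+ x y = trans (∑≡sum _) (trans (Sum.∑-distrib-+ x y) (sym (cong₂ _+_ (∑≡sum x) (∑≡sum y))))

  ∑-*ˡ : ∀ {n} c (x : Fin n → A) → ∑ (λ i → c * x i) ≡ c * ∑ x
  ∑-*ˡ c x = trans (∑≡sum _) (trans (sym (Sum.*-distribˡ-sum c x)) (cong (c *_) (sym (∑≡sum x))))

  ∑-*ʳ : ∀ {n} c (x : Fin n → A) → ∑ (λ i → x i * c) ≡ ∑ x * c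
  ∑-*ʳ c x = trans (∑-cong (λ i → *-comm (x i) c)) (trans (∑-*ˡ c x) (*-comm c (∑ x)))

  ∑-swap : ∀ {m n} (x : Fin m → Fin n → A) → ∑ (λ i → ∑ (λ j → x i j)) ≡ ∑ (λ j → ∑ (λ i → x i j))
  ∑-swap x = trans (swapped (λ i j → x i j)) (trans (Sum.∑-comm x) (sym (swapped (λ j i → x i j))))
    where swapped : ∀ {m n} (x : Fin m → Fin n → A) → ∑ (λ i → ∑ (x i)) ≡ Sum.sum (λ i → Sum.sum (x i))
          swapped x = trans (∑≡sum _) (Sum.sum-cong-≗ (λ i → ∑≡sum (x i)))

  ∑-0 : ∀ {n} (x : Fin n → A) → (∀ i → x i ≡ 0#) → ∑ x ≡ 0#
  ∑-0 {n} x z = trans (∑≡sum x) (trans (Sum.sum-cong-≗ z) (Sum.sum-replicate-zero n))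

  ∑-assoc : ∀ {m n} (x : Fin m → A) (y : Fin m → Fin n → A) (z : Fin n → A) →
            ∑ (λ i → x i * ∑ (λ j → y i j * z j)) ≡ ∑ (λ j → ∑ (λ i → x i * y i j) * z j)
  ∑-assoc x y z = begin
    ∑ (λ i → x i * ∑ (λ j → y i j * z j))     ≡⟨ ∑-cong (λ i → trans (sym (∑-*ˡ (x i) (λ j → y i j * z j))) (∑-cong (λ j → sym (*-assoc (x i) (y i j) (z j))))) ⟩
    ∑ (λ i → ∑ (λ j → x i * y i j * z j))     ≡⟨ ∑-swap (λ i j → x i * y i j * z j) ⟩
    ∑ (λ j → ∑ (λ i → x i * y i j * z j))     ≡⟨ ∑-cong (λ j → trans (∑-cong (λ i → *-comm (x i * y i j) (z j))) (trans (∑-*ˡ (z j) (λ i → x i * y i j)) (*-comm _ _))) ⟩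
    ∑ (λ j → ∑ (λ i → x i * y i j) * z j)     ∎

  unit : ∀ {n} → Fin n → Fin n → A
  unit zero    zero    = 1#
  unit zero    (suc j) = 0#
  unit (suc i) zero    = 0#
  unit (suc i) (suc j) = unit i j

  ∑-unit : ∀ {n} (i : Fin n) (x : Fin n → A) → ∑ (λ j → unit i j * x j) ≡ x i
  ∑-unit {suc n} zero x = trans (∑-suc _) (trans (cong₂ _+_ (*-identityˡ (x zero)) (∑-0 {n} _ (λ j → zeroˡ (x (suc j))))) (+-identityʳ _))
  ∑-unit (suc i) x = trans (∑-suc _) (trans (cong₂ _+_ (zeroˡ (x zero)) (∑-unit i (x ∘ suc))) (+-identityˡ _))

  infixl 6 _⊕_
  infix  7 _·_

  _⊕_ : ∀ {p} → Vec A p → Vec A p → Vec A p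
  _⊕_ = zipWith _+_

  𝟘 : ∀ {p} → Vec A p
  𝟘 = replicate _ 0#

  _·_ : ∀ {p} → Vec A p → Vec A p → A
  [] · [] = 0#
  (x ∷ xs) · (y ∷ ys) = x * y + xs · ys

  𝟘-· : ∀ {p} (v : Vec A p) → 𝟘 · v ≡ 0#
  𝟘-· [] = refl
  𝟘-· (x ∷ v) = trans (cong₂ _+_ (zeroˡ x) (𝟘-· v)) (+-identityˡ 0#)

  ·-𝟘 : ∀ {p} (v : Vec A p) → v · 𝟘 ≡ 0#
  ·-𝟘 [] = refl
  ·-𝟘 (x ∷ v) = trans (cong₂ _+_ (zeroʳ x) (·-𝟘 v)) (+-identityˡ 0#)

  -- A change of coordinates, with its transpose tr acting on row vectors.
  record Iso (p n : ℕ) : Set where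
    field
      to      : Vec A p → Vec A n
      from    : Vec A n → Vec A p
      tr      : Vec A p → Vec A n
      to-from : ∀ x → to (from x) ≡ x
      from-to : ∀ v → from (to v) ≡ v
      to-⊕    : ∀ u v → to (u ⊕ v) ≡ to u ⊕ to v
      adjoint : ∀ r x → r · from x ≡ tr r · x

    adjoint′ : ∀ r v → r · v ≡ tr r · to v
    adjoint′ r v = trans (cong (r ·_) (sym (from-to v))) (adjoint r (to v))

  open Iso

  idIso : ∀ {p} → Iso p p
  idIso = record { to = id ; from = id ; tr = id ; to-from = λ _ → refl ; from-to = λ _ → refl
                 ; to-⊕ = λ _ _ → refl ; adjoint = λ _ _ → refl }

  infixr 9 _∘I_
  _∘I_ : ∀ {p q r} → Iso q r → Iso p q → Iso p r
  J ∘I I = record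
    { to = to J ∘ to I ; from = from I ∘ from J ; tr = tr J ∘ tr I
    ; to-from = λ x → trans (cong (to J) (to-from I _)) (to-from J x)
    ; from-to = λ v → trans (cong (from I) (from-to J _)) (from-to I v)
    ; to-⊕ = λ u v → trans (cong (to J) (to-⊕ I u v)) (to-⊕ J _ _)
    ; adjoint = λ r x → trans (adjoint I r _) (adjoint J _ x) }

  extend : ∀ {p n} → Iso p n → Iso (suc p) (suc n)
  extend I = record
    { to = λ { (x ∷ v) → x ∷ to I v } ; from = λ { (x ∷ v) → x ∷ from I v } ; tr = λ { (x ∷ v) → x ∷ tr I v }
    ; to-from = λ { (x ∷ v) → cong (x ∷_) (to-from I v) }
    ; from-to = λ { (x ∷ v) → cong (x ∷_) (from-to I v) }
    ; to-⊕ = λ { (x ∷ u) (y ∷ v) → cong (x + y ∷_) (to-⊕ I u v) }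
    ; adjoint = λ { (x ∷ r) (y ∷ v) → cong (x * y +_) (adjoint I r v) } }

  -- Multiplication of the first two coordinates by a matrix of determinant 1.
  shear : ∀ {p} (a b u v : A) → a * u + b * v ≡ 1# → Iso (suc (suc p)) (suc (suc p))
  shear {p} a b u v det = record
    { to = to′ ; from = from′ ; tr = tr′
    ; to-from = λ { (x ∷ y ∷ w) → cong₂ (λ s t → s ∷ t ∷ w)
        (begin
          a * (u * x + - b * y) + b * (v * x + a * y)
            ≡⟨ solve 7 (λ a b c u v x y → a :* (u :* x :+ c :* y) :+ b :* (v :* x :+ a :* y)
                          := (a :* u :+ b :* v) :* x :+ (c :+ b) :* (a :* y)) refl a b (- b) u v x y ⟩
          (a * u + b * v) * x + (- b + b) * (a * y)  ≡⟨ cofactor det (-‿inverseˡ b) x (a * y) ⟩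
          x ∎)
        (begin
          - v * (u * x + - b * y) + u * (v * x + a * y)
            ≡⟨ solve 7 (λ a d b u v x y → d :* (u :* x :+ b :* y) :+ u :* (v :* x :+ a :* y)
                          := (a :* u :+ d :* b) :* y :+ (d :+ v) :* (u :* x)) refl a (- v) (- b) u v x y ⟩
          (a * u + - v * - b) * y + (- v + v) * (u * x)
            ≡⟨ cofactor (trans (cong (a * u +_) (neg-neg v b)) det) (-‿inverseˡ v) y (u * x) ⟩
          y ∎) }
    ; from-to = λ { (x ∷ y ∷ w) → cong₂ (λ s t → s ∷ t ∷ w)
        (begin
          u * (a * x + b * y) + - b * (- v * x + u * y)
            ≡⟨ solve 7 (λ a b c d u x y → u :* (a :* x :+ b :* y) :+ c :* (d :* x :+ u :* y)
                          := (a :* u :+ d :* c) :* x :+ (c :+ b) :* (u :* y)) refl a b (- b) (- v) u x y ⟩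
          (a * u + - v * - b) * x + (- b + b) * (u * y)
            ≡⟨ cofactor (trans (cong (a * u +_) (neg-neg v b)) det) (-‿inverseˡ b) x (u * y) ⟩
          x ∎)
        (begin
          v * (a * x + b * y) + a * (- v * x + u * y)
            ≡⟨ solve 7 (λ a b d u v x y → v :* (a :* x :+ b :* y) :+ a :* (d :* x :+ u :* y)
                          := (a :* u :+ b :* v) :* y :+ (d :+ v) :* (a :* x)) refl a b (- v) u v x y ⟩
          (a * u + b * v) * y + (- v + v) * (a * x)  ≡⟨ cofactor det (-‿inverseˡ v) y (a * x) ⟩
          y ∎) }
    ; to-⊕ = λ { (x ∷ y ∷ w) (x₁ ∷ y₁ ∷ w₁) → cong₂ (λ s t → s ∷ t ∷ w ⊕ w₁) (lin a b x x₁ y y₁) (lin (- v) u x x₁ y y₁) }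
    ; adjoint = λ { (r ∷ s ∷ q) (x ∷ y ∷ w) →
        solve 9 (λ r s a c u v x y t → r :* (u :* x :+ c :* y) :+ (s :* (v :* x :+ a :* y) :+ t)
                   := (r :* u :+ s :* v) :* x :+ ((r :* c :+ s :* a) :* y :+ t)) refl r s a (- b) u v x y (q · w) } }
    where
    to′ from′ tr′ : Vec A (suc (suc p)) → Vec A (suc (suc p))
    to′   (x ∷ y ∷ w) = a * x + b * y ∷ - v * x + u * y ∷ w
    from′ (x ∷ y ∷ w) = u * x + - b * y ∷ v * x + a * y ∷ w
    tr′   (r ∷ s ∷ q) = r * u + s * v ∷ r * - b + s * a ∷ q
    neg-neg : ∀ s t → - s * - t ≡ t * s
    neg-neg s t = begin
      - s * - t               ≡⟨ +-identityʳ _ ⟨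
      - s * - t + 0#          ≡⟨ cong (- s * - t +_) (trans (cong (t *_) (-‿inverseˡ s)) (zeroʳ t)) ⟨
      - s * - t + t * (- s + s) ≡⟨ solve 4 (λ s t n m → n :* m :+ t :* (n :+ s) := n :* (m :+ t) :+ t :* s) refl s t (- s) (- t) ⟩
      - s * (- t + t) + t * s ≡⟨ cong (λ z → - s * z + t * s) (-‿inverseˡ t) ⟩
      - s * 0# + t * s        ≡⟨ cong (_+ t * s) (zeroʳ _) ⟩
      0# + t * s              ≡⟨ +-identityˡ _ ⟩
      t * s ∎
    -- Negatives enter the identities above as independent variables. Here the determinant, equal to
    -- 1, and the sum of a variable with its negative, equal to 0, are put in.
    cofactor : ∀ {m n} → m ≡ 1# → n ≡ 0# → ∀ x y → m * x + n * y ≡ x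
    cofactor refl refl x y = trans (cong₂ _+_ (*-identityˡ x) (zeroˡ y)) (+-identityʳ x)
    lin : ∀ a b x x₁ y y₁ → a * (x + x₁) + b * (y + y₁) ≡ (a * x + b * y) + (a * x₁ + b * y₁)
    lin = solve 6 (λ a b x x₁ y y₁ → a :* (x :+ x₁) :+ b :* (y :+ y₁) := (a :* x :+ b :* y) :+ (a :* x₁ :+ b :* y₁)) refl

  -- Column operations collect the gcd from the right: the tail becomes h followed by zeros, and one
  -- shear made from a Bézout relation for x and h turns this pair into g and 0.
  hermite : ∀ {p} (r : Vec A (suc p)) → ∃[ g ] Σ (Iso (suc p) (suc p)) λ I → tr I r ≡ g ∷ 𝟘
  hermite (x ∷ []) = x , idIso , refl
  hermite (x ∷ r@(_ ∷ _)) with hermite r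
  ... | h , I , eq with bezout x h
  ... | g , a , b , u , v , x≡ , h≡ , det = g , shear a b u v det ∘I extend I ,
        trans (cong (tr (shear a b u v det)) (cong (x ∷_) eq))
              (cong₂ (λ s t → s ∷ t ∷ 𝟘) eq₁ eq₂)
    where
    eq₁ : x * u + h * v ≡ g
    eq₁ = begin
      x * u + h * v               ≡⟨ cong₂ (λ s t → s * u + t * v) x≡ h≡ ⟩
      a * g * u + b * g * v       ≡⟨ solve 5 (λ a b g u v → a :* g :* u :+ b :* g :* v := (a :* u :+ b :* v) :* g) refl a b g u v ⟩
      (a * u + b * v) * g         ≡⟨ cong (_* g) det ⟩
      1# * g                      ≡⟨ *-identityˡ g ⟩
      g ∎
    eq₂ : x * - b + h * a ≡ 0#
    eq₂ = begin
      x * - b + h * a             ≡⟨ cong₂ (λ s t → s * - b + t * a) x≡ h≡ ⟩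
      a * g * - b + b * g * a     ≡⟨ solve 4 (λ a b n g → a :* g :* n :+ b :* g :* a := a :* g :* (n :+ b)) refl a b (- b) g ⟩
      a * g * (- b + b)           ≡⟨ cong (a * g *_) (-‿inverseˡ b) ⟩
      a * g * 0#                  ≡⟨ zeroʳ _ ⟩
      0# ∎

  -- The reduced matrix itself is not kept, only coordinates in which the common kernel of the rows
  -- is given by the vanishing of the first `rank` entries.
  record Echelon {q p} (C : Fin q → Vec A p) : Set where
    field
      rank nullity : ℕ
      rank≤ : rank ≤ q
      size≡  : p ≡ rank ℕ.+ nullity
      iso   : Iso p (rank ℕ.+ nullity)
      ker→  : ∀ v → (∀ i → C i · v ≡ 0#) → Vec.take rank (to iso v) ≡ 𝟘
      ker←  : ∀ v → Vec.take rank (to iso v) ≡ 𝟘 → ∀ i → C i · v ≡ 0#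

  -- A first row with g = 0 imposes no condition. If g is nonzero, g x = 0 forces x = 0 in a domain,
  -- whatever the size of the pivot, and the other rows become conditions on the remaining
  -- coordinates.
  echelon : ∀ {q p} (C : Fin q → Vec A p) → Echelon C
  echelon {zero} {p} C = record { rank = 0 ; nullity = p ; rank≤ = z≤n ; size≡ = refl ; iso = idIso
                                ; ker→ = λ _ _ → refl ; ker← = λ _ _ () }
  echelon {suc q} {zero} C = record { rank = 0 ; nullity = 0 ; rank≤ = z≤n ; size≡ = refl ; iso = idIso
                                    ; ker→ = λ _ _ → refl ; ker← = λ { [] _ i → nil (C i) } }
    where nil : ∀ (r : Vec A 0) → r · [] ≡ 0#
          nil [] = refl
  echelon {suc q} {suc p} C with hermite (C zero)
  ... | g , I , eq with g ≟0
  ...   | yes refl = record { rank = rank ; nullity = nullity ; rank≤ = ℕP.m≤n⇒m≤1+n rank≤ ; size≡ = size≡ ; iso = iso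
                            ; ker→ = λ v z → ker→ v (z ∘ suc)
                            ; ker← = λ { v t zero → trans (adjoint′ I (C zero) v) (trans (cong (_· to I v) eq) (𝟘-· (to I v)))
                                       ; v t (suc i) → ker← v t i } }
    where open Echelon (echelon (C ∘ suc))
  ...   | no g≢0 = record { rank = suc rank ; nullity = nullity ; rank≤ = s≤s rank≤ ; size≡ = cong suc size≡
                          ; iso = extend iso ∘I I
                          ; ker→ = λ v z → ker→′ v (to I v) refl z
                          ; ker← = λ v → ker←′ v (to I v) refl }
    where
    C′ : Fin q → Vec A p
    C′ i = tail (tr I (C (suc i)))
    open Echelon (echelon C′)
    pivot : ∀ v x w → to I v ≡ x ∷ w → C zero · v ≡ g * x
    pivot v x w e = trans (adjoint′ I (C zero) v) (trans (cong₂ _·_ eq e) (trans (cong (g * x +_) (𝟘-· w)) (+-identityʳ _)))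
    cut : ∀ (r : Vec A (suc p)) w → r · (0# ∷ w) ≡ tail r · w
    cut (y ∷ r) w = trans (cong (_+ r · w) (zeroʳ y)) (+-identityˡ _)
    rest : ∀ v w → to I v ≡ 0# ∷ w → ∀ i → C (suc i) · v ≡ C′ i · w
    rest v w e i = trans (adjoint′ I (C (suc i)) v) (trans (cong (tr I (C (suc i)) ·_) e) (cut (tr I (C (suc i))) w))
    ker→′ : ∀ v xw → to I v ≡ xw → (∀ i → C i · v ≡ 0#) → Vec.take (suc rank) (to (extend iso) xw) ≡ 𝟘
    ker→′ v (x ∷ w) e z with cancel g g≢0 (trans (sym (pivot v x w e)) (z zero))
    ... | refl = cong (0# ∷_) (ker→ w (λ i → trans (sym (rest v w e i)) (z (suc i))))
    ker←′ : ∀ v xw → to I v ≡ xw → Vec.take (suc rank) (to (extend iso) xw) ≡ 𝟘 → ∀ i → C i · v ≡ 0#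
    ker←′ v (x ∷ w) e t i with VecP.∷-injectiveˡ t
    ker←′ v (x ∷ w) e t zero    | refl = trans (pivot v x w e) (zeroʳ g)
    ker←′ v (x ∷ w) e t (suc i) | refl = trans (rest v w e i) (ker← w (VecP.∷-injectiveʳ t) i)

  lookup-⊕ : ∀ {p} (u v : Vec A p) i → lookup (u ⊕ v) i ≡ lookup u i + lookup v i
  lookup-⊕ u v i = VecP.lookup-zipWith _+_ i u v

  take-⊕ : ∀ a {b} (u v : Vec A (a ℕ.+ b)) → Vec.take a (u ⊕ v) ≡ Vec.take a u ⊕ Vec.take a v
  take-⊕ a u v = VecP.take-zipWith _+_ u v

  drop-⊕ : ∀ a {b} (u v : Vec A (a ℕ.+ b)) → Vec.drop a (u ⊕ v) ≡ Vec.drop a u ⊕ Vec.drop a v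
  drop-⊕ a u v = VecP.drop-zipWith _+_ u v

  tabulate-⊕ : ∀ {p} (x y : Fin p → A) → tabulate (λ t → x t + y t) ≡ tabulate x ⊕ tabulate y
  tabulate-⊕ {zero} x y = refl
  tabulate-⊕ {suc p} x y = cong (x zero + y zero ∷_) (tabulate-⊕ (x ∘ suc) (y ∘ suc))

  tabulate-0 : ∀ {p} (x : Fin p → A) → (∀ t → x t ≡ 0#) → tabulate x ≡ 𝟘
  tabulate-0 {zero} x z = refl
  tabulate-0 {suc p} x z = cong₂ _∷_ (z zero) (tabulate-0 (x ∘ suc) (z ∘ suc))

  ·-∑ : ∀ {p} (u v : Vec A p) → u · v ≡ ∑ (λ t → lookup u t * lookup v t)
  ·-∑ [] [] = sym (∑-zero _)
  ·-∑ (x ∷ u) (y ∷ v) = trans (cong (x * y +_) (·-∑ u v)) (sym (∑-suc _))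

  tabulate-· : ∀ {p} (x y : Fin p → A) → tabulate x · tabulate y ≡ ∑ (λ t → x t * y t)
  tabulate-· {zero} x y = sym (∑-zero _)
  tabulate-· {suc p} x y = trans (cong (x zero * y zero +_) (tabulate-· (x ∘ suc) (y ∘ suc))) (sym (∑-suc _))

  basis : ∀ {p} → Fin p → Vec A p
  basis zero = 1# ∷ 𝟘
  basis (suc t) = 0# ∷ basis t

  basis-· : ∀ {p} (t : Fin p) v → basis t · v ≡ lookup v t
  basis-· zero (x ∷ v) = trans (cong₂ _+_ (*-identityˡ x) (𝟘-· v)) (+-identityʳ x)
  basis-· (suc t) (x ∷ v) = trans (cong₂ _+_ (zeroˡ x) (basis-· t v)) (+-identityˡ _)

  ·-++𝟘 : ∀ a {b} (r v : Vec A (a ℕ.+ b)) → Vec.take a v ≡ 𝟘 → r · v ≡ Vec.drop a r · Vec.drop a v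
  ·-++𝟘 zero r v z = refl
  ·-++𝟘 (suc a) (x ∷ r) (y ∷ v) z =
    trans (cong₂ (λ s t → x * s + t) (VecP.∷-injectiveˡ z) (·-++𝟘 a r v (VecP.∷-injectiveʳ z)))
          (trans (cong (_+ Vec.drop a r · Vec.drop a v) (zeroʳ x)) (+-identityˡ _))

  take-++ : ∀ {a b} (x : Vec A a) (y : Vec A b) → Vec.take a (x Vec.++ y) ≡ x
  take-++ {a} x y = VecP.++-injectiveˡ _ x (VecP.take++drop≡id a (x Vec.++ y))

  drop-++ : ∀ {a b} (x : Vec A a) (y : Vec A b) → Vec.drop a (x Vec.++ y) ≡ y
  drop-++ {a} x y = VecP.++-injectiveʳ _ x (VecP.take++drop≡id a (x Vec.++ y))

  -- α and β are coordinates of the image and of the kernel of C; the columns of G are a basis of the kernel.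
  record FreeKernel {q p} (C : Fin q → Fin p → A) : Set where
    field
      rank nullity : ℕ
      rank≤  : rank ≤ q
      size≡   : p ≡ rank ℕ.+ nullity
      α      : (Fin p → A) → Fin rank → A
      β      : (Fin p → A) → Fin nullity → A
      γ      : (Fin rank → A) → (Fin nullity → A) → Fin p → A
      G      : Fin p → Fin nullity → A
      α-cong : ∀ {u v} → (∀ t → u t ≡ v t) → ∀ i → α u i ≡ α v i
      β-cong : ∀ {u v} → (∀ t → u t ≡ v t) → ∀ i → β u i ≡ β v i
      α-+    : ∀ u v i → α (λ t → u t + v t) i ≡ α u i + α v i
      β-+    : ∀ u v i → β (λ t → u t + v t) i ≡ β u i + β v i
      α-γ    : ∀ x y i → α (γ x y) i ≡ x i
      β-γ    : ∀ x y i → β (γ x y) i ≡ y i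
      ker→   : ∀ v → (∀ i → ∑ (λ t → C i t * v t) ≡ 0#) → ∀ j → α v j ≡ 0#
      ker←   : ∀ v → (∀ j → α v j ≡ 0#) → ∀ i → ∑ (λ t → C i t * v t) ≡ 0#
      recon  : ∀ v → (∀ j → α v j ≡ 0#) → ∀ t → v t ≡ ∑ (λ j → G t j * β v j)

  freeKernel : ∀ {q p} (C : Fin q → Fin p → A) → FreeKernel C
  freeKernel {q} {p} C = record
    { rank = rank ; nullity = nullity ; rank≤ = rank≤ ; size≡ = size≡
    ; α = λ v → lookup (αV (tabulate v)) ; β = λ v → lookup (βV (tabulate v))
    ; γ = λ x y → lookup (from iso (tabulate x Vec.++ tabulate y))
    ; G = λ t → lookup (Vec.drop rank (tr iso (basis t)))
    ; α-cong = λ e i → cong (λ v → lookup (αV v) i) (VecP.tabulate-cong e)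
    ; β-cong = λ e i → cong (λ v → lookup (βV v) i) (VecP.tabulate-cong e)
    ; α-+ = λ u v i → trans (cong (λ w → lookup w i) (trans (cong αV (tabulate-⊕ u v)) (trans (cong (Vec.take rank) (to-⊕ iso _ _)) (take-⊕ rank _ _)))) (lookup-⊕ (αV (tabulate u)) _ i)
    ; β-+ = λ u v i → trans (cong (λ w → lookup w i) (trans (cong βV (tabulate-⊕ u v)) (trans (cong (Vec.drop rank) (to-⊕ iso _ _)) (drop-⊕ rank _ _)))) (lookup-⊕ (βV (tabulate u)) _ i)
    ; α-γ = λ x y i → trans (cong (λ w → lookup (Vec.take rank w) i) (to-γ x y)) (trans (cong (λ w → lookup w i) (take-++ (tabulate x) (tabulate y))) (VecP.lookup∘tabulate x i))
    ; β-γ = λ x y i → trans (cong (λ w → lookup (Vec.drop rank w) i) (to-γ x y)) (trans (cong (λ w → lookup w i) (drop-++ (tabulate x) (tabulate y))) (VecP.lookup∘tabulate y i))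
    ; ker→ = λ v z j → trans (cong (λ w → lookup w j) (ker→ (tabulate v) (λ i → trans (tabulate-· (C i) v) (z i)))) (VecP.lookup-replicate j 0#)
    ; ker← = λ v z i → trans (sym (tabulate-· (C i) v)) (ker← (tabulate v) (αV0 v z) i)
    ; recon = λ v z t → begin
        v t ≡⟨ VecP.lookup∘tabulate v t ⟨
        lookup (tabulate v) t ≡⟨ basis-· t (tabulate v) ⟨
        basis t · tabulate v ≡⟨ adjoint′ iso (basis t) (tabulate v) ⟩
        tr iso (basis t) · to iso (tabulate v) ≡⟨ ·-++𝟘 rank (tr iso (basis t)) (to iso (tabulate v)) (αV0 v z) ⟩
        _ ≡⟨ ·-∑ (Vec.drop rank (tr iso (basis t))) (βV (tabulate v)) ⟩
        _ ∎ }
    where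
    open Echelon (echelon (λ i → tabulate (C i)))
    αV : Vec A p → Vec A rank
    αV v = Vec.take rank (to iso v)
    βV : Vec A p → Vec A nullity
    βV v = Vec.drop rank (to iso v)
    to-γ : ∀ x y → to iso (tabulate (lookup (from iso (tabulate x Vec.++ tabulate y)))) ≡ tabulate x Vec.++ tabulate y
    to-γ x y = trans (cong (to iso) (VecP.tabulate∘lookup _)) (to-from iso _)
    αV0 : ∀ v → (∀ j → lookup (αV (tabulate v)) j ≡ 0#) → αV (tabulate v) ≡ 𝟘
    αV0 v z = trans (sym (VecP.tabulate∘lookup _)) (tabulate-0 _ z)

  infix 4 _∣_
  _∣_ : A → A → Set
  n ∣ x = ∃[ e ] x ≡ n * e

  *-≢0 : ∀ {x y} → x ≢ 0# → y ≢ 0# → x * y ≢ 0#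
  *-≢0 x≢0 y≢0 z = y≢0 (cancel _ x≢0 z)

  *-cancelˡ : ∀ g {x y} → g ≢ 0# → g * x ≡ g * y → x ≡ y
  *-cancelˡ g {x} {y} g≢0 e = begin
    x               ≡⟨ +-identityʳ x ⟨
    x + 0#          ≡⟨ cong (x +_) (-‿inverseˡ y) ⟨
    x + (- y + y)   ≡⟨ +-assoc _ _ _ ⟨
    x + - y + y     ≡⟨ cong (_+ y) (cancel g g≢0 (trans (distribˡ g x (- y)) (trans (cong (_+ g * - y) e)
                         (trans (sym (distribˡ g y (- y))) (trans (cong (g *_) (-‿inverseʳ y)) (zeroʳ g)))))) ⟩
    0# + y          ≡⟨ +-identityˡ y ⟩
    y ∎

  -- The row Σ c_j M_j regarded as a linear form. Conditions on it that range over all v carry over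
  -- to new coordinates by substituting for v.
  combination : ∀ {s p} → (Fin s → Vec A p) → (Fin s → A) → Vec A p → A
  combination M c v = ∑ (λ j → c j * (M j · v))

  Independent : ∀ {s p} → (Fin s → Vec A p) → Set
  Independent M = ∀ c → (∀ v → combination M c v ≡ 0#) → ∀ j → c j ≡ 0#

  -- With fractions: whenever the row (c/n)M is integral, so is (c/n)ε. A solution w makes this
  -- necessary, since (c/n)ε = (c/n)Mw.
  Compatible : ∀ {s p} → (Fin s → Vec A p) → (Fin s → A) → Set
  Compatible M ε = ∀ n → n ≢ 0# → ∀ c → (∀ v → n ∣ combination M c v) → n ∣ ∑ (λ j → c j * ε j)

  -- Kronecker's criterion for solvability of a linear system, by elimination of one unknown:
  -- a Hermite step turns the first equation into g x₀ = ε₀.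
  kronecker : ∀ {s p} (M : Fin s → Vec A p) (ε : Fin s → A) → Independent M → Compatible M ε → ∃[ w ] (∀ j → M j · w ≡ ε j)
  kronecker {zero} M ε ind cmp = 𝟘 , λ ()
  kronecker {suc s} {zero} M ε ind cmp = ⊥-elim (1≢0 (ind (λ _ → 1#) (λ v → ∑-0 {suc s} _ (λ j → trans (cong (1# *_) (nil (M j) v)) (zeroʳ 1#))) zero))
    where nil : ∀ (r v : Vec A 0) → r · v ≡ 0#
          nil [] [] = refl
  kronecker {suc s} {suc p} M ε ind cmp with hermite (M zero)
  ... | g , I , eq = from I (e ∷ w) , sol
    where
    h : Fin s → A
    h j = head (tr I (M (suc j)))
    M′ : Fin s → Vec A p
    M′ j = tail (tr I (M (suc j)))

    row₀ : ∀ x v → M zero · from I (x ∷ v) ≡ g * x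
    row₀ x v = trans (adjoint I (M zero) (x ∷ v)) (trans (cong (_· (x ∷ v)) eq) (trans (cong (g * x +_) (𝟘-· v)) (+-identityʳ _)))

    row₊ : ∀ j x v → M (suc j) · from I (x ∷ v) ≡ h j * x + M′ j · v
    row₊ j x v = trans (adjoint I (M (suc j)) (x ∷ v)) (split (tr I (M (suc j))))
      where split : ∀ (r : Vec A (suc p)) → r · (x ∷ v) ≡ head r * x + tail r · v
            split (y ∷ r) = refl

    M₀ : ∀ v → M zero · v ≡ g * head (to I v)
    M₀ v with to I v in q
    ... | x ∷ w = trans (cong (M zero ·_) (trans (sym (from-to I v)) (cong (from I) q))) (row₀ x w)

    g≢0 : g ≢ 0#
    g≢0 refl = 1≢0 (ind (unit zero) (λ v → trans (∑-unit zero (λ j → M j · v)) (trans (M₀ v) (zeroˡ _))) zero)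

    -- The first row takes only multiples of g as values, so compatibility applies with n = g and
    -- the combination consisting of that row alone.
    div₀ : g ∣ ε zero
    div₀ with cmp g g≢0 (unit zero) (λ v → head (to I v) , trans (∑-unit zero (λ j → M j · v)) (M₀ v))
    ... | e , q = e , trans (sym (∑-unit zero ε)) q

    e : A
    e = proj₁ div₀

    ε′ : Fin s → A
    ε′ j = ε (suc j) + - (h j * e)

    -- Extends a combination of the later rows to all rows so that the eliminated unknown cancels:
    -- after scaling by g, the multiple - Σ c_j h_j of the first row, whose pivot is g, removes it.
    lift : (Fin s → A) → Fin (suc s) → A
    lift c zero = - ∑ (λ j → c j * h j)
    lift c (suc j) = g * c j

    lift-sum : ∀ c x₀ (x y : Fin s → A) z → x₀ ≡ g * z → (∀ j → x j ≡ h j * z + y j) →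
               - ∑ (λ j → c j * h j) * x₀ + ∑ (λ j → g * c j * x j) ≡ g * ∑ (λ j → c j * y j)
    lift-sum c x₀ x y z refl ex = begin
      - H * (g * z) + ∑ (λ j → g * c j * x j)
        ≡⟨ cong (- H * (g * z) +_) (∑-cong (λ j → trans (cong (g * c j *_) (ex j))
             (solve 5 (λ g c h z y → g :* c :* (h :* z :+ y) := g :* z :* (c :* h) :+ g :* (c :* y)) refl g (c j) (h j) z (y j)))) ⟩
      - H * (g * z) + ∑ (λ j → g * z * (c j * h j) + g * (c j * y j))
        ≡⟨ cong (- H * (g * z) +_) (∑-+ _ (λ j → g * (c j * y j))) ⟩
      - H * (g * z) + (∑ (λ j → g * z * (c j * h j)) + ∑ (λ j → g * (c j * y j)))
        ≡⟨ cong (- H * (g * z) +_) (cong₂ _+_ (∑-*ˡ (g * z) (λ j → c j * h j)) (∑-*ˡ g (λ j → c j * y j))) ⟩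
      - H * (g * z) + (g * z * H + g * Y)
        ≡⟨ solve 4 (λ n w h t → n :* w :+ (w :* h :+ t) := w :* (n :+ h) :+ t) refl (- H) (g * z) H (g * Y) ⟩
      g * z * (- H + H) + g * Y ≡⟨ cong (λ t → g * z * t + g * Y) (-‿inverseˡ H) ⟩
      g * z * 0# + g * Y ≡⟨ cong (_+ g * Y) (zeroʳ _) ⟩
      0# + g * Y ≡⟨ +-identityˡ _ ⟩
      g * Y ∎
      where H = ∑ (λ j → c j * h j)
            Y = ∑ (λ j → c j * y j)

    lift-comb : ∀ c v → combination M (lift c) v ≡ g * combination M′ c (tail (to I v))
    lift-comb c v with to I v in q
    ... | x ∷ w = trans (cong (combination M (lift c)) (trans (sym (from-to I v)) (cong (from I) q))) (trans (∑-suc _)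
                        (lift-sum c _ _ (λ j → M′ j · w) x (row₀ x w) (λ j → row₊ j x w)))

    ind′ : Independent M′
    ind′ c z j = cancel g g≢0 (ind (lift c) (λ v → trans (lift-comb c v) (trans (cong (g *_) (z _)) (zeroʳ g))) (suc j))

    cmp′ : Compatible M′ ε′
    -- The modulus g n absorbs the factor g introduced by `lift`; it is cancelled afterwards.
    cmp′ n n≢0 c d with cmp (g * n) (*-≢0 g≢0 n≢0) (lift c)
                        (λ v → proj₁ (d (tail (to I v))) , trans (lift-comb c v) (trans (cong (g *_) (proj₂ (d _))) (sym (*-assoc _ _ _))))
    ... | f , q = f , *-cancelˡ g g≢0 (trans (sym (trans (∑-suc (λ j → lift c j * ε j)) (lift-sum c (ε zero) (ε ∘ suc) ε′ e (proj₂ div₀) back))) (trans q (*-assoc _ _ _)))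
      where
      back : ∀ j → ε (suc j) ≡ h j * e + ε′ j
      back j = sym (begin
        h j * e + (ε (suc j) + - (h j * e))  ≡⟨ solve 3 (λ a b c → a :+ (b :+ c) := b :+ (c :+ a)) refl (h j * e) (ε (suc j)) (- (h j * e)) ⟩
        ε (suc j) + (- (h j * e) + h j * e)  ≡⟨ cong (ε (suc j) +_) (-‿inverseˡ (h j * e)) ⟩
        ε (suc j) + 0#                       ≡⟨ +-identityʳ _ ⟩
        ε (suc j) ∎)

    rec = kronecker M′ ε′ ind′ cmp′
    w = proj₁ rec

    sol : ∀ j → M j · from I (e ∷ w) ≡ ε j
    sol zero = trans (row₀ e w) (sym (proj₂ div₀))
    sol (suc j) = begin
      M (suc j) · from I (e ∷ w)           ≡⟨ row₊ j e w ⟩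
      h j * e + M′ j · w                   ≡⟨ cong (h j * e +_) (proj₂ rec j) ⟩
      h j * e + ε′ j                       ≡⟨ solve 3 (λ a b c → a :+ (b :+ c) := b :+ (c :+ a)) refl (h j * e) (ε (suc j)) (- (h j * e)) ⟩
      ε (suc j) + (- (h j * e) + h j * e)  ≡⟨ cong (ε (suc j) +_) (-‿inverseˡ (h j * e)) ⟩
      ε (suc j) + 0#                       ≡⟨ +-identityʳ _ ⟩
      ε (suc j) ∎

  ·-basis : ∀ {p} (t : Fin p) v → v · basis t ≡ lookup v t
  ·-basis zero (x ∷ v) = trans (cong₂ _+_ (*-identityʳ x) (·-𝟘 v)) (+-identityʳ x)
  ·-basis (suc t) (x ∷ v) = trans (cong₂ _+_ (zeroʳ x) (·-basis t v)) (+-identityˡ _)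

  combination-basis : ∀ {s p} (B : Fin s → Fin p → A) c t → combination (λ j → tabulate (B j)) c (basis t) ≡ ∑ (λ j → c j * B j t)
  combination-basis B c t = ∑-cong (λ j → cong (c j *_) (trans (·-basis t (tabulate (B j))) (VecP.lookup∘tabulate (B j) t)))

  kroneckerᶠ : ∀ {s p} (B : Fin s → Fin p → A) (ε : Fin s → A) →
    (∀ c → (∀ t → ∑ (λ j → c j * B j t) ≡ 0#) → ∀ j → c j ≡ 0#) →
    (∀ n → n ≢ 0# → ∀ c z → (∀ t → ∑ (λ j → c j * B j t) ≡ n * z t) → n ∣ ∑ (λ j → c j * ε j)) →
    ∃[ w ] (∀ j → ∑ (λ t → w t * B j t) ≡ ε j)
  kroneckerᶠ B ε ind cmp with kronecker (λ j → tabulate (B j)) ε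
      (λ c z → ind c (λ t → trans (sym (combination-basis B c t)) (z (basis t))))
      (λ n n≢0 c d → cmp n n≢0 c (λ t → proj₁ (d (basis t))) (λ t → trans (sym (combination-basis B c t)) (proj₂ (d (basis t)))))
  ... | w , e = lookup w , λ j → trans (∑-cong (λ t → trans (*-comm _ _) (cong (_* lookup w t) (sym (VecP.lookup∘tabulate (B j) t)))))
                                (trans (sym (·-∑ (tabulate (B j)) w)) (e j))

  module _ {q p} {C : Fin q → Fin p → A} (K : FreeKernel C) where
    open FreeKernel K

    β-0 : ∀ u → (∀ t → u t ≡ 0#) → ∀ i → β u i ≡ 0#
    β-0 u z i = idem (β u i) (trans (sym (β-+ u u i)) (β-cong (λ t → trans (cong (u t +_) (z t)) (+-identityʳ (u t))) i))
      where
      idem : ∀ x → x + x ≡ x → x ≡ 0#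
      idem x e = begin
        x               ≡⟨ +-identityʳ x ⟨
        x + 0#          ≡⟨ cong (x +_) (-‿inverseʳ x) ⟨
        x + (x + - x)   ≡⟨ +-assoc x x (- x) ⟨
        x + x + - x     ≡⟨ cong (_+ - x) e ⟩
        x + - x         ≡⟨ -‿inverseʳ x ⟩
        0# ∎

  -- The rank is at most q < p = rank + nullity, so the nullity is positive; the vector with all
  -- kernel coordinates 1 is then a nonzero solution.
  nontrivial-kernel : ∀ {q p} (C : Fin q → Fin p → A) → q ℕ.< p → ∃[ κ ] ((∀ i → ∑ (λ a → C i a * κ a) ≡ 0#) × ¬ (∀ a → κ a ≡ 0#))
  nontrivial-kernel {q} {p} C q<p with freeKernel C
  ... | K with FreeKernel.nullity K in eq
  ...   | zero = ⊥-elim (ℕP.<⇒≱ q<p (subst (ℕ._≤ q) (sym (trans size≡ (trans (cong (rank ℕ.+_) eq) (ℕP.+-identityʳ rank)))) rank≤))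
    where open FreeKernel K
  ...   | suc l = κ , ker← κ (α-γ _ _) , λ z → 1≢0 (trans (sym (β-γ (λ _ → 0#) (λ _ → 1#) i₀)) (β-0 K κ z i₀))
    where
    open FreeKernel K
    i₀ : Fin nullity
    i₀ = subst Fin (sym eq) zero
    κ = γ (λ _ → 0#) (λ _ → 1#)

-- The integers, the rationals and the field with two elements

open import Data.Integer using (+_)

BezoutStep : ℤ → ℤ → Set
BezoutStep x y = ∃[ g ] ∃[ x′ ] ∃[ y′ ] ∃[ u ] ∃[ v ] (x ≡ x′ ℤ.* g × y ≡ y′ ℤ.* g × x′ ℤ.* u ℤ.+ y′ ℤ.* v ≡ ℤ.1ℤ)

bezout-ℕ : ∀ m n → BezoutStep (+ m) (+ n)
bezout-ℕ m n with mkGCD m n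
... | zero , G with GCD.commonDivisor G
-- A gcd of 0 means that both numbers are 0. The quotients are then arbitrary, and 1 and 0 are
-- coprime.
...   | divides p refl , divides q refl = ℤ.0ℤ , ℤ.1ℤ , ℤ.0ℤ , ℤ.1ℤ , ℤ.0ℤ , cong +_ (ℕP.*-zeroʳ p) , cong +_ (ℕP.*-zeroʳ q) , refl
bezout-ℕ m n | g@(suc _) , G with GCD.commonDivisor G | Bézout.identity G
...   | divides p refl , divides q refl | Bézout.+- x y e =
        + g , + p , + q , + x , ℤ.- (+ y) , ℤP.pos-* p g , ℤP.pos-* q g , ℤP.*-cancelʳ-≡ _ _ (+ g) (begin
          (+ p ℤ.* + x ℤ.+ + q ℤ.* ℤ.- + y) ℤ.* + g
            ≡⟨ rearrange (+ p) (+ x) (+ q) (+ y) (+ g) ⟩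
          + x ℤ.* (+ p ℤ.* + g) ℤ.- + y ℤ.* (+ q ℤ.* + g)
            ≡⟨ cong (ℤ._- + y ℤ.* (+ q ℤ.* + g)) (trans (trans (cong (+ x ℤ.*_) (sym (ℤP.pos-* p g))) (sym (ℤP.pos-* x (p ℕ.* g))))
                 (trans (cong +_ (sym e)) (cong (λ t → + g ℤ.+ t) (trans (ℤP.pos-* y (q ℕ.* g)) (cong (+ y ℤ.*_) (ℤP.pos-* q g)))))) ⟩
          + g ℤ.+ + y ℤ.* (+ q ℤ.* + g) ℤ.- + y ℤ.* (+ q ℤ.* + g)
            ≡⟨ undo (+ g) (+ y ℤ.* (+ q ℤ.* + g)) ⟩
          ℤ.1ℤ ℤ.* + g ∎)
        where
        rearrange : ∀ p x q y g → (p ℤ.* x ℤ.+ q ℤ.* ℤ.- y) ℤ.* g ≡ x ℤ.* (p ℤ.* g) ℤ.- y ℤ.* (q ℤ.* g)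
        rearrange = ℤS.solve-∀
        undo : ∀ g t → g ℤ.+ t ℤ.- t ≡ ℤ.1ℤ ℤ.* g
        undo = ℤS.solve-∀
...   | divides p refl , divides q refl | Bézout.-+ x y e =
        + g , + p , + q , ℤ.- (+ x) , + y , ℤP.pos-* p g , ℤP.pos-* q g , ℤP.*-cancelʳ-≡ _ _ (+ g) (begin
          (+ p ℤ.* ℤ.- + x ℤ.+ + q ℤ.* + y) ℤ.* + g
            ≡⟨ rearrange (+ p) (+ x) (+ q) (+ y) (+ g) ⟩
          + y ℤ.* (+ q ℤ.* + g) ℤ.- + x ℤ.* (+ p ℤ.* + g)
            ≡⟨ cong (ℤ._- + x ℤ.* (+ p ℤ.* + g)) (trans (trans (cong (+ y ℤ.*_) (sym (ℤP.pos-* q g))) (sym (ℤP.pos-* y (q ℕ.* g))))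
                 (trans (cong +_ (sym e)) (cong (λ t → + g ℤ.+ t) (trans (ℤP.pos-* x (p ℕ.* g)) (cong (+ x ℤ.*_) (ℤP.pos-* p g)))))) ⟩
          + g ℤ.+ + x ℤ.* (+ p ℤ.* + g) ℤ.- + x ℤ.* (+ p ℤ.* + g)
            ≡⟨ undo (+ g) (+ x ℤ.* (+ p ℤ.* + g)) ⟩
          ℤ.1ℤ ℤ.* + g ∎)
        where
        rearrange : ∀ p x q y g → (p ℤ.* ℤ.- x ℤ.+ q ℤ.* y) ℤ.* g ≡ y ℤ.* (q ℤ.* g) ℤ.- x ℤ.* (p ℤ.* g)
        rearrange = ℤS.solve-∀
        undo : ∀ g t → g ℤ.+ t ℤ.- t ≡ ℤ.1ℤ ℤ.* g
        undo = ℤS.solve-∀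

neg-neg-* : ∀ a u → ℤ.- a ℤ.* ℤ.- u ≡ a ℤ.* u
neg-neg-* = ℤS.solve-∀

negˡ : ∀ {x y} → BezoutStep x y → BezoutStep (ℤ.- x) y
negˡ {x} (g , a , b , u , v , ex , ey , d) = g , ℤ.- a , b , ℤ.- u , v ,
  trans (cong ℤ.-_ ex) (ℤP.neg-distribˡ-* a g) , ey , trans (cong (ℤ._+ b ℤ.* v) (neg-neg-* a u)) d

negʳ : ∀ {x y} → BezoutStep x y → BezoutStep x (ℤ.- y)
negʳ {x} (g , a , b , u , v , ex , ey , d) = g , a , ℤ.- b , u , ℤ.- v ,
  ex , trans (cong ℤ.-_ ey) (ℤP.neg-distribˡ-* b g) , trans (cong (λ t → a ℤ.* u ℤ.+ t) (neg-neg-* b v)) d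

bezout-ℤ : ∀ x y → BezoutStep x y
bezout-ℤ (+ m)    (+ n)    = bezout-ℕ m n
bezout-ℤ (+ m)    -[1+ n ] = negʳ (bezout-ℕ m (suc n))
bezout-ℤ -[1+ m ] (+ n)    = negˡ (bezout-ℕ (suc m) n)
bezout-ℤ -[1+ m ] -[1+ n ] = negˡ (negʳ (bezout-ℕ (suc m) (suc n)))

ℤ-domain : BezoutDomain
ℤ-domain = record
  { isCommutativeRing = ℤP.+-*-isCommutativeRing ; _≟0 = ℤ._≟ ℤ.0ℤ ; 1≢0 = λ () ; cancel = cancel ; ∑ = sumℤ ; ∑-zero = λ _ → refl ; ∑-suc = λ _ → refl ; bezout = bezout-ℤ }
  where
  cancel : ∀ x {y} → x ≢ ℤ.0ℤ → x ℤ.* y ≡ ℤ.0ℤ → y ≡ ℤ.0ℤ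
  cancel x x≢0 z with ℤP.i*j≡0⇒i≡0∨j≡0 x z
  ... | inj₁ q = ⊥-elim (x≢0 q)
  ... | inj₂ q = q

ℚ-cancel : ∀ x {y} → x ≢ ℚ.0ℚ → x ℚ.* y ≡ ℚ.0ℚ → y ≡ ℚ.0ℚ
ℚ-cancel x {y} x≢0 z = begin
  y                       ≡⟨ ℚP.*-identityˡ y ⟨
  ℚ.1ℚ ℚ.* y              ≡⟨ cong (ℚ._* y) (ℚP.*-inverseˡ x) ⟨
  ℚ.1/ x ℚ.* x ℚ.* y      ≡⟨ ℚP.*-assoc (ℚ.1/ x) x y ⟩
  ℚ.1/ x ℚ.* (x ℚ.* y)    ≡⟨ cong (ℚ.1/ x ℚ.*_) z ⟩
  ℚ.1/ x ℚ.* ℚ.0ℚ         ≡⟨ ℚP.*-zeroʳ (ℚ.1/ x) ⟩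
  ℚ.0ℚ ∎
  where instance _ = ℚ.≢-nonZero x≢0

ℚ-domain : BezoutDomain
ℚ-domain = record
  { isCommutativeRing = ℚP.+-*-isCommutativeRing ; _≟0 = ℚP._≟ ℚ.0ℚ ; 1≢0 = λ () ; cancel = ℚ-cancel ; ∑ = sumℚ ; ∑-zero = λ _ → refl ; ∑-suc = λ _ → refl ; bezout = bezout }
  where
  bezout : ∀ x y → ∃[ g ] ∃[ x′ ] ∃[ y′ ] ∃[ u ] ∃[ v ] (x ≡ x′ ℚ.* g × y ≡ y′ ℚ.* g × x′ ℚ.* u ℚ.+ y′ ℚ.* v ≡ ℚ.1ℚ)
  bezout x y with x ℚP.≟ ℚ.0ℚ
  ... | yes x≡0 = y , ℚ.0ℚ , ℚ.1ℚ , ℚ.0ℚ , ℚ.1ℚ , trans x≡0 (sym (ℚP.*-zeroˡ y)) , sym (ℚP.*-identityˡ y) , refl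
  ... | no x≢0 = x , ℚ.1ℚ , y ℚ.* ℚ.1/ x , ℚ.1ℚ , ℚ.0ℚ , sym (ℚP.*-identityˡ x) ,
        sym (trans (ℚP.*-assoc y (ℚ.1/ x) x) (trans (cong (y ℚ.*_) (ℚP.*-inverseˡ x)) (ℚP.*-identityʳ y))) ,
        cong (ℚ._+_ ℚ.1ℚ) (ℚP.*-zeroʳ (y ℚ.* ℚ.1/ x))
    where instance _ = ℚ.≢-nonZero x≢0

sum𝔽₂ : ∀ {n} → (Fin n → Bool) → Bool
sum𝔽₂ {zero} x = false
sum𝔽₂ {suc n} x = x zero xor sum𝔽₂ (x ∘ suc)

𝔽₂-domain : BezoutDomain
𝔽₂-domain = record
  { isCommutativeRing = CommutativeRing.isCommutativeRing BoolP.xor-∧-commutativeRing ; _≟0 = BoolP._≟ false ; 1≢0 = λ ()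
  ; cancel = λ { false x≢0 _ → ⊥-elim (x≢0 refl) ; true _ → id }
  ; ∑ = sum𝔽₂ ; ∑-zero = λ _ → refl ; ∑-suc = λ _ → refl
  ; bezout = λ { true y → true , true , y , true , false , refl , sym (BoolP.∧-identityʳ y) , cong (true xor_) (BoolP.∧-zeroʳ y)
               ; false y → y , false , true , false , true , refl , refl , refl } }

module Z = LinearAlgebra ℤ-domain
module Q = LinearAlgebra ℚ-domain
module F = LinearAlgebra 𝔽₂-domain

-- Boundary maps

listSum : ∀ {X : Set} → (X → ℤ) → List X → ℤ
listSum g [] = 0ℤ
listSum g (x ∷ xs) = g x ℤ.+ listSum g xs

sum-lookup : ∀ {X : Set} (g : X → ℤ) xs → sumℤ (λ i → g (List.lookup xs i)) ≡ listSum g xs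
sum-lookup g [] = refl
sum-lookup g (x ∷ xs) = cong (ℤ._+_ (g x)) (sum-lookup g xs)

listSum-++ : ∀ {X : Set} (g : X → ℤ) xs ys → listSum g (xs ++ ys) ≡ listSum g xs ℤ.+ listSum g ys
listSum-++ g [] ys = sym (ℤP.+-identityˡ _)
listSum-++ g (x ∷ xs) ys = trans (cong (ℤ._+_ (g x)) (listSum-++ g xs ys)) (sym (ℤP.+-assoc (g x) _ _))

listSum-map : ∀ {X Y : Set} (g : Y → ℤ) (h : X → Y) xs → listSum g (List.map h xs) ≡ listSum (g ∘ h) xs
listSum-map g h [] = refl
listSum-map g h (x ∷ xs) = cong (ℤ._+_ (g (h x))) (listSum-map g h xs)

listSum-keep : ∀ {X : Set} (p : X → Bool) (g : X → ℤ) → (∀ x → p x ≡ false → g x ≡ 0ℤ) → ∀ xs → listSum g (keep p xs) ≡ listSum g xs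
listSum-keep p g z [] = refl
listSum-keep p g z (x ∷ xs) with p x in q
... | true = cong (ℤ._+_ (g x)) (listSum-keep p g z xs)
... | false = trans (listSum-keep p g z xs) (sym (trans (cong (ℤ._+ listSum g xs) (z x q)) (ℤP.+-identityˡ _)))

keep-lookup : ∀ {X : Set} (p : X → Bool) xs i → p (List.lookup (keep p xs) i) ≡ true
keep-lookup p (x ∷ xs) i with p x in q
keep-lookup p (x ∷ xs) zero    | true = q
keep-lookup p (x ∷ xs) (suc i) | true = keep-lookup p xs i
keep-lookup p (x ∷ xs) i       | false = keep-lookup p xs i

-- A sum over all subsets splits according to the first vertex, which permits induction on n; a sum
-- over the faces of one dimension of a complex does not.
faceSum : ∀ n → (Face n → ℤ) → ℤ
faceSum zero g = g []
faceSum (suc n) g = faceSum n (g ∘ (true ∷_)) ℤ.+ faceSum n (g ∘ (false ∷_))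

listSum-allFaces : ∀ n (g : Face n → ℤ) → listSum g (allFaces n) ≡ faceSum n g
listSum-allFaces zero g = ℤP.+-identityʳ (g [])
listSum-allFaces (suc n) g = trans (listSum-++ g (List.map (true ∷_) (allFaces n)) _)
  (cong₂ ℤ._+_ (trans (listSum-map g (true ∷_) (allFaces n)) (listSum-allFaces n _))
               (trans (listSum-map g (false ∷_) (allFaces n)) (listSum-allFaces n _)))

faceSum-cong : ∀ n {g h : Face n → ℤ} → (∀ τ → g τ ≡ h τ) → faceSum n g ≡ faceSum n h
faceSum-cong zero e = e []
faceSum-cong (suc n) e = cong₂ ℤ._+_ (faceSum-cong n (e ∘ (true ∷_))) (faceSum-cong n (e ∘ (false ∷_)))

faceSum-0 : ∀ n {g : Face n → ℤ} → (∀ τ → g τ ≡ 0ℤ) → faceSum n g ≡ 0ℤ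
faceSum-0 zero e = e []
faceSum-0 (suc n) e = cong₂ ℤ._+_ (faceSum-0 n (e ∘ (true ∷_))) (faceSum-0 n (e ∘ (false ∷_)))

faceSum-neg : ∀ n (g : Face n → ℤ) → faceSum n (λ τ → ℤ.- g τ) ≡ ℤ.- faceSum n g
faceSum-neg zero g = refl
faceSum-neg (suc n) g = trans (cong₂ ℤ._+_ (faceSum-neg n _) (faceSum-neg n _)) (sym (ℤP.neg-distrib-+ (faceSum n _) (faceSum n _)))

δ : ∀ {n} → Face n → Face n → ℤ
δ σ τ = if eqFace σ τ then 1ℤ else 0ℤ

faceSum-δʳ : ∀ {n} (g : Face n → ℤ) ρ → faceSum n (λ τ → g τ ℤ.* δ τ ρ) ≡ g ρ
faceSum-δʳ {zero} g [] = ℤP.*-identityʳ (g [])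
faceSum-δʳ {suc n} g (true ∷ ρ) = trans (cong₂ ℤ._+_ (faceSum-δʳ (g ∘ (true ∷_)) ρ) (faceSum-0 n (λ τ → ℤP.*-zeroʳ (g (false ∷ τ))))) (ℤP.+-identityʳ _)
faceSum-δʳ {suc n} g (false ∷ ρ) = trans (cong₂ ℤ._+_ (faceSum-0 n (λ τ → ℤP.*-zeroʳ (g (true ∷ τ)))) (faceSum-δʳ (g ∘ (false ∷_)) ρ)) (ℤP.+-identityˡ _)

faceSum-δˡ : ∀ {n} (g : Face n → ℤ) ρ → faceSum n (λ τ → δ ρ τ ℤ.* g τ) ≡ g ρ
faceSum-δˡ {zero} g [] = ℤP.*-identityˡ (g [])
faceSum-δˡ {suc n} g (true ∷ ρ) = trans (cong₂ ℤ._+_ (faceSum-δˡ (g ∘ (true ∷_)) ρ) (faceSum-0 n (λ τ → ℤP.*-zeroˡ (g (false ∷ τ))))) (ℤP.+-identityʳ _)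
faceSum-δˡ {suc n} g (false ∷ ρ) = trans (cong₂ ℤ._+_ (faceSum-0 n (λ τ → ℤP.*-zeroˡ (g (true ∷ τ)))) (faceSum-δˡ (g ∘ (false ∷_)) ρ)) (ℤP.+-identityˡ _)

-- The identity ∂∂ = 0 on a full simplex. When the first vertex lies in σ but not in ρ, deleting it
-- second contributes `- coef σ ρ` and deleting it first contributes `coef σ ρ`; the other cases
-- reduce to fewer vertices.
coef-coef : ∀ {n} (σ ρ : Face n) → faceSum n (λ τ → coef σ τ ℤ.* coef τ ρ) ≡ 0ℤ
coef-coef {zero} [] [] = refl
coef-coef {suc n} (true ∷ σ) (true ∷ ρ) = cong₂ ℤ._+_
  (trans (faceSum-cong n (λ τ → neg-neg-* (coef σ τ) (coef τ ρ))) (coef-coef σ ρ))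
  (faceSum-0 n (λ τ → ℤP.*-zeroʳ (δ σ τ)))
coef-coef {suc n} (true ∷ σ) (false ∷ ρ) = trans (cong₂ ℤ._+_
  (trans (faceSum-δʳ (λ τ → ℤ.- coef σ τ) ρ) refl)
  (faceSum-δˡ (λ τ → coef τ ρ) σ)) (ℤP.+-inverseˡ (coef σ ρ))
coef-coef {suc n} (false ∷ σ) (true ∷ ρ) = cong₂ ℤ._+_ (faceSum-0 n (λ τ → ℤP.*-zeroˡ (ℤ.- coef τ ρ))) (faceSum-0 n (λ τ → ℤP.*-zeroʳ (coef σ τ)))
coef-coef {suc n} (false ∷ σ) (false ∷ ρ) = cong₂ ℤ._+_ (faceSum-0 n (λ τ → ℤP.*-zeroˡ (δ τ ρ))) (coef-coef σ ρ)

coef-sum-suc : ∀ {n} (σ : Face n) {x} → faceSum n (coef σ) ≡ x → faceSum (suc n) (coef (true ∷ σ)) ≡ ℤ.- x ℤ.+ 1ℤ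
coef-sum-suc {n} σ e = cong₂ ℤ._+_ (trans (faceSum-neg n (coef σ)) (cong ℤ.-_ e))
  (trans (faceSum-cong n (λ τ → sym (ℤP.*-identityʳ (δ σ τ)))) (faceSum-δˡ (λ _ → 1ℤ) σ))

-- A new first vertex reverses all earlier signs and adds one +1, so the sum x becomes 1 - x.
coef-sum : ∀ {n} (σ : Face n) → (faceSum n (coef σ) ≡ 0ℤ × EvenN (size σ)) ⊎ (faceSum n (coef σ) ≡ 1ℤ × OddN (size σ))
coef-sum {zero} [] = inj₁ (refl , 0 , refl)
coef-sum {suc n} (false ∷ σ) with coef-sum σ
... | inj₁ (e , even) = inj₁ (cong₂ ℤ._+_ (faceSum-0 n (λ _ → refl)) e , even)
... | inj₂ (e , odd)  = inj₂ (cong₂ ℤ._+_ (faceSum-0 n (λ _ → refl)) e , odd)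
coef-sum {suc n} (true ∷ σ) with coef-sum σ
... | inj₁ (e , q , even) = inj₂ (coef-sum-suc σ e , q , cong suc even)
... | inj₂ (e , q , odd)  = inj₁ (coef-sum-suc σ e , suc q , trans (cong suc odd) (cong suc (sym (ℕP.+-suc q q))))

≡ᵇ-refl : ∀ m → (m ℕ.≡ᵇ m) ≡ true
≡ᵇ-refl zero = refl
≡ᵇ-refl (suc m) = ≡ᵇ-refl m

eqFace-sound : ∀ {n} (σ τ : Face n) → eqFace σ τ ≡ true → σ ≡ τ
eqFace-sound [] [] e = refl
eqFace-sound (true ∷ σ) (true ∷ τ) e = cong (true ∷_) (eqFace-sound σ τ e)
eqFace-sound (false ∷ σ) (false ∷ τ) e = cong (false ∷_) (eqFace-sound σ τ e)

coef-support : ∀ {n} (σ τ : Face n) → coef σ τ ≡ 0ℤ ⊎ (τ ⊆F σ × size σ ≡ suc (size τ))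
coef-support [] [] = inj₁ refl
coef-support (true ∷ σ) (true ∷ τ) with coef-support σ τ
... | inj₁ z = inj₁ (cong ℤ.-_ z)
... | inj₂ (sub , e) = inj₂ ((λ { zero _ → refl ; (suc i) → sub i }) , cong suc e)
coef-support (true ∷ σ) (false ∷ τ) with eqFace σ τ in q
... | false = inj₁ refl
... | true with eqFace-sound σ τ q
...   | refl = inj₂ ((λ { (suc i) → λ m → m }) , refl)
coef-support (false ∷ σ) (true ∷ τ) = inj₁ refl
coef-support (false ∷ σ) (false ∷ τ) with coef-support σ τ
... | inj₁ z = inj₁ z
... | inj₂ (sub , e) = inj₂ ((λ { (suc i) → sub i }) , e)

module _ (Δ : SimplicialComplex) where

  isFace : ℕ → Face (n Δ) → Bool
  isFace j σ = mem Δ σ ∧ (size σ ℕ.≡ᵇ suc j)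

  isFace-sound : ∀ j σ → isFace j σ ≡ true → mem Δ σ ≡ true × size σ ≡ suc j
  isFace-sound j σ e with mem Δ σ
  ... | true = refl , ℕP.≡ᵇ⇒≡ (size σ) (suc j) (subst T (sym e) tt)

  face-mem : ∀ j i → mem Δ (face Δ j i) ≡ true × size (face Δ j i) ≡ suc j
  face-mem j i = isFace-sound j _ (keep-lookup (isFace j) (allFaces (n Δ)) i)

  -- Nonzero coefficients occur only at subsets of σ with one vertex less. These are j-faces because
  -- the complex is closed under subsets, so the remaining subsets add only zeros.
  sum-faces : ∀ j i (g : Face (n Δ) → ℤ) → (∀ τ → coef (face Δ (suc j) i) τ ≡ 0ℤ → g τ ≡ 0ℤ) →
              sumℤ (λ t → g (face Δ j t)) ≡ faceSum (n Δ) g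
  sum-faces j i g z = trans (sum-lookup g (faces Δ j))
                     (trans (listSum-keep (isFace j) g off (allFaces (n Δ))) (listSum-allFaces (n Δ) g))
    where
    σ = face Δ (suc j) i
    off : ∀ τ → isFace j τ ≡ false → g τ ≡ 0ℤ
    off τ e with coef-support σ τ
    ... | inj₁ c = z τ c
    ... | inj₂ (sub , s) rewrite closed Δ σ τ sub (proj₁ (face-mem (suc j) i))
                               | ℕP.suc-injective (trans (sym s) (proj₂ (face-mem (suc j) i)))
                         with () ← trans (sym (≡ᵇ-refl (suc j))) e

  bdEntry-bdEntry : ∀ j i t → sumℤ (λ τ → bdEntry Δ (suc j) i τ ℤ.* bdEntry Δ j τ t) ≡ 0ℤ
  bdEntry-bdEntry j i t = trans (sum-faces (suc j) i (λ τ → coef (face Δ (2 ℕ.+ j) i) τ ℤ.* coef τ (face Δ j t))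
                                  (λ τ c → trans (cong (ℤ._* coef τ (face Δ j t)) c) (ℤP.*-zeroˡ (coef τ (face Δ j t)))))
                                (coef-coef (face Δ (2 ℕ.+ j) i) (face Δ j t))

  -- A face of even dimension j + 1 has j + 2 vertices, an odd number.
  bdEntry-sum : ∀ j i → EvenN (suc j) → sumℤ (bdEntry Δ j i) ≡ 1ℤ
  bdEntry-sum j i (q , e) = trans (sum-faces j i (coef (face Δ (suc j) i)) (λ _ z → z)) odd
    where
    odd≢even : ∀ a b → suc (a ℕ.+ a) ≢ b ℕ.+ b
    odd≢even zero (suc b) e with () ← trans (ℕP.suc-injective e) (ℕP.+-suc b b)
    odd≢even (suc a) (suc b) e = odd≢even a b (ℕP.suc-injective (trans (sym (ℕP.+-suc (suc a) a)) (trans (ℕP.suc-injective e) (ℕP.+-suc b b))))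
    odd : faceSum (n Δ) (coef (face Δ (suc j) i)) ≡ 1ℤ
    odd with coef-sum (face Δ (suc j) i)
    ... | inj₂ (s , _) = s
    ... | inj₁ (_ , b , ev) with () ← odd≢even q b (trans (cong suc (sym e)) (trans (sym (proj₂ (face-mem (suc j) i))) ev))

-- From integers to rationals

ℚ-ring : ACR.AlmostCommutativeRing 0ℓ 0ℓ
ℚ-ring = ACR.fromCommutativeRing ℚP.+-*-commutativeRing (λ x → dec⇒maybe (0ℚ ℚP.≟ x))

ι : ℤ → ℚ
ι x = x ℚ./ 1

toℚᵘ-ι : ∀ x → ℚ.toℚᵘ (ι x) ℚᵘ.≃ mkℚᵘ x 0
toℚᵘ-ι x = ℚP.toℚᵘ-fromℚᵘ (mkℚᵘ x 0)

ι-+ : ∀ x y → ι (x ℤ.+ y) ≡ ι x ℚ.+ ι y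
ι-+ x y = ℚP.toℚᵘ-injective (ℚᵘP.≃-trans (toℚᵘ-ι (x ℤ.+ y)) (ℚᵘP.≃-trans (*≡* (eq x y))
  (ℚᵘP.≃-sym (ℚᵘP.≃-trans (ℚP.toℚᵘ-homo-+ (ι x) (ι y)) (ℚᵘP.+-cong (toℚᵘ-ι x) (toℚᵘ-ι y))))))
  where eq : ∀ x y → (x ℤ.+ y) ℤ.* (1ℤ ℤ.* 1ℤ) ≡ (x ℤ.* 1ℤ ℤ.+ y ℤ.* 1ℤ) ℤ.* 1ℤ
        eq = ℤS.solve-∀

ι-* : ∀ x y → ι (x ℤ.* y) ≡ ι x ℚ.* ι y
ι-* x y = ℚP.toℚᵘ-injective (ℚᵘP.≃-trans (toℚᵘ-ι (x ℤ.* y)) (ℚᵘP.≃-trans (*≡* refl)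
  (ℚᵘP.≃-sym (ℚᵘP.≃-trans (ℚP.toℚᵘ-homo-* (ι x) (ι y)) (ℚᵘP.*-cong (toℚᵘ-ι x) (toℚᵘ-ι y))))))

ι-injective : ∀ {x y} → ι x ≡ ι y → x ≡ y
ι-injective {x} {y} e with ℚᵘP.≃-trans (ℚᵘP.≃-sym (toℚᵘ-ι x)) (ℚᵘP.≃-trans (ℚP.toℚᵘ-cong e) (toℚᵘ-ι y))
... | *≡* q = trans (sym (ℤP.*-identityʳ x)) (trans q (ℤP.*-identityʳ y))

ι-∑ : ∀ {n} (g : Fin n → ℤ) → ι (sumℤ g) ≡ sumℚ (λ i → ι (g i))
ι-∑ {zero} g = refl
ι-∑ {suc n} g = trans (ι-+ (g zero) _) (cong (ℚ._+_ (ι (g zero))) (ι-∑ (g ∘ suc)))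

ι-∑-* : ∀ {n} (g h : Fin n → ℤ) → ι (sumℤ (λ i → g i ℤ.* h i)) ≡ sumℚ (λ i → ι (g i) ℚ.* ι (h i))
ι-∑-* g h = trans (ι-∑ (λ i → g i ℤ.* h i)) (Q.∑-cong (λ i → ι-* (g i) (h i)))

clear-denominator : ∀ q → ι (ℚ.↧ q) ℚ.* q ≡ ι (ℚ.↥ q)
clear-denominator q@record{} = ℚP.toℚᵘ-injective (ℚᵘP.≃-trans (ℚP.toℚᵘ-homo-* (ι (ℚ.↧ q)) q)
  (ℚᵘP.≃-trans (ℚᵘP.*-congʳ {ℚ.toℚᵘ q} (toℚᵘ-ι (ℚ.↧ q))) (ℚᵘP.≃-trans (*≡* eq) (ℚᵘP.≃-sym (toℚᵘ-ι (ℚ.↥ q))))))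
  where
  lem : ∀ a b → a ℤ.* b ℤ.* 1ℤ ≡ b ℤ.* a
  lem = ℤS.solve-∀
  eq : ℚ.↧ q ℤ.* ℚ.↥ q ℤ.* 1ℤ ≡ ℚ.↥ q ℤ.* ℚᵘ.ℚᵘ.denominator (mkℚᵘ (ℚ.↧ q) 0 ℚᵘ.* ℚ.toℚᵘ q)
  eq = trans (lem (ℚ.↧ q) (ℚ.↥ q)) (cong (ℚ.↥ q ℤ.*_) (cong +_ (sym (ℕP.*-identityˡ (ℚ.↧ₙ q)))))

common-denominator : ∀ {s} (v : Fin s → ℚ) → ∃[ n ] Σ (Fin s → ℤ) λ c → n ≢ 0ℤ × (∀ i → ι n ℚ.* v i ≡ ι (c i))
common-denominator {zero} v = 1ℤ , (λ ()) , (λ ()) , λ ()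
common-denominator {suc s} v with common-denominator (v ∘ suc)
... | n , c , n≢0 , e = ℚ.↧ (v zero) ℤ.* n , (λ { zero → n ℤ.* ℚ.↥ v zero ; (suc i) → ℚ.↧ (v zero) ℤ.* c i }) ,
      Z.*-≢0 {ℚ.↧ (v zero)} (λ ()) n≢0 , λ
      { zero → trans (cong (ℚ._* v zero) (trans (cong ι (ℤP.*-comm (ℚ.↧ v zero) n)) (ι-* n (ℚ.↧ v zero))))
                 (trans (ℚP.*-assoc (ι n) _ _) (trans (cong (ι n ℚ.*_) (clear-denominator (v zero))) (sym (ι-* n (ℚ.↥ v zero)))))
      ; (suc i) → trans (cong (ℚ._* v (suc i)) (ι-* (ℚ.↧ v zero) n)) (trans (ℚP.*-assoc (ι (ℚ.↧ v zero)) _ _)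
                 (trans (cong (ι (ℚ.↧ v zero) ℚ.*_) (e i)) (sym (ι-* (ℚ.↧ v zero) (c i))))) }

ℤ-independent⇒ℚ-independent : ∀ {s m} (B : Fin s → Fin m → ℤ) →
  (∀ c → (∀ t → sumℤ (λ j → c j ℤ.* B j t) ≡ 0ℤ) → ∀ j → c j ≡ 0ℤ) →
  ∀ v → (∀ t → sumℚ (λ j → v j ℚ.* ι (B j t)) ≡ 0ℚ) → ∀ j → v j ≡ 0ℚ
ℤ-independent⇒ℚ-independent B ind v z j with common-denominator v
... | n , c , n≢0 , e = ℚ-cancel (ι n) (λ q → n≢0 (ι-injective q)) (trans (e j) (cong ι (ind c vanish j)))
  where
  vanish : ∀ t → sumℤ (λ j → c j ℤ.* B j t) ≡ 0ℤ
  vanish t = ι-injective (begin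
    ι (sumℤ (λ j → c j ℤ.* B j t))               ≡⟨ ι-∑-* c (λ j → B j t) ⟩
    sumℚ (λ j → ι (c j) ℚ.* ι (B j t))           ≡⟨ Q.∑-cong (λ j → trans (cong (ℚ._* ι (B j t)) (sym (e j))) (ℚP.*-assoc (ι n) (v j) _)) ⟩
    sumℚ (λ j → ι n ℚ.* (v j ℚ.* ι (B j t)))     ≡⟨ Q.∑-*ˡ (ι n) (λ j → v j ℚ.* ι (B j t)) ⟩
    ι n ℚ.* sumℚ (λ j → v j ℚ.* ι (B j t))       ≡⟨ cong (ι n ℚ.*_) (z t) ⟩
    ι n ℚ.* 0ℚ                                   ≡⟨ ℚP.*-zeroʳ (ι n) ⟩
    0ℚ ∎)

*-nonNeg : ∀ {p q} → 0ℚ ℚ.≤ p → 0ℚ ℚ.≤ q → 0ℚ ℚ.≤ p ℚ.* q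
*-nonNeg {p} {q} 0≤p 0≤q = ℚP.nonNegative⁻¹ (p ℚ.* q) {{ℚP.nonNeg*nonNeg⇒nonNeg p {{ℚ.nonNegative 0≤p}} q {{ℚ.nonNegative 0≤q}}}}

≤⇒0≤- : ∀ {p q} → p ℚ.≤ q → 0ℚ ℚ.≤ q ℚ.- p
≤⇒0≤- {p} {q} p≤q = subst (ℚ._≤ q ℚ.- p) (ℚP.+-inverseʳ p) (ℚP.+-monoˡ-≤ (ℚ.- p) p≤q)

sumℚ-mono : ∀ {n} {x y : Fin n → ℚ} → (∀ i → x i ℚ.≤ y i) → sumℚ x ℚ.≤ sumℚ y
sumℚ-mono {zero} le = ℚP.≤-refl
sumℚ-mono {suc n} le = ℚP.+-mono-≤ (le zero) (sumℚ-mono (le ∘ suc))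

sumℚ-nonNeg : ∀ {n} {x : Fin n → ℚ} → (∀ i → 0ℚ ℚ.≤ x i) → 0ℚ ℚ.≤ sumℚ x
sumℚ-nonNeg {n} {x} le = subst (λ q → q ℚ.≤ sumℚ x) (Q.∑-0 {n} (λ _ → 0ℚ) (λ _ → refl)) (sumℚ-mono le)

+-nonNeg-0 : ∀ {p q} → 0ℚ ℚ.≤ p → 0ℚ ℚ.≤ q → p ℚ.+ q ≡ 0ℚ → p ≡ 0ℚ × q ≡ 0ℚ
+-nonNeg-0 {p} {q} 0≤p 0≤q e = p≡0 , trans (sym (ℚP.+-identityˡ q)) (trans (cong (ℚ._+ q) (sym p≡0)) e)
  where p≡0 = ℚP.≤-antisym (subst₂ ℚ._≤_ (ℚP.+-identityʳ p) e (ℚP.+-monoʳ-≤ p 0≤q)) 0≤p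

sumℚ-nonNeg-0 : ∀ {n} {x : Fin n → ℚ} → (∀ i → 0ℚ ℚ.≤ x i) → sumℚ x ≡ 0ℚ → ∀ i → x i ≡ 0ℚ
sumℚ-nonNeg-0 {suc n} le e i with +-nonNeg-0 (le zero) (sumℚ-nonNeg (le ∘ suc)) e
sumℚ-nonNeg-0 {suc n} le e zero    | z , _ = z
sumℚ-nonNeg-0 {suc n} le e (suc i) | _ , r = sumℚ-nonNeg-0 (le ∘ suc) r i

-- Facets of the symmetric homology polytope

sgn : Bool → ℤ
sgn true  = 1ℤ
sgn false = -1ℤ

SignSolvable : SimplicialComplex → ℕ → Set
SignSolvable Δ k = ∀ (ε : Fin (f Δ (suc k)) → Bool) →
  Σ (Fin (f Δ k) → ℤ) λ w → ∀ i → sumℤ (λ t → w t ℤ.* bdEntry Δ k i t) ≡ sgn (ε i)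

∈-allFaces : ∀ {n} (σ : Face n) → σ ∈ allFaces n
∈-allFaces [] = here refl
∈-allFaces {suc n} (true ∷ σ) = ∈-++⁺ˡ (∈-map⁺ (true ∷_) (∈-allFaces σ))
∈-allFaces {suc n} (false ∷ σ) = ∈-++⁺ʳ (List.map (true ∷_) (allFaces n)) (∈-map⁺ (false ∷_) (∈-allFaces σ))

∈-keep : ∀ {X : Set} (p : X → Bool) {x xs} → p x ≡ true → x ∈ xs → x ∈ keep p xs
∈-keep p px (here refl) rewrite px = here refl
∈-keep p {xs = y List.∷ _} px (there x∈) with p y
... | true = there (∈-keep p px x∈)
... | false = ∈-keep p px x∈

-- Supplies one column of the boundary matrix. The midpoint of ± this column puts the origin into
-- the polytope, and s ≥ 1 lets a facet have dimension s - 1.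
top-face : ∀ Δ k → IsDim Δ k → Fin (f Δ k)
top-face Δ k ((σ , m , s) , _) = index (∈-keep (isFace Δ k) isF (∈-allFaces σ))
  where isF : isFace Δ k σ ≡ true
        isF rewrite m | s = ≡ᵇ-refl k

HasAffIndep-mono : ∀ {m N} {S T : (Fin m → ℚ) → Set} → (∀ x → S x → T x) → HasAffIndep S N → HasAffIndep T N
HasAffIndep-mono S⊆T (p , p∈S , ind) = p , (λ a → S⊆T (p a) (p∈S a)) , ind

Fin⇒suc : ∀ {s} → Fin s → ∃[ s′ ] s ≡ suc s′
Fin⇒suc {suc s} _ = s , refl

-- On a hyperplane where the form c has a nonzero value, this makes the coefficients of every linear
-- relation sum to 0, so affine and linear independence agree there.
dot-kernel : ∀ {N m} (c : Fin m → ℚ) (κ : Fin N → ℚ) (q : Fin N → Fin m → ℚ) →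
             (∀ t → sumℚ (λ a → κ a ℚ.* q a t) ≡ 0ℚ) → sumℚ (λ a → κ a ℚ.* dot c (q a)) ≡ 0ℚ
dot-kernel c κ q z = begin
  sumℚ (λ a → κ a ℚ.* dot c (q a))                   ≡⟨ Q.∑-cong (λ a → cong (κ a ℚ.*_) (Q.∑-cong (λ t → ℚP.*-comm (c t) (q a t)))) ⟩
  sumℚ (λ a → κ a ℚ.* sumℚ (λ t → q a t ℚ.* c t))    ≡⟨ Q.∑-assoc κ q c ⟩
  sumℚ (λ t → sumℚ (λ a → κ a ℚ.* q a t) ℚ.* c t)    ≡⟨ Q.∑-0 _ (λ t → trans (cong (ℚ._* c t) (z t)) (ℚP.*-zeroˡ (c t))) ⟩
  0ℚ ∎

-- `bit b` and `bit (not b)` are the weights of a vertex of sign b on a column and on its negative.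
bit : Bool → ℚ
bit b = if b then 1ℚ else 0ℚ

bit-nonNeg : ∀ b → 0ℚ ℚ.≤ bit b
bit-nonNeg true = ℚP.nonNegative⁻¹ 1ℚ
bit-nonNeg false = ℚP.≤-refl

bit-diff : ∀ b → bit b ℚ.- bit (not b) ≡ ι (sgn b)
bit-diff true = refl
bit-diff false = refl

bit-total : ∀ b → bit b ℚ.+ bit (not b) ≡ 1ℚ
bit-total true = refl
bit-total false = refl

sgn-square : ∀ b → ι (sgn b) ℚ.* ι (sgn b) ≡ 1ℚ
sgn-square true = refl
sgn-square false = refl

sgn≢0 : ∀ b → ι (sgn b) ≢ 0ℚ
sgn≢0 true ()
sgn≢0 false ()

unit-nonNeg : ∀ {n} (i j : Fin n) → 0ℚ ℚ.≤ Q.unit i j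
unit-nonNeg zero    zero    = ℚP.nonNegative⁻¹ 1ℚ
unit-nonNeg zero    (suc j) = ℚP.≤-refl
unit-nonNeg (suc i) zero    = ℚP.≤-refl
unit-nonNeg (suc i) (suc j) = unit-nonNeg i j

unit-diag : ∀ {n} (i : Fin n) → Q.unit i i ≡ 1ℚ
unit-diag zero    = refl
unit-diag (suc i) = unit-diag i

unit-total : ∀ {n} (i : Fin n) → sumℚ (Q.unit i) ≡ 1ℚ
unit-total i = trans (Q.∑-cong (λ j → sym (ℚP.*-identityʳ (Q.unit i j)))) (Q.∑-unit i (λ _ → 1ℚ))

module Columns (Δ : SimplicialComplex) (k : ℕ) where

  s m : ℕ
  s = f Δ (suc k)
  m = f Δ k

  B : Fin s → Fin m → ℤ
  B = bdEntry Δ k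

module Facets (Δ : SimplicialComplex) (k : ℕ) (dim : IsDim Δ (suc k)) (top : TopHomologyVanishes Δ k) where

  open Columns Δ k

  Bq : Fin s → Fin m → ℚ
  Bq i t = ι (B i t)

  i₀ : Fin s
  i₀ = top-face Δ (suc k) dim

  independent : ∀ c → (∀ t → sumℤ (λ j → c j ℤ.* B j t) ≡ 0ℤ) → ∀ j → c j ≡ 0ℤ
  independent c z = top c (λ t → trans (Z.∑-cong (λ i → ℤP.*-comm (B i t) (c i))) (z t))

  independentℚ : ∀ v → (∀ t → sumℚ (λ j → v j ℚ.* Bq j t) ≡ 0ℚ) → ∀ j → v j ≡ 0ℚ
  independentℚ = ℤ-independent⇒ℚ-independent B independent

  P : Point Δ k → Set
  P = InP Δ k

  coord : ∀ {x} → P x → Fin s → ℚ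
  coord (λp , λn , _) i = λp i ℚ.- λn i

  coord-comb : ∀ {x} (x∈P : P x) t → x t ≡ sumℚ (λ i → coord x∈P i ℚ.* Bq i t)
  coord-comb (_ , _ , _ , _ , _ , e) = e

  dot-comb : ∀ c {x} μ → (∀ t → x t ≡ sumℚ (λ i → μ i ℚ.* Bq i t)) → dot c x ≡ sumℚ (λ i → μ i ℚ.* dot c (Bq i))
  dot-comb c {x} μ e = begin
    dot c x                                                  ≡⟨ Q.∑-cong (λ t → cong (c t ℚ.*_) (trans (e t) (Q.∑-cong (λ i → ℚP.*-comm (μ i) (Bq i t))))) ⟩
    sumℚ (λ t → c t ℚ.* sumℚ (λ i → Bq i t ℚ.* μ i))         ≡⟨ Q.∑-assoc c (λ t i → Bq i t) μ ⟩
    sumℚ (λ i → dot c (Bq i) ℚ.* μ i)                        ≡⟨ Q.∑-cong (λ i → ℚP.*-comm (dot c (Bq i)) (μ i)) ⟩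
    sumℚ (λ i → μ i ℚ.* dot c (Bq i)) ∎

  points-comb : ∀ {N} (κ : Fin N → ℚ) (q : Fin N → Point Δ k) (q∈P : ∀ a → P (q a)) t →
                sumℚ (λ a → κ a ℚ.* q a t) ≡ sumℚ (λ j → sumℚ (λ a → κ a ℚ.* coord (q∈P a) j) ℚ.* Bq j t)
  points-comb κ q q∈P t = trans (Q.∑-cong (λ a → cong (κ a ℚ.*_) (coord-comb (q∈P a) t)))
                                (Q.∑-assoc κ (λ a j → coord (q∈P a) j) (λ j → Bq j t))

  vertex : Bool → Fin s → Point Δ k
  vertex b i t = ι (sgn b) ℚ.* Bq i t

  vertex∈P : ∀ b i → P (vertex b i)
  vertex∈P b i = (λ j → bit b ℚ.* Q.unit i j) , (λ j → bit (not b) ℚ.* Q.unit i j) ,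
    (λ j → *-nonNeg (bit-nonNeg b) (unit-nonNeg i j)) , (λ j → *-nonNeg (bit-nonNeg (not b)) (unit-nonNeg i j)) ,
    (begin
      sumℚ (λ j → bit b ℚ.* Q.unit i j) ℚ.+ sumℚ (λ j → bit (not b) ℚ.* Q.unit i j)
        ≡⟨ cong₂ ℚ._+_ (total b) (total (not b)) ⟩
      bit b ℚ.+ bit (not b) ≡⟨ bit-total b ⟩
      1ℚ ∎) ,
    λ t → sym (begin
      sumℚ (λ j → (bit b ℚ.* Q.unit i j ℚ.- bit (not b) ℚ.* Q.unit i j) ℚ.* Bq j t)
        ≡⟨ Q.∑-cong (λ j → factor (bit b) (bit (not b)) (Q.unit i j) (Bq j t)) ⟩
      sumℚ (λ j → (bit b ℚ.- bit (not b)) ℚ.* (Q.unit i j ℚ.* Bq j t))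
        ≡⟨ Q.∑-*ˡ (bit b ℚ.- bit (not b)) (λ j → Q.unit i j ℚ.* Bq j t) ⟩
      (bit b ℚ.- bit (not b)) ℚ.* sumℚ (λ j → Q.unit i j ℚ.* Bq j t)
        ≡⟨ cong₂ ℚ._*_ (bit-diff b) (Q.∑-unit i (λ j → Bq j t)) ⟩
      vertex b i t ∎)
    where
    total : ∀ b → sumℚ (λ j → bit b ℚ.* Q.unit i j) ≡ bit b
    total b = trans (Q.∑-*ˡ (bit b) (Q.unit i)) (trans (cong (bit b ℚ.*_) (unit-total i)) (ℚP.*-identityʳ (bit b)))
    factor : ∀ a b u x → (a ℚ.* u ℚ.- b ℚ.* u) ℚ.* x ≡ (a ℚ.- b) ℚ.* (u ℚ.* x)
    factor = RingSolver.solve-∀ ℚ-ring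

  origin∈P : P (λ _ → 0ℚ)
  origin∈P = (λ j → ½ ℚ.* Q.unit i₀ j) , (λ j → ½ ℚ.* Q.unit i₀ j) , half≥0 , half≥0 ,
    cong₂ ℚ._+_ total total ,
    λ t → sym (Q.∑-0 {s} _ (λ j → trans (cong (ℚ._* Bq j t) (ℚP.+-inverseʳ (½ ℚ.* Q.unit i₀ j))) (ℚP.*-zeroˡ (Bq j t))))
    where
    half≥0 = λ j → *-nonNeg (ℚP.nonNegative⁻¹ ½) (unit-nonNeg i₀ j)
    total : sumℚ (λ j → ½ ℚ.* Q.unit i₀ j) ≡ ½
    total = trans (Q.∑-*ˡ ½ (Q.unit i₀)) (trans (cong (½ ℚ.*_) (unit-total i₀)) (ℚP.*-identityʳ ½))

  dot-vertex : ∀ c b i → dot c (vertex b i) ≡ ι (sgn b) ℚ.* dot c (Bq i)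
  dot-vertex c b i = trans (Q.∑-cong (λ t → swap (c t) (ι (sgn b)) (Bq i t))) (Q.∑-*ˡ (ι (sgn b)) (λ t → c t ℚ.* Bq i t))
    where swap : ∀ x y z → x ℚ.* (y ℚ.* z) ≡ y ℚ.* (x ℚ.* z)
          swap = RingSolver.solve-∀ ℚ-ring

  module Supporting (c : Point Δ k) (h : ℚ) (bound : ∀ x → P x → dot c x ℚ.≤ h) where

    γ : Fin s → ℚ
    γ i = dot c (Bq i)

    upper : ∀ i → γ i ℚ.≤ h
    upper i = subst (ℚ._≤ h) (trans (dot-vertex c true i) (ℚP.*-identityˡ (γ i))) (bound _ (vertex∈P true i))

    lower : ∀ i → ℚ.- γ i ℚ.≤ h
    lower i = subst (ℚ._≤ h) (trans (dot-vertex c false i) (neg1 (γ i))) (bound _ (vertex∈P false i))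
      where neg1 : ∀ x → ι (sgn false) ℚ.* x ≡ ℚ.- x
            neg1 x = trans (sym (ℚP.neg-distribˡ-* 1ℚ x)) (cong ℚ.-_ (ℚP.*-identityˡ x))

    h≥0 : 0ℚ ℚ.≤ h
    h≥0 = subst (ℚ._≤ h) (Q.∑-0 {m} _ (λ t → ℚP.*-zeroʳ (c t))) (bound _ origin∈P)

    -- The gaps λp (h − γ) + λn (h + γ) are non-negative and sum to zero.
    off-extremal : ∀ {x} (x∈P : P x) → dot c x ≡ h → ∀ i → γ i ≢ h → ℚ.- γ i ≢ h → coord x∈P i ≡ 0ℚ
    off-extremal x∈P@(λp , λn , p≥0 , n≥0 , one , e) attained i γ≢h -γ≢h =
      cong₂ ℚ._-_ (solve-0 (λp i) (γ i) γ≢h (proj₁ both)) (solve-0 (λn i) (ℚ.- γ i) -γ≢h (proj₂ both))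
      where
      pos neg gap : Fin s → ℚ
      pos j = λp j ℚ.* (h ℚ.- γ j)
      neg j = λn j ℚ.* (h ℚ.- (ℚ.- γ j))
      gap j = pos j ℚ.+ neg j

      pos≥0 : ∀ j → 0ℚ ℚ.≤ pos j
      pos≥0 j = *-nonNeg (p≥0 j) (≤⇒0≤- (upper j))

      neg≥0 : ∀ j → 0ℚ ℚ.≤ neg j
      neg≥0 j = *-nonNeg (n≥0 j) (≤⇒0≤- (lower j))

      expand : ∀ a b h g → a ℚ.* (h ℚ.- g) ℚ.+ b ℚ.* (h ℚ.- (ℚ.- g)) ℚ.+ (a ℚ.- b) ℚ.* g ≡ h ℚ.* (a ℚ.+ b)
      expand = RingSolver.solve-∀ ℚ-ring

      x+h≡h⇒x≡0 : ∀ x → x ℚ.+ h ≡ h → x ≡ 0ℚ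
      x+h≡h⇒x≡0 x e = trans (cancel-h x h) (trans (cong (ℚ._- h) e) (ℚP.+-inverseʳ h))
        where cancel-h : ∀ x h → x ≡ x ℚ.+ h ℚ.- h
              cancel-h = RingSolver.solve-∀ ℚ-ring

      total : sumℚ gap ≡ 0ℚ
      total = x+h≡h⇒x≡0 (sumℚ gap) (begin
        sumℚ gap ℚ.+ h                                                      ≡⟨ cong (sumℚ gap ℚ.+_) (trans (sym attained) (dot-comb c (coord x∈P) e)) ⟩
        sumℚ gap ℚ.+ sumℚ (λ j → coord x∈P j ℚ.* γ j)                       ≡⟨ Q.∑-+ gap (λ j → coord x∈P j ℚ.* γ j) ⟨
        sumℚ (λ j → gap j ℚ.+ coord x∈P j ℚ.* γ j)                          ≡⟨ Q.∑-cong (λ j → expand (λp j) (λn j) h (γ j)) ⟩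
        sumℚ (λ j → h ℚ.* (λp j ℚ.+ λn j))                                  ≡⟨ Q.∑-*ˡ h (λ j → λp j ℚ.+ λn j) ⟩
        h ℚ.* sumℚ (λ j → λp j ℚ.+ λn j)                                    ≡⟨ cong (h ℚ.*_) (trans (Q.∑-+ λp λn) one) ⟩
        h ℚ.* 1ℚ                                                            ≡⟨ ℚP.*-identityʳ h ⟩
        h ∎)

      both : pos i ≡ 0ℚ × neg i ≡ 0ℚ
      both = +-nonNeg-0 (pos≥0 i) (neg≥0 i)
               (sumℚ-nonNeg-0 (λ j → ℚP.+-mono-≤ (pos≥0 j) (neg≥0 j)) total i)

      solve-0 : ∀ a g → g ≢ h → a ℚ.* (h ℚ.- g) ≡ 0ℚ → a ≡ 0ℚ
      solve-0 a g g≢h z = ℚ-cancel (h ℚ.- g) (λ q → g≢h (sym (trans (split h g) (trans (cong (ℚ._+ g) q) (ℚP.+-identityˡ g)))))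
                            (trans (ℚP.*-comm (h ℚ.- g) a) z)
        where split : ∀ h g → h ≡ h ℚ.- g ℚ.+ g
              split = RingSolver.solve-∀ ℚ-ring

  -- Both γ i and its negative are at most h. If h = 0, all γ i vanish and the face is all of P,
  -- against its dimension. If h is nonzero, `extremal` rules out the columns at which neither bound
  -- is attained.
  facet-signs : ∀ c h → IsFacet Δ k c h → h ≢ 0ℚ × 0ℚ ℚ.≤ h × Σ (Fin s → Bool) λ ε → ∀ i → dot c (Bq i) ≡ ι (sgn (ε i)) ℚ.* h
  facet-signs c h (bound , D , (P-indep , P-max) , (p , p∈F , p-ind) , F-max) =
    h≢0 , h≥0 , (λ i → proj₁ (sign i)) , (λ i → proj₂ (sign i))
    where
    open Supporting c h bound

    h≢0 : h ≢ 0ℚ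
    h≢0 refl = F-max (HasAffIndep-mono {S = P} {T = FaceOf Δ k c 0ℚ} (λ x x∈P → x∈P , trans (dot-comb c {x} (coord x∈P) (coord-comb x∈P))
                 (Q.∑-0 {s} _ (λ i → trans (cong (coord x∈P i ℚ.*_) (γ≡0 i)) (ℚP.*-zeroʳ (coord x∈P i))))) P-indep)
      where γ≡0 : ∀ i → γ i ≡ 0ℚ
            γ≡0 i = ℚP.≤-antisym (upper i) (subst (0ℚ ℚ.≤_) (neg-neg (γ i)) (ℚP.neg-antimono-≤ (lower i)))
              where neg-neg : ∀ x → ℚ.- (ℚ.- x) ≡ x
                    neg-neg = RingSolver.solve-∀ ℚ-ring

    -- Otherwise ± Bq i together with the points of the facet would be too many affinely independent points of P.
    extremal : ∀ i → γ i ≢ h → ℚ.- γ i ≢ h → ⊥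
    extremal i γ≢h -γ≢h = P-max (q , q∈P , q-ind)
      where
      q : Fin (suc (suc (suc D))) → Point Δ k
      q zero = vertex true i
      q (suc zero) = vertex false i
      q (suc (suc a)) = p a

      q∈P : ∀ a → P (q a)
      q∈P zero = vertex∈P true i
      q∈P (suc zero) = vertex∈P false i
      q∈P (suc (suc a)) = proj₁ (p∈F a)

      -- All facet points have i-th column coordinate 0, so that coordinate of a relation is κ₀ - κ₁
      -- = 0. What remains is a linear relation among facet points, whose coefficients sum to 0
      -- since c has the nonzero value h on them; hence they vanish. Then κ₀ + κ₁ = 0 as well.
      q-ind : AffinelyIndependent q
      q-ind κ Σκ z = λ { zero → κ₀≡0 ; (suc zero) → κ₁≡0 ; (suc (suc a)) → κ′≡0 a }
        where
        κ₀ κ₁ : ℚ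
        κ₀ = κ zero
        κ₁ = κ (suc zero)
        κ′ : Fin (suc D) → ℚ
        κ′ a = κ (suc (suc a))
        ν : Fin s → ℚ
        ν j = sumℚ (λ a → κ′ a ℚ.* coord (proj₁ (p∈F a)) j)

        regroup : ∀ t → sumℚ (λ a → κ a ℚ.* q a t) ≡ (κ₀ ℚ.- κ₁) ℚ.* Bq i t ℚ.+ sumℚ (λ a → κ′ a ℚ.* p a t)
        regroup t = lem κ₀ κ₁ (Bq i t) (sumℚ (λ a → κ′ a ℚ.* p a t))
          where lem₀ : ∀ a b x y → a ℚ.* x ℚ.+ (b ℚ.* (ℚ.- x) ℚ.+ y) ≡ (a ℚ.- b) ℚ.* x ℚ.+ y
                lem₀ = RingSolver.solve-∀ ℚ-ring
                lem : ∀ a b x y → a ℚ.* (ι 1ℤ ℚ.* x) ℚ.+ (b ℚ.* (ι -1ℤ ℚ.* x) ℚ.+ y) ≡ (a ℚ.- b) ℚ.* x ℚ.+ y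
                lem a b x y = trans (cong₂ (λ u v → a ℚ.* u ℚ.+ (b ℚ.* v ℚ.+ y)) (ℚP.*-identityˡ x)
                                      (trans (sym (ℚP.neg-distribˡ-* 1ℚ x)) (cong ℚ.-_ (ℚP.*-identityˡ x)))) (lem₀ a b x y)

        comb≡0 : ∀ t → sumℚ (λ j → ((κ₀ ℚ.- κ₁) ℚ.* Q.unit i j ℚ.+ ν j) ℚ.* Bq j t) ≡ 0ℚ
        comb≡0 t = begin
          sumℚ (λ j → ((κ₀ ℚ.- κ₁) ℚ.* Q.unit i j ℚ.+ ν j) ℚ.* Bq j t)
            ≡⟨ Q.∑-cong (λ j → distrib (κ₀ ℚ.- κ₁) (Q.unit i j) (ν j) (Bq j t)) ⟩
          sumℚ (λ j → (κ₀ ℚ.- κ₁) ℚ.* (Q.unit i j ℚ.* Bq j t) ℚ.+ ν j ℚ.* Bq j t)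
            ≡⟨ Q.∑-+ (λ j → (κ₀ ℚ.- κ₁) ℚ.* (Q.unit i j ℚ.* Bq j t)) (λ j → ν j ℚ.* Bq j t) ⟩
          sumℚ (λ j → (κ₀ ℚ.- κ₁) ℚ.* (Q.unit i j ℚ.* Bq j t)) ℚ.+ sumℚ (λ j → ν j ℚ.* Bq j t)
            ≡⟨ cong₂ ℚ._+_ (trans (Q.∑-*ˡ (κ₀ ℚ.- κ₁) (λ j → Q.unit i j ℚ.* Bq j t)) (cong ((κ₀ ℚ.- κ₁) ℚ.*_) (Q.∑-unit i (λ j → Bq j t))))
                           (sym (points-comb κ′ p (λ a → proj₁ (p∈F a)) t)) ⟩
          (κ₀ ℚ.- κ₁) ℚ.* Bq i t ℚ.+ sumℚ (λ a → κ′ a ℚ.* p a t)  ≡⟨ regroup t ⟨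
          sumℚ (λ a → κ a ℚ.* q a t)                              ≡⟨ z t ⟩
          0ℚ ∎
          where distrib : ∀ d u n x → (d ℚ.* u ℚ.+ n) ℚ.* x ≡ d ℚ.* (u ℚ.* x) ℚ.+ n ℚ.* x
                distrib = RingSolver.solve-∀ ℚ-ring

        νi≡0 : ν i ≡ 0ℚ
        νi≡0 = Q.∑-0 {suc D} _ (λ a → trans (cong (κ′ a ℚ.*_) (off-extremal (proj₁ (p∈F a)) (proj₂ (p∈F a)) i γ≢h -γ≢h)) (ℚP.*-zeroʳ (κ′ a)))

        κ₀-κ₁≡0 : κ₀ ℚ.- κ₁ ≡ 0ℚ
        κ₀-κ₁≡0 = begin
          κ₀ ℚ.- κ₁                                 ≡⟨ trans (ℚP.+-identityʳ _) (ℚP.*-identityʳ (κ₀ ℚ.- κ₁)) ⟨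
          (κ₀ ℚ.- κ₁) ℚ.* 1ℚ ℚ.+ 0ℚ                 ≡⟨ cong₂ (λ u n → (κ₀ ℚ.- κ₁) ℚ.* u ℚ.+ n) (unit-diag i) νi≡0 ⟨
          (κ₀ ℚ.- κ₁) ℚ.* Q.unit i i ℚ.+ ν i        ≡⟨ independentℚ (λ j → (κ₀ ℚ.- κ₁) ℚ.* Q.unit i j ℚ.+ ν j) comb≡0 i ⟩
          0ℚ ∎

        p-dep : ∀ t → sumℚ (λ a → κ′ a ℚ.* p a t) ≡ 0ℚ
        p-dep t = begin
          sumℚ (λ a → κ′ a ℚ.* p a t)                              ≡⟨ ℚP.+-identityˡ _ ⟨
          0ℚ ℚ.+ sumℚ (λ a → κ′ a ℚ.* p a t)                       ≡⟨ cong (ℚ._+ sumℚ (λ a → κ′ a ℚ.* p a t)) (trans (cong (ℚ._* Bq i t) κ₀-κ₁≡0) (ℚP.*-zeroˡ (Bq i t))) ⟨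
          (κ₀ ℚ.- κ₁) ℚ.* Bq i t ℚ.+ sumℚ (λ a → κ′ a ℚ.* p a t)   ≡⟨ regroup t ⟨
          sumℚ (λ a → κ a ℚ.* q a t)                               ≡⟨ z t ⟩
          0ℚ ∎

        Σκ′≡0 : sumℚ κ′ ≡ 0ℚ
        Σκ′≡0 = ℚ-cancel h h≢0 (begin
          h ℚ.* sumℚ κ′                           ≡⟨ Q.∑-*ˡ h κ′ ⟨
          sumℚ (λ a → h ℚ.* κ′ a)                 ≡⟨ Q.∑-cong (λ a → trans (ℚP.*-comm h (κ′ a)) (cong (κ′ a ℚ.*_) (sym (proj₂ (p∈F a))))) ⟩
          sumℚ (λ a → κ′ a ℚ.* dot c (p a))       ≡⟨ dot-kernel c κ′ p p-dep ⟩
          0ℚ ∎)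

        κ′≡0 : ∀ a → κ′ a ≡ 0ℚ
        κ′≡0 = p-ind κ′ Σκ′≡0 p-dep

        κ₀+κ₁≡0 : κ₀ ℚ.+ κ₁ ≡ 0ℚ
        κ₀+κ₁≡0 = trans (trans (cong (κ₀ ℚ.+_) (sym (ℚP.+-identityʳ κ₁))) (cong (λ n → κ₀ ℚ.+ (κ₁ ℚ.+ n)) (sym Σκ′≡0))) Σκ

        κ₁≡0 : κ₁ ≡ 0ℚ
        κ₁≡0 = ℚ-cancel (1ℚ ℚ.+ 1ℚ) (λ ()) (trans (diff κ₀ κ₁) (cong₂ ℚ._-_ κ₀+κ₁≡0 κ₀-κ₁≡0))
          where diff : ∀ a b → (1ℚ ℚ.+ 1ℚ) ℚ.* b ≡ (a ℚ.+ b) ℚ.- (a ℚ.- b)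
                diff = RingSolver.solve-∀ ℚ-ring

        κ₀≡0 : κ₀ ≡ 0ℚ
        κ₀≡0 = trans (sym (ℚP.+-identityʳ κ₀)) (trans (cong (κ₀ ℚ.+_) (sym κ₁≡0)) κ₀+κ₁≡0)

    sign : ∀ i → ∃[ b ] γ i ≡ ι (sgn b) ℚ.* h
    sign i with γ i ℚP.≟ h
    ... | yes e = true , trans e (sym (ℚP.*-identityˡ h))
    ... | no γ≢h with (ℚ.- γ i) ℚP.≟ h
    ...   | yes e = false , trans (neg-neg (γ i)) (trans (cong ℚ.-_ e) (trans (cong ℚ.-_ (sym (ℚP.*-identityˡ h))) (ℚP.neg-distribˡ-* 1ℚ h)))
      where neg-neg : ∀ x → x ≡ ℚ.- (ℚ.- x)
            neg-neg = RingSolver.solve-∀ ℚ-ring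
    ...   | no -γ≢h = ⊥-elim (extremal i γ≢h -γ≢h)

  -- The given normal c and h times the integral solution w agree on every column, hence on the span
  -- of the columns. They may differ elsewhere, but P lies in that span.
  signSolvable⇒reflexive : SignSolvable Δ k → Reflexive Δ k
  signSolvable⇒reflexive solvable c h facet with facet-signs c h facet
  ... | h≢0 , h≥0 , ε , γ≡ with solvable ε
  ...   | w , w≡ = w ,
          (λ x x∈P → ℚP.*-cancelˡ-≤-pos h {{h>0}} (subst₂ ℚ._≤_ (scaled x x∈P) (sym (ℚP.*-identityʳ h)) (proj₁ facet x x∈P))) ,
          (λ { x (x∈P , e) → x∈P , Q.*-cancelˡ h h≢0 (trans (sym (scaled x x∈P)) (trans e (sym (ℚP.*-identityʳ h)))) }) ,
          (λ x x∈P e → x∈P , trans (scaled x x∈P) (trans (cong (h ℚ.*_) e) (ℚP.*-identityʳ h)))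
    where
    wq : Point Δ k
    wq t = ι (w t)
    h>0 : ℚ.Positive h
    h>0 = ℚP.nonNeg∧nonZero⇒pos h {{ℚ.nonNegative h≥0}} {{ℚ.≢-nonZero h≢0}}
    scaled : ∀ x → P x → dot c x ≡ h ℚ.* dot wq x
    scaled x x∈P = begin
      dot c x                                                   ≡⟨ dot-comb c (coord x∈P) (coord-comb x∈P) ⟩
      sumℚ (λ i → coord x∈P i ℚ.* dot c (Bq i))                 ≡⟨ Q.∑-cong (λ i → trans (cong (coord x∈P i ℚ.*_) (trans (γ≡ i) (cong (λ n → ι n ℚ.* h) (sym (w≡ i))))) (swap (coord x∈P i) _ h)) ⟩
      sumℚ (λ i → h ℚ.* (coord x∈P i ℚ.* ι (sumℤ (λ t → w t ℤ.* B i t))))  ≡⟨ Q.∑-*ˡ h (λ i → coord x∈P i ℚ.* ι (sumℤ (λ t → w t ℤ.* B i t))) ⟩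
      h ℚ.* sumℚ (λ i → coord x∈P i ℚ.* ι (sumℤ (λ t → w t ℤ.* B i t)))    ≡⟨ cong (h ℚ.*_) (Q.∑-cong (λ i → cong (coord x∈P i ℚ.*_) (ι-∑-* w (B i)))) ⟩
      h ℚ.* sumℚ (λ i → coord x∈P i ℚ.* dot wq (Bq i))          ≡⟨ cong (h ℚ.*_) (dot-comb wq (coord x∈P) (coord-comb x∈P)) ⟨
      h ℚ.* dot wq x ∎
      where swap : ∀ a e h → a ℚ.* (e ℚ.* h) ≡ h ℚ.* (a ℚ.* e)
            swap = RingSolver.solve-∀ ℚ-ring

  module SignFacet (ε : Fin s → Bool) where

    -- Over ℚ every nonzero n divides everything, so Kronecker's criterion asks only for
    -- independence.
    solution : ∃[ c ] (∀ i → dot c (Bq i) ≡ ι (sgn (ε i)))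
    solution = Q.kroneckerᶠ Bq (λ i → ι (sgn (ε i))) independentℚ
      (λ n n≢0 c _ _ → let instance _ = ℚ.≢-nonZero n≢0 in
        ℚ.1/ n ℚ.* sumℚ (λ j → c j ℚ.* ι (sgn (ε j))) ,
        sym (trans (sym (ℚP.*-assoc n (ℚ.1/ n) _)) (trans (cong (ℚ._* sumℚ (λ j → c j ℚ.* ι (sgn (ε j)))) (ℚP.*-inverseʳ n)) (ℚP.*-identityˡ _))))

    c : Point Δ k
    c = proj₁ solution

    F : Point Δ k → Set
    F = FaceOf Δ k c 1ℚ

    bound : ∀ x → P x → dot c x ℚ.≤ 1ℚ
    bound x x∈P@(λp , λn , p≥0 , n≥0 , one , e) =
      subst₂ ℚ._≤_ (sym (dot-comb c (coord x∈P) e)) (trans (Q.∑-+ λp λn) one)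
        (sumℚ-mono (λ i → subst (λ g → (λp i ℚ.- λn i) ℚ.* g ℚ.≤ λp i ℚ.+ λn i) (sym (proj₂ solution i)) (signed (ε i) (p≥0 i) (n≥0 i))))
      where
      ≤-by : ∀ {x y} d → 0ℚ ℚ.≤ d → x ℚ.+ d ≡ y → x ℚ.≤ y
      ≤-by {x} d d≥0 refl = subst (ℚ._≤ x ℚ.+ d) (ℚP.+-identityʳ x) (ℚP.+-monoʳ-≤ x d≥0)
      signed : ∀ b {p n} → 0ℚ ℚ.≤ p → 0ℚ ℚ.≤ n → (p ℚ.- n) ℚ.* ι (sgn b) ℚ.≤ p ℚ.+ n
      signed true {p} {n} p≥0 n≥0 = ≤-by (n ℚ.+ n) (ℚP.+-mono-≤ n≥0 n≥0) (trans (cong (ℚ._+ (n ℚ.+ n)) (ℚP.*-identityʳ (p ℚ.- n))) (lem p n))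
        where lem : ∀ p n → p ℚ.- n ℚ.+ (n ℚ.+ n) ≡ p ℚ.+ n
              lem = RingSolver.solve-∀ ℚ-ring
      signed false {p} {n} p≥0 n≥0 = ≤-by (p ℚ.+ p) (ℚP.+-mono-≤ p≥0 p≥0)
          (trans (cong (ℚ._+ (p ℚ.+ p)) (trans (sym (ℚP.neg-distribʳ-* (p ℚ.- n) 1ℚ)) (cong ℚ.-_ (ℚP.*-identityʳ (p ℚ.- n))))) (lem p n))
        where lem : ∀ p n → ℚ.- (p ℚ.- n) ℚ.+ (p ℚ.+ p) ≡ p ℚ.+ n
              lem = RingSolver.solve-∀ ℚ-ring

    vertex∈F : ∀ i → F (vertex (ε i) i)
    vertex∈F i = vertex∈P (ε i) i , trans (dot-vertex c (ε i) i) (trans (cong (ι (sgn (ε i)) ℚ.*_) (proj₂ solution i)) (sgn-square (ε i)))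

    coordinates-dependent : ∀ {N} (κ : Fin N → ℚ) (q : Fin N → Point Δ k) (q∈P : ∀ a → P (q a)) →
      (∀ j → sumℚ (λ a → κ a ℚ.* coord (q∈P a) j) ≡ 0ℚ) → ∀ t → sumℚ (λ a → κ a ℚ.* q a t) ≡ 0ℚ
    coordinates-dependent κ q q∈P z t = trans (points-comb κ q q∈P t)
      (Q.∑-0 {s} _ (λ j → trans (cong (ℚ._* Bq j t) (z j)) (ℚP.*-zeroˡ (Bq j t))))

    P-indep : HasAffIndep P (suc s)
    P-indep = points , (λ { zero → origin∈P ; (suc j) → vertex∈P true j }) , ind
      where
      points : Fin (suc s) → Point Δ k
      points zero t = 0ℚ
      points (suc j) = vertex true j
      ind : AffinelyIndependent points
      ind κ Σκ z = λ { zero → κ₀≡0 ; (suc j) → κ≡0 j }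
        where
        κ≡0 : ∀ j → κ (suc j) ≡ 0ℚ
        κ≡0 = independentℚ (κ ∘ suc) (λ t → trans (trans (Q.∑-cong (λ j → cong (κ (suc j) ℚ.*_) (sym (ℚP.*-identityˡ (Bq j t)))))
                (trans (sym (ℚP.+-identityˡ _)) (cong (λ u → u ℚ.+ sumℚ (λ j → κ (suc j) ℚ.* vertex true j t)) (sym (ℚP.*-zeroʳ (κ zero)))))) (z t))
        κ₀≡0 : κ zero ≡ 0ℚ
        κ₀≡0 = trans (sym (trans (cong (κ zero ℚ.+_) (Q.∑-0 (κ ∘ suc) κ≡0)) (ℚP.+-identityʳ (κ zero)))) Σκ

    F-indep : HasAffIndep F s
    F-indep = (λ j → vertex (ε j) j) , vertex∈F , λ κ Σκ z j →
      ℚ-cancel (ι (sgn (ε j))) (sgn≢0 (ε j)) (trans (ℚP.*-comm _ (κ j))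
        (independentℚ (λ j → κ j ℚ.* ι (sgn (ε j))) (λ t → trans (Q.∑-cong (λ j → ℚP.*-assoc (κ j) _ (Bq j t))) (z t)) j))

    -- An affine relation among s + 2 points is a solution of s + 1 equations: one for each column
    -- coordinate, and the row of ones for the sum of the coefficients.
    P-max : ¬ HasAffIndep P (suc (suc s))
    P-max (q , q∈P , ind) with Q.nontrivial-kernel C ℕP.≤-refl
      where C : Fin (suc s) → Fin (suc (suc s)) → ℚ
            C zero a = 1ℚ
            C (suc j) a = coord (q∈P a) j
    ... | κ , z , nontrivial = nontrivial (ind κ (trans (Q.∑-cong (λ a → sym (ℚP.*-identityˡ (κ a)))) (z zero))
            (coordinates-dependent κ q q∈P (λ j → trans (Q.∑-cong (λ a → ℚP.*-comm (κ a) (coord (q∈P a) j))) (z (suc j)))))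

    -- Here the s coordinate equations suffice: c equals 1 on F, so the sum of the coefficients of a
    -- linear relation vanishes by itself.
    F-max : ¬ HasAffIndep F (suc s)
    F-max (q , q∈F , ind) with Q.nontrivial-kernel (λ j a → coord (proj₁ (q∈F a)) j) ℕP.≤-refl
    ... | κ , z , nontrivial = nontrivial (ind κ
            (trans (Q.∑-cong (λ a → trans (sym (ℚP.*-identityʳ (κ a))) (cong (κ a ℚ.*_) (sym (proj₂ (q∈F a)))))) (dot-kernel c κ q dep)) dep)
      where dep = coordinates-dependent κ q (λ a → proj₁ (q∈F a)) (λ j → trans (Q.∑-cong (λ a → ℚP.*-comm (κ a) (coord (proj₁ (q∈F a)) j))) (z j))

    facet : IsFacet Δ k c 1ℚ
    facet with Fin⇒suc i₀
    ... | D , s≡ = bound , D ,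
          (subst (λ n → HasAffIndep P (suc n)) s≡ P-indep , subst (λ n → ¬ HasAffIndep P (suc (suc n))) s≡ P-max) ,
          (subst (HasAffIndep F) s≡ F-indep , subst (λ n → ¬ HasAffIndep F (suc n)) s≡ F-max)

  -- Each vertex ε_i B_i lies on the facet cut out by the rational solution for ε, so the integral
  -- normal of that facet has value 1 there and ε_i at B_i.
  reflexive⇒signSolvable : Reflexive Δ k → SignSolvable Δ k
  reflexive⇒signSolvable reflexive ε = w , λ i → ι-injective (trans (ι-∑-* w (B i)) (sign-inverse (ε i) (on-vertex i)))
    where
    open SignFacet ε
    valid = reflexive c 1ℚ facet
    w : Fin m → ℤ
    w = proj₁ valid
    wq : Point Δ k
    wq t = ι (w t)
    on-vertex : ∀ i → ι (sgn (ε i)) ℚ.* dot wq (Bq i) ≡ 1ℚ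
    on-vertex i = trans (sym (dot-vertex wq (ε i) i)) (proj₂ (proj₁ (proj₂ (proj₂ valid)) (vertex (ε i) i) (vertex∈F i)))
    sign-inverse : ∀ b {x} → ι (sgn b) ℚ.* x ≡ 1ℚ → x ≡ ι (sgn b)
    sign-inverse b e = Q.*-cancelˡ (ι (sgn b)) (sgn≢0 b) (trans e (sym (sgn-square b)))

-- Torsion and integer solvability

EvenZ : ℤ → Set
EvenZ x = ∃[ e ] x ≡ e ℤ.+ e

even-+ : ∀ {x y} → EvenZ x → EvenZ y → EvenZ (x ℤ.+ y)
even-+ (a , refl) (b , refl) = a ℤ.+ b , lem a b
  where lem : ∀ a b → a ℤ.+ a ℤ.+ (b ℤ.+ b) ≡ a ℤ.+ b ℤ.+ (a ℤ.+ b)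
        lem = ℤS.solve-∀

even-*ˡ : ∀ a {x} → EvenZ x → EvenZ (a ℤ.* x)
even-*ˡ a (b , refl) = a ℤ.* b , ℤP.*-distribˡ-+ a b b

even-∑ : ∀ {n} (x : Fin n → ℤ) → (∀ i → EvenZ (x i)) → EvenZ (sumℤ x)
even-∑ {zero} x e = 0ℤ , refl
even-∑ {suc n} x e = even-+ (e zero) (even-∑ (x ∘ suc) (e ∘ suc))


double-cancel : ∀ {x y} → x ℤ.+ x ≡ y ℤ.+ y → x ≡ y
double-cancel {x} {y} e = Z.*-cancelˡ (+ 2) (λ ()) (trans (sym (lem x)) (trans e (lem y)))
  where lem : ∀ x → x ℤ.+ x ≡ + 2 ℤ.* x
        lem = ℤS.solve-∀

∑-double : ∀ {n} (x : Fin n → ℤ) → sumℤ (λ i → x i ℤ.+ x i) ≡ sumℤ x ℤ.+ sumℤ x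
∑-double x = Z.∑-+ x x

HalfIntegral : ∀ {n} → (Fin n → ℚ) → Set
HalfIntegral v = ∀ i → v i ≡ ½ ⊎ v i ≡ -½ ⊎ v i ≡ 0ℚ

twiceAt : ∀ {q} → q ≡ ½ ⊎ q ≡ -½ ⊎ q ≡ 0ℚ → ℤ
twiceAt (inj₁ _)        = 1ℤ
twiceAt (inj₂ (inj₁ _)) = -1ℤ
twiceAt (inj₂ (inj₂ _)) = 0ℤ

twice : ∀ {n} {v : Fin n → ℚ} → HalfIntegral v → Fin n → ℤ
twice h i = twiceAt (h i)

ι-twiceAt : ∀ {q} (h : q ≡ ½ ⊎ q ≡ -½ ⊎ q ≡ 0ℚ) → ι (twiceAt h) ≡ q ℚ.+ q
ι-twiceAt (inj₁ refl)        = refl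
ι-twiceAt (inj₂ (inj₁ refl)) = refl
ι-twiceAt (inj₂ (inj₂ refl)) = refl

-- Each nonzero entry of 2v is odd; an entry -1 = 1 - 2 counts as one nonzero entry and lowers e by
-- 1.
twice-sum : ∀ {n} {v : Fin n → ℚ} (h : HalfIntegral v) → ∃[ e ] sumℤ (twice h) ≡ + nnz v ℤ.+ (e ℤ.+ e)
twice-sum {zero} h = 0ℤ , refl
twice-sum {suc n} {v} h with twice-sum (h ∘ suc)
... | e , q with h zero | v zero ℚP.≟ 0ℚ
...   | inj₁ p        | no _  = e , trans (cong (λ x → 1ℤ ℤ.+ x) q) (sym (ℤP.+-assoc 1ℤ (+ nnz (v ∘ suc)) (e ℤ.+ e)))
...   | inj₂ (inj₁ p) | no _  = e ℤ.- 1ℤ , trans (cong (λ x → -1ℤ ℤ.+ x) q) (lem (+ nnz (v ∘ suc)) e)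
  where lem : ∀ a e → -1ℤ ℤ.+ (a ℤ.+ (e ℤ.+ e)) ≡ 1ℤ ℤ.+ a ℤ.+ (e ℤ.- 1ℤ ℤ.+ (e ℤ.- 1ℤ))
        lem = ℤS.solve-∀
...   | inj₂ (inj₂ p) | yes _ = e , trans (ℤP.+-identityˡ _) q
...   | inj₁ p        | yes z with () ← trans (sym p) z
...   | inj₂ (inj₁ p) | yes z with () ← trans (sym p) z
...   | inj₂ (inj₂ p) | no nz = ⊥-elim (nz p)

twice-even : ∀ {n} {v : Fin n → ℚ} (h : HalfIntegral v) → EvenN (nnz v) → EvenZ (sumℤ (twice h))
twice-even h (q , e) with twice-sum h
... | a , eq = subst EvenZ (sym eq) (even-+ (+ q , cong +_ e) (a , refl))

-- Cycles, torsion, and the condition dual to sign solvability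

module Chains (Δ : SimplicialComplex) (k : ℕ) where

  open Columns Δ k public

  -- ker ∂ₖ as the solutions of a linear system; for k = 0 there are no equations.
  rows : ℕ → ℕ
  rows zero = 0
  rows (suc k) = f Δ k

  A : (k : ℕ) → Fin (rows k) → Fin (f Δ k) → ℤ
  A (suc k) i t = bdEntry Δ k t i

  cycle→ : ∀ k {z : Chain Δ k} → IsCycle Δ k z → ∀ i → sumℤ (λ t → A k i t ℤ.* z t) ≡ 0ℤ
  cycle→ zero _ ()
  cycle→ (suc k) cyc = cyc

  cycle← : ∀ k {z : Chain Δ k} → (∀ i → sumℤ (λ t → A k i t ℤ.* z t) ≡ 0ℤ) → IsCycle Δ k z
  cycle← zero _ = tt
  cycle← (suc k) cyc = cyc

  A-B : ∀ k i j → sumℤ (λ t → A k i t ℤ.* bdEntry Δ k j t) ≡ 0ℤ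
  A-B zero ()
  A-B (suc k) i j = trans (Z.∑-cong (λ t → ℤP.*-comm (bdEntry Δ k t i) (bdEntry Δ (suc k) j t))) (bdEntry-bdEntry Δ k j i)

  boundary⇒cycle : ∀ {z : Chain Δ k} → IsBoundary Δ k z → IsCycle Δ k z
  boundary⇒cycle {z} (c , e) = cycle← k (λ i → begin
    sumℤ (λ t → A k i t ℤ.* z t)                                   ≡⟨ Z.∑-cong (λ t → cong (A k i t ℤ.*_) (e t)) ⟨
    sumℤ (λ t → A k i t ℤ.* sumℤ (λ j → B j t ℤ.* c j))            ≡⟨ Z.∑-assoc (A k i) (λ t j → B j t) c ⟩
    sumℤ (λ j → sumℤ (λ t → A k i t ℤ.* B j t) ℤ.* c j)            ≡⟨ Z.∑-0 {s} _ (λ j → trans (cong (ℤ._* c j) (A-B k i j)) (ℤP.*-zeroˡ (c j))) ⟩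
    0ℤ ∎)

  cycle-+ : ∀ {y z : Chain Δ k} → IsCycle Δ k y → IsCycle Δ k z → IsCycle Δ k (λ t → y t ℤ.+ z t)
  cycle-+ {y} {z} cy cz = cycle← k (λ i → trans (Z.∑-cong (λ t → ℤP.*-distribˡ-+ (A k i t) (y t) (z t)))
    (trans (Z.∑-+ (λ t → A k i t ℤ.* y t) (λ t → A k i t ℤ.* z t)) (cong₂ ℤ._+_ (cycle→ k cy i) (cycle→ k cz i))))

  ∑-scale : ∀ n (y z : Fin m → ℤ) → sumℤ (λ t → y t ℤ.* (n ℤ.* z t)) ≡ n ℤ.* sumℤ (λ t → y t ℤ.* z t)
  ∑-scale n y z = trans (Z.∑-cong (λ t → swap (y t) n (z t))) (Z.∑-*ˡ n (λ t → y t ℤ.* z t))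
    where swap : ∀ a n z → a ℤ.* (n ℤ.* z) ≡ n ℤ.* (a ℤ.* z)
          swap = ℤS.solve-∀

  cycle-* : ∀ n {z : Chain Δ k} → IsCycle Δ k z → IsCycle Δ k (λ t → n ℤ.* z t)
  cycle-* n {z} cyc = cycle← k (λ i → trans (∑-scale n (A k i) z) (trans (cong (n ℤ.*_) (cycle→ k cyc i)) (ℤP.*-zeroʳ n)))

  torsion⇒cycle : ∀ n (z : Chain Δ k) → n ≢ 0ℤ → IsBoundary Δ k (λ t → n ℤ.* z t) → IsCycle Δ k z
  torsion⇒cycle n z n≢0 bd = cycle← k (λ i → Z.cancel n n≢0 (trans (sym (∑-scale n (A k i) z)) (cycle→ k (boundary⇒cycle bd) i)))

  boundary-cong : ∀ {y z : Chain Δ k} → (∀ t → y t ≡ z t) → IsBoundary Δ k y → IsBoundary Δ k z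
  boundary-cong e (c , q) = c , λ t → trans (q t) (e t)

  boundary-neg : ∀ (z : Chain Δ k) → IsBoundary Δ k z → IsBoundary Δ k (λ t → ℤ.- z t)
  boundary-neg z (c , q) = (λ i → -1ℤ ℤ.* c i) , λ t → trans (Z.∑-cong (λ i → swap (B i t) (c i)))
      (trans (Z.∑-*ˡ -1ℤ (λ i → B i t ℤ.* c i)) (trans (cong (-1ℤ ℤ.*_) (q t)) (ℤP.-1*i≡-i _)))
    where swap : ∀ a z → a ℤ.* (-1ℤ ℤ.* z) ≡ -1ℤ ℤ.* (a ℤ.* z)
          swap = ℤS.solve-∀

  -- Joins two notions of torsion: Kronecker's criterion supplies a nonzero integer multiplier,
  -- `IsTorsion` asks for a positive one.
  positive-multiple : ∀ n (z : Chain Δ k) → n ≢ 0ℤ → IsBoundary Δ k (λ t → n ℤ.* z t) → Σ ℕ λ N → IsBoundary Δ k (λ t → + suc N ℤ.* z t)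
  positive-multiple (+ zero) z n≢0 bd = ⊥-elim (n≢0 refl)
  positive-multiple (+ suc N) z n≢0 bd = N , bd
  positive-multiple -[1+ N ] z n≢0 bd = N , boundary-cong (λ t → ℤP.neg-distribˡ-* -[1+ N ] (z t)) (boundary-neg (λ t → -[1+ N ] ℤ.* z t) bd)

  -- The condition dual to SignSolvable under Kronecker's criterion.
  EvenHalf : Set
  EvenHalf = ∀ n → n ≢ 0ℤ → ∀ (z : Chain Δ k) → IsBoundary Δ k (λ t → n ℤ.* z t) →
             Σ (Chain Δ (suc k)) λ g → (∀ t → ∂ Δ k g t ≡ z t ℤ.+ z t) × EvenZ (sumℤ g)

  cond1⇒evenHalf : Cond1 Δ k → EvenHalf
  cond1⇒evenHalf vanish n n≢0 z bd with vanish z (torsion⇒cycle n z n≢0 bd)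
  ... | c , e = (λ i → c i ℤ.+ c i) ,
      (λ t → trans (Z.∑-cong (λ i → ℤP.*-distribˡ-+ (B i t) (c i) (c i))) (trans (∑-double (λ i → B i t ℤ.* c i)) (cong₂ ℤ._+_ (e t) (e t)))) ,
      sumℤ c , ∑-double c

  module Iso {ℓ r} (iso : HomologyIso Δ k ℓ r) where
    φ = proj₁ iso
    ψ = proj₁ (proj₂ iso)
    private laws = proj₂ (proj₂ iso)
    hom = proj₁ laws
    kernel→ = proj₁ (proj₂ (proj₂ laws))
    kernel← = proj₂ (proj₂ (proj₂ laws))

    -- Function extensionality is not available, so that φ respects pointwise equality follows from additivity.
    φ-cong : ∀ {y z : Chain Δ k} → IsCycle Δ k y → IsCycle Δ k z → (∀ t → y t ≡ z t) → ∀ i → φ y i ≡ φ z i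
    φ-cong {y} {z} cy cz e i = ℤG.∙-cancelʳ (φ b i) (φ y i) (φ z i) (trans (vanish y cy e) (sym (vanish z cz (λ _ → refl))))
      where
      b : Chain Δ k
      b t = -1ℤ ℤ.* z t
      cb = cycle-* -1ℤ cz
      vanish : ∀ x → IsCycle Δ k x → (∀ t → x t ≡ z t) → φ x i ℤ.+ φ b i ≡ 0ℤ
      vanish x cx e = trans (sym (proj₁ (hom x b cx cb) i)) (proj₁ (kernel← (λ t → x t ℤ.+ b t) (cycle-+ cx cb)
        ((λ _ → 0ℤ) , λ t → trans (Z.∑-0 {s} _ (λ j → ℤP.*-zeroʳ (B j t))) (sym (trans (cong (λ v → v ℤ.+ b t) (e t)) (lem (z t)))))) i)
        where lem : ∀ z → z ℤ.+ -1ℤ ℤ.* z ≡ 0ℤ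
              lem = ℤS.solve-∀

    φ-multiple : ∀ N {z : Chain Δ k} → IsCycle Δ k z → ∀ i → φ (λ t → + suc N ℤ.* z t) i ≡ + suc N ℤ.* φ z i
    φ-multiple zero {z} cz i = trans (φ-cong {λ t → 1ℤ ℤ.* z t} {z} (cycle-* 1ℤ cz) cz (λ t → ℤP.*-identityˡ (z t)) i) (sym (ℤP.*-identityˡ _))
    φ-multiple (suc N) {z} cz i = trans
      (trans (φ-cong {λ t → + suc (suc N) ℤ.* z t} {λ t → z t ℤ.+ + suc N ℤ.* z t} (cycle-* (+ suc (suc N)) cz) (cycle-+ cz (cycle-* (+ suc N) cz)) (λ t → ℤP.suc-* (+ suc N) (z t)) i)
             (proj₁ (hom z (λ t → + suc N ℤ.* z t) cz (cycle-* (+ suc N) cz)) i))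
      (trans (cong (λ v → φ z i ℤ.+ v) (φ-multiple N cz i)) (sym (ℤP.suc-* (+ suc N) (φ z i))))

    -- Since ℤ^ℓ has no torsion, φ vanishes on z; since 2 kills the other factor, ψ vanishes on 2z.
    -- Thus 2z is in the kernel.
    torsion-doubled : ∀ N (z : Chain Δ k) → IsBoundary Δ k (λ t → + suc N ℤ.* z t) → IsBoundary Δ k (λ t → z t ℤ.+ z t)
    torsion-doubled N z bd = kernel→ (λ t → z t ℤ.+ z t) (cycle-+ cz cz)
      ((λ i → trans (proj₁ (hom z z cz cz) i) (cong₂ ℤ._+_ (φ≡0 i) (φ≡0 i))) ,
       (λ i → trans (proj₂ (hom z z cz cz) i) (BoolP.xor-same (ψ z i))))
      where
      cz = torsion⇒cycle (+ suc N) z (λ ()) bd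
      φ≡0 : ∀ i → φ z i ≡ 0ℤ
      φ≡0 i = Z.cancel (+ suc N) (λ ()) (trans (sym (φ-multiple N cz i)) (proj₁ (kernel← (λ t → + suc N ℤ.* z t) (cycle-* (+ suc N) cz) bd) i))

  -- Add up all coordinates of ∂g = 2z: every column has sum 1, so the left side is Σ g.
  even-columns : EvenN (suc k) → ∀ (z : Chain Δ k) g → (∀ t → ∂ Δ k g t ≡ z t ℤ.+ z t) → EvenZ (sumℤ g)
  even-columns even z g e = sumℤ z , (begin
          sumℤ g                                    ≡⟨ Z.∑-cong (λ j → trans (cong (ℤ._* g j) (bdEntry-sum Δ k j even)) (ℤP.*-identityˡ (g j))) ⟨
          sumℤ (λ j → sumℤ (B j) ℤ.* g j)           ≡⟨ Z.∑-cong (λ j → Z.∑-*ʳ (g j) (B j)) ⟨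
          sumℤ (λ j → sumℤ (λ t → B j t ℤ.* g j))   ≡⟨ Z.∑-swap (λ j t → B j t ℤ.* g j) ⟩
          sumℤ (∂ Δ k g)                            ≡⟨ Z.∑-cong e ⟩
          sumℤ (λ t → z t ℤ.+ z t)                  ≡⟨ ∑-double z ⟩
          sumℤ z ℤ.+ sumℤ z ∎)

  cond2⇒evenHalf : Cond2 Δ k → EvenHalf
  cond2⇒evenHalf (even , ℓ , r , iso) n n≢0 z bd = proj₁ half , proj₂ half , even-columns even z (proj₁ half) (proj₂ half)
    where
    multiple = positive-multiple n z n≢0 bd
    half : IsBoundary Δ k (λ t → z t ℤ.+ z t)
    half = Iso.torsion-doubled iso (proj₁ multiple) z (proj₂ multiple)

  -- From z = Σ a_j w_j + ∂c one gets 2z = ∂g for g = Σ a_j (2v_j) + 2c. Each 2v_j has an even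
  -- number of entries ±1, hence an even sum.
  cond3⇒evenHalf : Cond3 Δ k → EvenHalf
  cond3⇒evenHalf (_ , ℓ , r , _ , v , w , good , _ , generates) n n≢0 z bd
    with generates z (torsion⇒cycle n z n≢0 bd , positive-multiple n z n≢0 bd)
  ... | a , c , e = g , ∂g , subst EvenZ (sym total) (even-+
        (even-∑ _ (λ j → even-*ˡ (a j) (twice-even (half j) (proj₂ (proj₂ (proj₁ (good j)))))))
        (sumℤ c , ∑-double c))
    where
    half : ∀ j → HalfIntegral (v j)
    half j = proj₁ (proj₁ (good j))
    u : Fin r → Fin s → ℤ
    u j = twice (half j)
    g : Fin s → ℤ
    g i = sumℤ (λ j → a j ℤ.* u j i) ℤ.+ (c i ℤ.+ c i)
    ∂u : ∀ j t → ∂ Δ k (u j) t ≡ w j t ℤ.+ w j t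
    ∂u j t = ι-injective (begin
      ι (∂ Δ k (u j) t)                                        ≡⟨ ι-∑-* (λ i → B i t) (u j) ⟩
      sumℚ (λ i → ι (B i t) ℚ.* ι (u j i))                     ≡⟨ Q.∑-cong (λ i → trans (cong (ι (B i t) ℚ.*_) (ι-twiceAt (half j i))) (ℚP.*-distribˡ-+ (ι (B i t)) (v j i) (v j i))) ⟩
      sumℚ (λ i → ι (B i t) ℚ.* v j i ℚ.+ ι (B i t) ℚ.* v j i) ≡⟨ Q.∑-+ (λ i → ι (B i t) ℚ.* v j i) (λ i → ι (B i t) ℚ.* v j i) ⟩
      ∂ℚ Δ k (v j) t ℚ.+ ∂ℚ Δ k (v j) t                        ≡⟨ cong₂ ℚ._+_ (proj₂ (good j) t) (proj₂ (good j) t) ⟩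
      ι (w j t) ℚ.+ ι (w j t)                                  ≡⟨ ι-+ (w j t) (w j t) ⟨
      ι (w j t ℤ.+ w j t) ∎)
    ∂g : ∀ t → ∂ Δ k g t ≡ z t ℤ.+ z t
    ∂g t = begin
      ∂ Δ k g t
        ≡⟨ Z.∑-cong (λ i → distrib (B i t) (sumℤ (λ j → a j ℤ.* u j i)) (c i)) ⟩
      sumℤ (λ i → B i t ℤ.* sumℤ (λ j → a j ℤ.* u j i) ℤ.+ (B i t ℤ.* c i ℤ.+ B i t ℤ.* c i))
        ≡⟨ trans (Z.∑-+ (λ i → B i t ℤ.* sumℤ (λ j → a j ℤ.* u j i)) _) (cong (λ x → sumℤ (λ i → B i t ℤ.* sumℤ (λ j → a j ℤ.* u j i)) ℤ.+ x) (∑-double (λ i → B i t ℤ.* c i))) ⟩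
      sumℤ (λ i → B i t ℤ.* sumℤ (λ j → a j ℤ.* u j i)) ℤ.+ (∂ Δ k c t ℤ.+ ∂ Δ k c t)
        ≡⟨ cong₂ (λ x y → x ℤ.+ (y ℤ.+ y)) part (e t) ⟩
      W ℤ.+ W ℤ.+ (z t ℤ.- W ℤ.+ (z t ℤ.- W))
        ≡⟨ lem W (z t) ⟩
      z t ℤ.+ z t ∎
      where
      W = sumℤ (λ j → a j ℤ.* w j t)
      distrib : ∀ b x c → b ℤ.* (x ℤ.+ (c ℤ.+ c)) ≡ b ℤ.* x ℤ.+ (b ℤ.* c ℤ.+ b ℤ.* c)
      distrib = ℤS.solve-∀
      lem : ∀ W z → W ℤ.+ W ℤ.+ (z ℤ.- W ℤ.+ (z ℤ.- W)) ≡ z ℤ.+ z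
      lem = ℤS.solve-∀
      part : sumℤ (λ i → B i t ℤ.* sumℤ (λ j → a j ℤ.* u j i)) ≡ W ℤ.+ W
      part = begin
        sumℤ (λ i → B i t ℤ.* sumℤ (λ j → a j ℤ.* u j i))  ≡⟨ Z.∑-cong (λ i → cong (B i t ℤ.*_) (Z.∑-cong (λ j → ℤP.*-comm (a j) (u j i)))) ⟩
        sumℤ (λ i → B i t ℤ.* sumℤ (λ j → u j i ℤ.* a j))  ≡⟨ Z.∑-assoc (λ i → B i t) (λ i j → u j i) a ⟩
        sumℤ (λ j → ∂ Δ k (u j) t ℤ.* a j)                 ≡⟨ Z.∑-cong (λ j → trans (cong (ℤ._* a j) (∂u j t)) (lem₂ (w j t) (a j))) ⟩
        sumℤ (λ j → a j ℤ.* w j t ℤ.+ a j ℤ.* w j t)       ≡⟨ ∑-double (λ j → a j ℤ.* w j t) ⟩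
        W ℤ.+ W ∎
        where lem₂ : ∀ w a → (w ℤ.+ w) ℤ.* a ≡ a ℤ.* w ℤ.+ a ℤ.* w
              lem₂ = ℤS.solve-∀
    total : sumℤ g ≡ sumℤ (λ j → a j ℤ.* sumℤ (u j)) ℤ.+ sumℤ (λ i → c i ℤ.+ c i)
    total = trans (Z.∑-+ (λ i → sumℤ (λ j → a j ℤ.* u j i)) (λ i → c i ℤ.+ c i)) (cong (ℤ._+ sumℤ (λ i → c i ℤ.+ c i))
      (trans (Z.∑-swap (λ i j → a j ℤ.* u j i)) (Z.∑-cong (λ j → Z.∑-*ˡ (a j) (u j)))))

  conditions⇒evenHalf : Cond1 Δ k ⊎ Cond2 Δ k ⊎ Cond3 Δ k → EvenHalf
  conditions⇒evenHalf (inj₁ c) = cond1⇒evenHalf c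
  conditions⇒evenHalf (inj₂ (inj₁ c)) = cond2⇒evenHalf c
  conditions⇒evenHalf (inj₂ (inj₂ c)) = cond3⇒evenHalf c

  -- Reversing the sign of one term changes the sum by twice that term.
  sgn-parity : ∀ {n} (g : Fin n → ℤ) (ε : Fin n → Bool) → EvenZ (sumℤ g) → EvenZ (sumℤ (λ i → g i ℤ.* sgn (ε i)))
  sgn-parity g ε ev = subst EvenZ (begin
      sumℤ g ℤ.+ sumℤ (λ i → d i ℤ.+ d i)  ≡⟨ Z.∑-+ g (λ i → d i ℤ.+ d i) ⟨
      sumℤ (λ i → g i ℤ.+ (d i ℤ.+ d i))   ≡⟨ Z.∑-cong (λ i → flip (g i) (ε i)) ⟩
      sumℤ (λ i → g i ℤ.* sgn (ε i)) ∎)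
    (even-+ ev (sumℤ d , ∑-double d))
    where
    d : _ → ℤ
    d i = if ε i then 0ℤ else ℤ.- g i
    flip : ∀ x b → x ℤ.+ ((if b then 0ℤ else ℤ.- x) ℤ.+ (if b then 0ℤ else ℤ.- x)) ≡ x ℤ.* sgn b
    flip x true = lem x
      where lem : ∀ x → x ℤ.+ (0ℤ ℤ.+ 0ℤ) ≡ x ℤ.* 1ℤ
            lem = ℤS.solve-∀
    flip x false = lem x
      where lem : ∀ x → x ℤ.+ (ℤ.- x ℤ.+ ℤ.- x) ≡ x ℤ.* -1ℤ
            lem = ℤS.solve-∀

  -- If ∂c = nz and ∂g = 2z, then 2c and ng have the same boundary and are equal by injectivity. So
  -- 2 εᵀc = n εᵀg, where εᵀg is even with Σ g; halving gives the divisibility by n.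
  evenHalf⇒signSolvable : TopHomologyVanishes Δ k → EvenHalf → SignSolvable Δ k
  evenHalf⇒signSolvable top half ε = Z.kroneckerᶠ B (sgn ∘ ε)
    (λ c z → top c (λ t → trans (comm c t) (z t))) compatible
    where
    comm : ∀ c t → ∂ Δ k c t ≡ sumℤ (λ j → c j ℤ.* B j t)
    comm c t = Z.∑-cong (λ j → ℤP.*-comm (B j t) (c j))
    compatible : ∀ n → n ≢ 0ℤ → ∀ c z → (∀ t → sumℤ (λ j → c j ℤ.* B j t) ≡ n ℤ.* z t) → n Z.∣ sumℤ (λ j → c j ℤ.* sgn (ε j))
    compatible n n≢0 c z e with half n n≢0 z (c , λ t → trans (comm c t) (e t))
    ... | g , ∂g , ev with sgn-parity g ε ev
    ...   | x , x≡ = x , double-cancel (begin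
            C ℤ.+ C                                          ≡⟨ ∑-double (λ j → c j ℤ.* sgn (ε j)) ⟨
            sumℤ (λ j → c j ℤ.* sgn (ε j) ℤ.+ c j ℤ.* sgn (ε j))  ≡⟨ Z.∑-cong (λ j → trans (sym (ℤP.*-distribʳ-+ (sgn (ε j)) (c j) (c j))) (trans (cong (ℤ._* sgn (ε j)) (doubled j)) (ℤP.*-assoc n (g j) (sgn (ε j))))) ⟩
            sumℤ (λ j → n ℤ.* (g j ℤ.* sgn (ε j)))           ≡⟨ Z.∑-*ˡ n (λ j → g j ℤ.* sgn (ε j)) ⟩
            n ℤ.* sumℤ (λ j → g j ℤ.* sgn (ε j))             ≡⟨ cong (n ℤ.*_) x≡ ⟩
            n ℤ.* (x ℤ.+ x)                                  ≡⟨ ℤP.*-distribˡ-+ n x x ⟩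
            n ℤ.* x ℤ.+ n ℤ.* x ∎)
      where
      C = sumℤ (λ j → c j ℤ.* sgn (ε j))
      doubled : ∀ j → c j ℤ.+ c j ≡ n ℤ.* g j
      doubled j = ℤP.i-j≡0⇒i≡j (c j ℤ.+ c j) (n ℤ.* g j) (top (λ j → c j ℤ.+ c j ℤ.- n ℤ.* g j) (λ t → begin
        sumℤ (λ j → B j t ℤ.* (c j ℤ.+ c j ℤ.- n ℤ.* g j))
          ≡⟨ Z.∑-cong (λ j → distrib (B j t) (c j) n (g j)) ⟩
        sumℤ (λ j → (B j t ℤ.* c j ℤ.+ B j t ℤ.* c j) ℤ.+ (ℤ.- n) ℤ.* (B j t ℤ.* g j))
          ≡⟨ trans (Z.∑-+ (λ j → B j t ℤ.* c j ℤ.+ B j t ℤ.* c j) (λ j → (ℤ.- n) ℤ.* (B j t ℤ.* g j)))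
                   (cong₂ ℤ._+_ (∑-double (λ j → B j t ℤ.* c j)) (Z.∑-*ˡ (ℤ.- n) (λ j → B j t ℤ.* g j))) ⟩
        (∂ Δ k c t ℤ.+ ∂ Δ k c t) ℤ.+ (ℤ.- n) ℤ.* ∂ Δ k g t
          ≡⟨ cong₂ (λ x y → (x ℤ.+ x) ℤ.+ (ℤ.- n) ℤ.* y) (trans (comm c t) (e t)) (∂g t) ⟩
        (n ℤ.* z t ℤ.+ n ℤ.* z t) ℤ.+ (ℤ.- n) ℤ.* (z t ℤ.+ z t)
          ≡⟨ lem n (z t) ⟩
        0ℤ ∎) j)
        where
        distrib : ∀ b c n g → b ℤ.* (c ℤ.+ c ℤ.- n ℤ.* g) ≡ (b ℤ.* c ℤ.+ b ℤ.* c) ℤ.+ (ℤ.- n) ℤ.* (b ℤ.* g)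
        distrib = ℤS.solve-∀
        lem : ∀ n z → (n ℤ.* z ℤ.+ n ℤ.* z) ℤ.+ (ℤ.- n) ℤ.* (z ℤ.+ z) ≡ 0ℤ
        lem = ℤS.solve-∀

-- Homology from solvability

⌜_⌝ : Bool → ℤ
⌜ true ⌝  = 1ℤ
⌜ false ⌝ = 0ℤ

-- Congruence mod 2 with an explicit witness. Sums and products are treated for this relation, and
-- uniqueness of the residue then makes `par` a ring homomorphism onto the field with two elements.
Residue : ℤ → Bool → Set
Residue x b = ∃[ e ] x ≡ ⌜ b ⌝ ℤ.+ (e ℤ.+ e)

residue-suc : ∀ {x} b → Residue x b → Residue (1ℤ ℤ.+ x) (not b)
residue-suc true (e , refl) = 1ℤ ℤ.+ e , lem e
  where lem : ∀ e → 1ℤ ℤ.+ (1ℤ ℤ.+ (e ℤ.+ e)) ≡ 0ℤ ℤ.+ (1ℤ ℤ.+ e ℤ.+ (1ℤ ℤ.+ e))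
        lem = ℤS.solve-∀
residue-suc false (e , refl) = e , lem e
  where lem : ∀ e → 1ℤ ℤ.+ (0ℤ ℤ.+ (e ℤ.+ e)) ≡ 1ℤ ℤ.+ (e ℤ.+ e)
        lem = ℤS.solve-∀

residue-neg : ∀ {x} b → Residue x b → Residue (ℤ.- x) b
residue-neg b (e , refl) = ℤ.- e ℤ.- ⌜ b ⌝ , lem ⌜ b ⌝ e
  where lem : ∀ b e → ℤ.- (b ℤ.+ (e ℤ.+ e)) ≡ b ℤ.+ (ℤ.- e ℤ.- b ℤ.+ (ℤ.- e ℤ.- b))
        lem = ℤS.solve-∀

residue-+ : ∀ {x y} b c → Residue x b → Residue y c → Residue (x ℤ.+ y) (b xor c)
residue-+ true true (e , refl) (d , refl) = 1ℤ ℤ.+ (e ℤ.+ d) , lem e d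
  where lem : ∀ e d → 1ℤ ℤ.+ (e ℤ.+ e) ℤ.+ (1ℤ ℤ.+ (d ℤ.+ d)) ≡ 0ℤ ℤ.+ (1ℤ ℤ.+ (e ℤ.+ d) ℤ.+ (1ℤ ℤ.+ (e ℤ.+ d)))
        lem = ℤS.solve-∀
residue-+ true false (e , refl) (d , refl) = e ℤ.+ d , lem e d
  where lem : ∀ e d → 1ℤ ℤ.+ (e ℤ.+ e) ℤ.+ (0ℤ ℤ.+ (d ℤ.+ d)) ≡ 1ℤ ℤ.+ (e ℤ.+ d ℤ.+ (e ℤ.+ d))
        lem = ℤS.solve-∀
residue-+ false c (e , refl) (d , refl) = e ℤ.+ d , lem ⌜ c ⌝ e d
  where lem : ∀ c e d → 0ℤ ℤ.+ (e ℤ.+ e) ℤ.+ (c ℤ.+ (d ℤ.+ d)) ≡ c ℤ.+ (e ℤ.+ d ℤ.+ (e ℤ.+ d))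
        lem = ℤS.solve-∀

residue-* : ∀ {x y} b c → Residue x b → Residue y c → Residue (x ℤ.* y) (b ∧ c)
residue-* true c (e , refl) (d , refl) = d ℤ.+ e ℤ.* (⌜ c ⌝ ℤ.+ (d ℤ.+ d)) , lem ⌜ c ⌝ e d
  where lem : ∀ c e d → (1ℤ ℤ.+ (e ℤ.+ e)) ℤ.* (c ℤ.+ (d ℤ.+ d)) ≡ c ℤ.+ (d ℤ.+ e ℤ.* (c ℤ.+ (d ℤ.+ d)) ℤ.+ (d ℤ.+ e ℤ.* (c ℤ.+ (d ℤ.+ d))))
        lem = ℤS.solve-∀
residue-* {y = y} false c (e , refl) _ = e ℤ.* y , lem e y
  where lem : ∀ e y → (0ℤ ℤ.+ (e ℤ.+ e)) ℤ.* y ≡ 0ℤ ℤ.+ (e ℤ.* y ℤ.+ e ℤ.* y)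
        lem = ℤS.solve-∀

double≢1 : ∀ e → e ℤ.+ e ≢ 1ℤ
double≢1 (+ suc (suc n)) ()
double≢1 (+ suc zero) ()
double≢1 (+ zero) ()
double≢1 -[1+ n ] ()

residue-distinct : ∀ {x} → Residue x true → ¬ Residue x false
residue-distinct (e , refl) (d , q) = double≢1 (d ℤ.- e) (lem e d q)
  where lem : ∀ e d → 1ℤ ℤ.+ (e ℤ.+ e) ≡ 0ℤ ℤ.+ (d ℤ.+ d) → d ℤ.- e ℤ.+ (d ℤ.- e) ≡ 1ℤ
        lem e d q = trans (l₁ e d) (trans (cong (ℤ._- (e ℤ.+ e)) (sym q)) (l₂ e))
          where l₁ : ∀ e d → d ℤ.- e ℤ.+ (d ℤ.- e) ≡ 0ℤ ℤ.+ (d ℤ.+ d) ℤ.- (e ℤ.+ e)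
                l₁ = ℤS.solve-∀
                l₂ : ∀ e → 1ℤ ℤ.+ (e ℤ.+ e) ℤ.- (e ℤ.+ e) ≡ 1ℤ
                l₂ = ℤS.solve-∀

residue-unique : ∀ {x} b c → Residue x b → Residue x c → b ≡ c
residue-unique true true _ _ = refl
residue-unique false false _ _ = refl
residue-unique true false r r′ = ⊥-elim (residue-distinct r r′)
residue-unique false true r r′ = ⊥-elim (residue-distinct r′ r)

parityℕ : ∀ n → ∃ (Residue (+ n))
parityℕ zero = false , 0ℤ , refl
parityℕ (suc n) with parityℕ n
... | b , r = not b , residue-suc b r

parity : ∀ x → ∃ (Residue x)
parity (+ n) = parityℕ n
parity -[1+ n ] with parityℕ (suc n)
... | b , r = b , residue-neg b r

par : ℤ → Bool
par x = proj₁ (parity x)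

residue : ∀ x → Residue x (par x)
residue x = proj₂ (parity x)

par-unique : ∀ {x} b → Residue x b → par x ≡ b
par-unique {x} b r = residue-unique (par x) b (residue x) r

par-+ : ∀ x y → par (x ℤ.+ y) ≡ par x xor par y
par-+ x y = par-unique _ (residue-+ (par x) (par y) (residue x) (residue y))

par-* : ∀ x y → par (x ℤ.* y) ≡ par x ∧ par y
par-* x y = par-unique _ (residue-* (par x) (par y) (residue x) (residue y))

par-⌜⌝ : ∀ b → par ⌜ b ⌝ ≡ b
par-⌜⌝ true = refl
par-⌜⌝ false = refl

par-∑ : ∀ {n} (x : Fin n → ℤ) → par (sumℤ x) ≡ sum𝔽₂ (λ i → par (x i))
par-∑ {zero} x = refl
par-∑ {suc n} x = trans (par-+ (x zero) _) (cong (par (x zero) xor_) (par-∑ (x ∘ suc)))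

par-∑-* : ∀ {n} (x y : Fin n → ℤ) → par (sumℤ (λ i → x i ℤ.* y i)) ≡ sum𝔽₂ (λ i → par (x i) ∧ par (y i))
par-∑-* x y = trans (par-∑ (λ i → x i ℤ.* y i)) (F.∑-cong (λ i → par-* (x i) (y i)))

par-double : ∀ e → par (e ℤ.+ e) ≡ false
par-double e = par-unique false (e , sym (ℤP.+-identityˡ (e ℤ.+ e)))

halve : ∀ x → par x ≡ false → EvenZ x
halve x p with parity x
halve x refl | false , e , q = e , trans q (ℤP.+-identityˡ (e ℤ.+ e))

par-difference : ∀ x y → par x ≡ par y → EvenZ (x ℤ.- y)
par-difference x y p = halve (x ℤ.- y) (trans (par-+ x (ℤ.- y)) (trans (cong₂ _xor_ p (par-unique (par y) (residue-neg (par y) (residue y)))) (BoolP.xor-same (par y))))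

nnz-bits : ∀ {n} (b : Fin n → Bool) (v : Fin n → ℚ) → (∀ i → v i ≡ (if b i then ½ else 0ℚ)) → sumℤ (λ i → ⌜ b i ⌝) ≡ + nnz v
nnz-bits {zero} b v e = refl
nnz-bits {suc n} b v e with v zero ℚP.≟ 0ℚ | b zero | e zero
... | yes z | true  | q with () ← trans (sym q) z
... | yes z | false | q = trans (ℤP.+-identityˡ _) (nnz-bits (b ∘ suc) (v ∘ suc) (e ∘ suc))
... | no z  | true  | q = cong (λ x → 1ℤ ℤ.+ x) (nnz-bits (b ∘ suc) (v ∘ suc) (e ∘ suc))
... | no z  | false | q = ⊥-elim (z q)

evenZ⇒evenN : ∀ n → EvenZ (+ n) → EvenN n
evenZ⇒evenN n (+ q , e) = q , ℤP.+-injective e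
evenZ⇒evenN n (-[1+ q ] , ())

evenN-oddN : ∀ n → EvenN n ⊎ OddN n
evenN-oddN zero = inj₁ (0 , refl)
evenN-oddN (suc n) with evenN-oddN n
... | inj₁ (q , e) = inj₂ (q , cong suc e)
... | inj₂ (q , e) = inj₁ (suc q , cong suc (trans e (sym (ℕP.+-suc q q))))

-- The negated unit vector encodes all signs plus except the i-th, so its difference from the
-- constant sign vector is 2δ.
flip-one : ∀ {n} (i j : Fin n) → 1ℤ ℤ.- sgn (not (F.unit i j)) ≡ Z.unit i j ℤ.+ Z.unit i j
flip-one zero    zero    = refl
flip-one zero    (suc j) = refl
flip-one (suc i) zero    = refl
flip-one (suc i) (suc j) = flip-one i j

-- Coordinates on the homology from the solutions for all sign vectors

module Converse (Δ : SimplicialComplex) (k : ℕ) (solvable : SignSolvable Δ k) where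
  open Chains Δ k

  ones : Fin m → ℤ
  ones = proj₁ (solvable (λ _ → true))

  ones-B : ∀ j → sumℤ (λ t → ones t ℤ.* B j t) ≡ 1ℤ
  ones-B = proj₂ (solvable (λ _ → true))

  flipped : Fin s → Fin m → ℤ
  flipped i = proj₁ (solvable (λ j → not (F.unit i j)))

  ω : Fin s → Fin m → ℤ
  ω i t = ones t ℤ.- flipped i t

  ω-B : ∀ i j → sumℤ (λ t → ω i t ℤ.* B j t) ≡ Z.unit i j ℤ.+ Z.unit i j
  ω-B i j = begin
    sumℤ (λ t → ω i t ℤ.* B j t)
      ≡⟨ Z.∑-cong (λ t → distrib (ones t) (flipped i t) (B j t)) ⟩
    sumℤ (λ t → ones t ℤ.* B j t ℤ.+ ℤ.- 1ℤ ℤ.* (flipped i t ℤ.* B j t))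
      ≡⟨ Z.∑-+ (λ t → ones t ℤ.* B j t) (λ t → ℤ.- 1ℤ ℤ.* (flipped i t ℤ.* B j t)) ⟩
    sumℤ (λ t → ones t ℤ.* B j t) ℤ.+ sumℤ (λ t → ℤ.- 1ℤ ℤ.* (flipped i t ℤ.* B j t))
      ≡⟨ cong₂ ℤ._+_ (ones-B j) (trans (Z.∑-*ˡ (ℤ.- 1ℤ) (λ t → flipped i t ℤ.* B j t)) (trans (cong (ℤ.- 1ℤ ℤ.*_) (proj₂ (solvable (λ j → not (F.unit i j))) j)) (ℤP.-1*i≡-i _))) ⟩
    1ℤ ℤ.- sgn (not (F.unit i j))
      ≡⟨ flip-one i j ⟩
    Z.unit i j ℤ.+ Z.unit i j ∎
    where distrib : ∀ a b x → (a ℤ.- b) ℤ.* x ≡ a ℤ.* x ℤ.+ ℤ.- 1ℤ ℤ.* (b ℤ.* x)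
          distrib = ℤS.solve-∀

  -- On the rational span of the columns these are twice the column coordinates, because the rows of
  -- ω are twice a dual family.
  pair : Chain Δ k → Fin s → ℤ
  pair z i = sumℤ (λ t → ω i t ℤ.* z t)

  pair-cong : ∀ {y z} → (∀ t → y t ≡ z t) → ∀ i → pair y i ≡ pair z i
  pair-cong e i = Z.∑-cong (λ t → cong (ω i t ℤ.*_) (e t))

  pair-+ : ∀ y z i → pair (λ t → y t ℤ.+ z t) i ≡ pair y i ℤ.+ pair z i
  pair-+ y z i = trans (Z.∑-cong (λ t → ℤP.*-distribˡ-+ (ω i t) (y t) (z t))) (Z.∑-+ (λ t → ω i t ℤ.* y t) (λ t → ω i t ℤ.* z t))

  ∂-cong : ∀ {g h} → (∀ i → g i ≡ h i) → ∀ t → ∂ Δ k g t ≡ ∂ Δ k h t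
  ∂-cong e t = Z.∑-cong (λ i → cong (B i t ℤ.*_) (e i))

  ∂-double : ∀ g t → ∂ Δ k (λ i → g i ℤ.+ g i) t ≡ ∂ Δ k g t ℤ.+ ∂ Δ k g t
  ∂-double g t = trans (Z.∑-cong (λ i → ℤP.*-distribˡ-+ (B i t) (g i) (g i))) (∑-double (λ i → B i t ℤ.* g i))

  pair-∂ : ∀ g i → pair (∂ Δ k g) i ≡ g i ℤ.+ g i
  pair-∂ g i = begin
    sumℤ (λ t → ω i t ℤ.* sumℤ (λ j → B j t ℤ.* g j))     ≡⟨ Z.∑-assoc (ω i) (λ t j → B j t) g ⟩
    sumℤ (λ j → sumℤ (λ t → ω i t ℤ.* B j t) ℤ.* g j)     ≡⟨ Z.∑-cong (λ j → trans (cong (ℤ._* g j) (ω-B i j)) (ℤP.*-distribʳ-+ (g j) (Z.unit i j) (Z.unit i j))) ⟩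
    sumℤ (λ j → Z.unit i j ℤ.* g j ℤ.+ Z.unit i j ℤ.* g j) ≡⟨ ∑-double (λ j → Z.unit i j ℤ.* g j) ⟩
    _                                                      ≡⟨ cong₂ ℤ._+_ (Z.∑-unit i g) (Z.∑-unit i g) ⟩
    g i ℤ.+ g i ∎

  -- z lies in the rational span of the columns.
  Spanned : Chain Δ k → Set
  Spanned z = ∀ t → z t ℤ.+ z t ≡ ∂ Δ k (pair z) t

  -- Pairing ∂c = nz with ω gives 2c = n `pair z`; taking boundaries yields 2nz = n ∂(`pair z`), and
  -- n cancels.
  torsion⇒spanned : ∀ n z → n ≢ 0ℤ → IsBoundary Δ k (λ t → n ℤ.* z t) → Spanned z
  torsion⇒spanned n z n≢0 (c , e) t = Z.*-cancelˡ n n≢0 (begin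
    n ℤ.* (z t ℤ.+ z t)                         ≡⟨ ℤP.*-distribˡ-+ n (z t) (z t) ⟩
    n ℤ.* z t ℤ.+ n ℤ.* z t                     ≡⟨ cong₂ ℤ._+_ (e t) (e t) ⟨
    ∂ Δ k c t ℤ.+ ∂ Δ k c t                     ≡⟨ ∂-double c t ⟨
    ∂ Δ k (λ i → c i ℤ.+ c i) t                 ≡⟨ ∂-cong scaled t ⟩
    ∂ Δ k (λ i → n ℤ.* pair z i) t              ≡⟨ Z.∑-cong (λ i → swap (B i t) n (pair z i)) ⟩
    sumℤ (λ i → n ℤ.* (B i t ℤ.* pair z i))     ≡⟨ Z.∑-*ˡ n (λ i → B i t ℤ.* pair z i) ⟩
    n ℤ.* ∂ Δ k (pair z) t ∎)
    where
    swap : ∀ b n p → b ℤ.* (n ℤ.* p) ≡ n ℤ.* (b ℤ.* p)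
    swap = ℤS.solve-∀
    scaled : ∀ i → c i ℤ.+ c i ≡ n ℤ.* pair z i
    scaled i = trans (sym (pair-∂ c i)) (trans (pair-cong {∂ Δ k c} {λ t → n ℤ.* z t} e i) (∑-scale n (ω i) z))

  spanned-∂ : ∀ g z → (∀ t → ∂ Δ k g t ≡ z t) → Spanned z
  spanned-∂ g z e t = begin
    z t ℤ.+ z t                          ≡⟨ cong₂ ℤ._+_ (e t) (e t) ⟨
    ∂ Δ k g t ℤ.+ ∂ Δ k g t              ≡⟨ ∂-double g t ⟨
    ∂ Δ k (λ i → g i ℤ.+ g i) t          ≡⟨ ∂-cong (λ i → trans (sym (pair-∂ g i)) (pair-cong {∂ Δ k g} {z} e i)) t ⟩
    ∂ Δ k (pair z) t ∎

  E : Fin m → Fin m → ℤ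
  E t t′ = Z.unit t t′ ℤ.+ Z.unit t t′ ℤ.- sumℤ (λ i → B i t ℤ.* ω i t′)

  E-apply : ∀ z t → sumℤ (λ t′ → E t t′ ℤ.* z t′) ≡ z t ℤ.+ z t ℤ.- ∂ Δ k (pair z) t
  E-apply z t = begin
    sumℤ (λ t′ → E t t′ ℤ.* z t′)
      ≡⟨ Z.∑-cong (λ t′ → distrib (Z.unit t t′) (S t′) (z t′)) ⟩
    sumℤ (λ t′ → (U t′ ℤ.+ U t′) ℤ.+ -1ℤ ℤ.* (S t′ ℤ.* z t′))
      ≡⟨ trans (Z.∑-+ (λ t′ → U t′ ℤ.+ U t′) (λ t′ → -1ℤ ℤ.* (S t′ ℤ.* z t′))) (cong₂ ℤ._+_ (∑-double U) (Z.∑-*ˡ -1ℤ (λ t′ → S t′ ℤ.* z t′))) ⟩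
    sumℤ U ℤ.+ sumℤ U ℤ.+ -1ℤ ℤ.* sumℤ (λ t′ → S t′ ℤ.* z t′)
      ≡⟨ cong₂ (λ x y → x ℤ.+ x ℤ.+ -1ℤ ℤ.* y) (Z.∑-unit t z) (sym (Z.∑-assoc (λ i → B i t) ω z)) ⟩
    z t ℤ.+ z t ℤ.+ -1ℤ ℤ.* ∂ Δ k (pair z) t
      ≡⟨ cong (λ x → z t ℤ.+ z t ℤ.+ x) (ℤP.-1*i≡-i _) ⟩
    z t ℤ.+ z t ℤ.- ∂ Δ k (pair z) t ∎
    where
    S U : Fin m → ℤ
    S t′ = sumℤ (λ i → B i t ℤ.* ω i t′)
    U t′ = Z.unit t t′ ℤ.* z t′
    distrib : ∀ u s z → (u ℤ.+ u ℤ.- s) ℤ.* z ≡ (u ℤ.* z ℤ.+ u ℤ.* z) ℤ.+ -1ℤ ℤ.* (s ℤ.* z)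
    distrib = ℤS.solve-∀

  module K₁ = Z.FreeKernel (Z.freeKernel (A k))

  -- The map z ↦ 2z - ∂(`pair z`) restricted to the cycles, in the basis `K₁.G` of the cycle
  -- lattice. Its rank is the ℓ of the homology.
  EG : Fin m → Fin K₁.nullity → ℤ
  EG t j = sumℤ (λ t′ → E t t′ ℤ.* K₁.G t′ j)

  module K₂ = Z.FreeKernel (Z.freeKernel EG)

  C : Fin m → Fin s → Bool
  C t i = par (B i t)

  𝕂₃ = F.freeKernel C
  module K₃ = F.FreeKernel 𝕂₃

  EG-apply : ∀ z → IsCycle Δ k z → ∀ t → sumℤ (λ j → EG t j ℤ.* K₁.β z j) ≡ z t ℤ.+ z t ℤ.- ∂ Δ k (pair z) t
  EG-apply z cyc t = begin
    sumℤ (λ j → EG t j ℤ.* K₁.β z j)                                   ≡⟨ Z.∑-assoc (E t) K₁.G (K₁.β z) ⟨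
    sumℤ (λ t′ → E t t′ ℤ.* sumℤ (λ j → K₁.G t′ j ℤ.* K₁.β z j))       ≡⟨ Z.∑-cong (λ t′ → cong (E t t′ ℤ.*_) (K₁.recon z (K₁.ker→ z (cycle→ k cyc)) t′)) ⟨
    sumℤ (λ t′ → E t t′ ℤ.* z t′)                                      ≡⟨ E-apply z t ⟩
    z t ℤ.+ z t ℤ.- ∂ Δ k (pair z) t ∎

  -- The values of `EG` fill only some sublattice. The coordinates α have the same kernel and are
  -- onto ℤ^ℓ.
  φ : Chain Δ k → Fin K₂.rank → ℤ
  φ z = K₂.α (K₁.β z)

  φ-+ : ∀ y z i → φ (λ t → y t ℤ.+ z t) i ≡ φ y i ℤ.+ φ z i
  φ-+ y z i = trans (K₂.α-cong (K₁.β-+ y z) i) (K₂.α-+ (K₁.β y) (K₁.β z) i)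

  φ≡0⇒spanned : ∀ z → IsCycle Δ k z → (∀ i → φ z i ≡ 0ℤ) → Spanned z
  φ≡0⇒spanned z cyc φ≡0 t = ℤP.i-j≡0⇒i≡j (z t ℤ.+ z t) (∂ Δ k (pair z) t) (trans (sym (EG-apply z cyc t)) (K₂.ker← (K₁.β z) φ≡0 t))

  spanned⇒φ≡0 : ∀ z → IsCycle Δ k z → Spanned z → ∀ i → φ z i ≡ 0ℤ
  spanned⇒φ≡0 z cyc sp = K₂.ker→ (K₁.β z) (λ t → trans (EG-apply z cyc t) (trans (cong (ℤ._- ∂ Δ k (pair z) t) (sp t)) (ℤP.+-inverseʳ (∂ Δ k (pair z) t))))

  χ : Chain Δ k → Fin s → Bool
  χ z i = par (pair z i)

  -- The vector χ z is known to lie in the kernel of `C` only when z is spanned by the columns.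
  -- Since β is defined on the whole space, ψ is nevertheless additive on all chains.
  ψ : Chain Δ k → Fin K₃.nullity → Bool
  ψ z = K₃.β (χ z)

  ψ-+ : ∀ y z i → ψ (λ t → y t ℤ.+ z t) i ≡ ψ y i xor ψ z i
  ψ-+ y z i = trans (K₃.β-cong (λ j → trans (cong par (pair-+ y z j)) (par-+ (pair y j) (pair z j))) i) (K₃.β-+ (χ y) (χ z) i)

  χ-kernel : ∀ z → Spanned z → ∀ j → K₃.α (χ z) j ≡ false
  χ-kernel z sp = K₃.ker→ (χ z) (λ t → trans (sym (par-∑-* (λ i → B i t) (pair z))) (trans (cong par (sym (sp t))) (par-double (z t))))

  half-boundary : ∀ z g → (∀ t → z t ℤ.+ z t ≡ ∂ Δ k g t) → (∀ i → EvenZ (g i)) → IsBoundary Δ k z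
  half-boundary z g e ev = (λ i → proj₁ (ev i)) , λ t → double-cancel (trans (sym (∂-double (λ i → proj₁ (ev i)) t))
      (trans (∂-cong (λ i → sym (proj₂ (ev i))) t) (sym (e t))))

  -- The torsion class with coordinates y, obtained as half the boundary of a 0/1-chain.
  module Torsion (y : Fin K₃.nullity → Bool) where
    κ : Fin s → Bool
    κ = K₃.γ (λ _ → false) y

    κℤ : Fin s → ℤ
    κℤ i = ⌜ κ i ⌝

    even : ∀ t → EvenZ (∂ Δ k κℤ t)
    even t = halve _ (trans (par-∑-* (λ i → B i t) κℤ)
      (trans (F.∑-cong (λ i → cong (C t i ∧_) (par-⌜⌝ (κ i)))) (K₃.ker← κ (K₃.α-γ _ y) t)))

    cls : Chain Δ k
    cls t = proj₁ (even t)

    ∂κ : ∀ t → ∂ Δ k κℤ t ≡ cls t ℤ.+ cls t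
    ∂κ t = proj₂ (even t)

    doubled : IsBoundary Δ k (λ t → + 2 ℤ.* cls t)
    doubled = κℤ , λ t → trans (∂κ t) (lem (cls t))
      where lem : ∀ x → x ℤ.+ x ≡ + 2 ℤ.* x
            lem = ℤS.solve-∀

    cls-cycle : IsCycle Δ k cls
    cls-cycle = torsion⇒cycle (+ 2) cls (λ ()) doubled

    pair-cls : ∀ i → pair cls i ≡ κℤ i
    pair-cls i = double-cancel (trans (sym (pair-+ cls cls i)) (trans (pair-cong {λ t → cls t ℤ.+ cls t} {∂ Δ k κℤ} (λ t → sym (∂κ t)) i) (pair-∂ κℤ i)))

    φ-cls : ∀ i → φ cls i ≡ 0ℤ
    φ-cls = spanned⇒φ≡0 cls cls-cycle (λ t → trans (sym (∂κ t)) (∂-cong (λ i → sym (pair-cls i)) t))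

    ψ-cls : ∀ i → ψ cls i ≡ y i
    ψ-cls i = trans (K₃.β-cong (λ j → trans (cong par (pair-cls j)) (par-⌜⌝ (κ j))) i) (K₃.β-γ (λ _ → false) y i)

    -- Pairing ∂κ = 2 `cls` with `ones`, which has value 1 on every column, gives Σ κ = 2 (`ones` ·
    -- `cls`). For either parity of the dimension, `ones` takes over the role of the coordinate sum.
    κ-even : EvenZ (sumℤ κℤ)
    κ-even = sumℤ (λ t → ones t ℤ.* cls t) , (begin
      sumℤ κℤ                                                       ≡⟨ Z.∑-cong (λ j → trans (cong (ℤ._* κℤ j) (ones-B j)) (ℤP.*-identityˡ (κℤ j))) ⟨
      sumℤ (λ j → sumℤ (λ t → ones t ℤ.* B j t) ℤ.* κℤ j)           ≡⟨ Z.∑-assoc ones (λ t j → B j t) κℤ ⟨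
      sumℤ (λ t → ones t ℤ.* ∂ Δ k κℤ t)                            ≡⟨ Z.∑-cong (λ t → trans (cong (ones t ℤ.*_) (∂κ t)) (ℤP.*-distribˡ-+ (ones t) (cls t) (cls t))) ⟩
      sumℤ (λ t → ones t ℤ.* cls t ℤ.+ ones t ℤ.* cls t)            ≡⟨ ∑-double (λ t → ones t ℤ.* cls t) ⟩
      sumℤ (λ t → ones t ℤ.* cls t) ℤ.+ sumℤ (λ t → ones t ℤ.* cls t) ∎)

  -- A cycle z₁ with φ z₁ = x exists by freeness; its uncontrolled ψ-value is corrected by the
  -- torsion class with coordinates ψ z₁ + y, which leaves φ unchanged.
  surjective : ∀ (x : Fin K₂.rank → ℤ) (y : Fin K₃.nullity → Bool) →
               ∃[ z ] (IsCycle Δ k z × (∀ i → φ z i ≡ x i) × (∀ i → ψ z i ≡ y i))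
  surjective x y = (λ t → z₁ t ℤ.+ T.cls t) , cycle-+ z₁-cycle T.cls-cycle ,
    (λ i → trans (φ-+ z₁ T.cls i) (trans (cong₂ ℤ._+_ (trans (K₂.α-cong (K₁.β-γ _ free) i) (K₂.α-γ x _ i)) (T.φ-cls i)) (ℤP.+-identityʳ (x i)))) ,
    (λ i → trans (ψ-+ z₁ T.cls i) (trans (cong (ψ z₁ i xor_) (T.ψ-cls i)) (xor-involutive (ψ z₁ i) (y i))))
    where
    free : Fin K₁.nullity → ℤ
    free = K₂.γ x (λ _ → 0ℤ)
    z₁ : Chain Δ k
    z₁ = K₁.γ (λ _ → 0ℤ) free
    z₁-cycle : IsCycle Δ k z₁
    z₁-cycle = cycle← k (K₁.ker← z₁ (K₁.α-γ _ free))
    module T = Torsion (λ i → ψ z₁ i xor y i)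
    xor-involutive : ∀ a b → a xor (a xor b) ≡ b
    xor-involutive true true = refl
    xor-involutive true false = refl
    xor-involutive false b = refl

  -- Vanishing of φ gives 2z = ∂(`pair z`). Then χ z lies in the kernel of `C` with coordinates ψ z
  -- = 0, so χ z = 0, `pair z` is even, and both sides can be halved.
  kernel→ : ∀ z → IsCycle Δ k z → ((∀ i → φ z i ≡ 0ℤ) × (∀ i → ψ z i ≡ false)) → IsBoundary Δ k z
  kernel→ z cyc (φ≡0 , ψ≡0) = half-boundary z (pair z) sp (λ i → halve (pair z i)
      (trans (K₃.recon (χ z) (χ-kernel z sp) i) (F.∑-0 {K₃.nullity} _ (λ j → trans (cong (K₃.G i j ∧_) (ψ≡0 j)) (BoolP.∧-zeroʳ (K₃.G i j))))))
    where sp = φ≡0⇒spanned z cyc φ≡0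

  kernel← : ∀ z → IsCycle Δ k z → IsBoundary Δ k z → ((∀ i → φ z i ≡ 0ℤ) × (∀ i → ψ z i ≡ false))
  kernel← z cyc (c , e) = spanned⇒φ≡0 z cyc (spanned-∂ c z e) ,
    F.β-0 𝕂₃ (χ z) (λ i → trans (cong par (trans (sym (pair-cong {∂ Δ k c} {z} e i)) (pair-∂ c i))) (par-double (c i)))

  homologyIso : HomologyIso Δ k K₂.rank K₃.nullity
  homologyIso = φ , ψ , (λ a b _ _ → φ-+ a b , ψ-+ a b) , surjective , kernel→ , kernel←

  -- The vectors v_j are halves of the 0/1 lifts of a basis of the kernel of B mod 2, and the
  -- classes w_j are their boundaries.
  cond3 : OddN (suc k) → Cond3 Δ k
  cond3 odd = odd , K₂.rank , K₃.nullity , homologyIso , v , w , (λ j → (values j , nonzero j , even j) , ∂v j) , torsion , generates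
    where
    module T (j : Fin K₃.nullity) = Torsion (F.unit j)
    v : Fin K₃.nullity → Fin s → ℚ
    v j i = if T.κ j i then ½ else 0ℚ
    w : Fin K₃.nullity → Chain Δ k
    w j = T.cls j

    bit-value : ∀ b → (if b then ½ else 0ℚ) ≡ ½ ⊎ (if b then ½ else 0ℚ) ≡ -½ ⊎ (if b then ½ else 0ℚ) ≡ 0ℚ
    bit-value true = inj₁ refl
    bit-value false = inj₂ (inj₂ refl)

    values : ∀ j i → v j i ≡ ½ ⊎ v j i ≡ -½ ⊎ v j i ≡ 0ℚ
    values j i = bit-value (T.κ j i)

    bit-zero : ∀ b → (if b then ½ else 0ℚ) ≡ 0ℚ → b ≡ false
    bit-zero false _ = refl

    unit-true : ∀ {n} (j : Fin n) → F.unit j j ≡ true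
    unit-true zero = refl
    unit-true (suc j) = unit-true j

    nonzero : ∀ j → ¬ (∀ i → v j i ≡ 0ℚ)
    nonzero j z = true≢false (begin
      true                  ≡⟨ unit-true j ⟨
      F.unit j j            ≡⟨ K₃.β-γ (λ _ → false) (F.unit j) j ⟨
      K₃.β (T.κ j) j        ≡⟨ F.β-0 𝕂₃ (T.κ j) (λ i → bit-zero (T.κ j i) (z i)) j ⟩
      false ∎)
      where true≢false : true ≢ false
            true≢false ()

    even : ∀ j → EvenN (nnz (v j))
    even j = evenZ⇒evenN _ (subst EvenZ (nnz-bits (T.κ j) (v j) (λ _ → refl)) (T.κ-even j))

    v-double : ∀ j i → v j i ℚ.+ v j i ≡ ι (T.κℤ j i)
    v-double j i = lem (T.κ j i)
      where lem : ∀ b → (if b then ½ else 0ℚ) ℚ.+ (if b then ½ else 0ℚ) ≡ ι ⌜ b ⌝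
            lem true = refl
            lem false = refl

    ∂v : ∀ j t → ∂ℚ Δ k (v j) t ≡ ι (w j t)
    ∂v j t = ℚ-cancel-double (begin
      ∂ℚ Δ k (v j) t ℚ.+ ∂ℚ Δ k (v j) t                          ≡⟨ Q.∑-+ (λ i → ι (B i t) ℚ.* v j i) (λ i → ι (B i t) ℚ.* v j i) ⟨
      sumℚ (λ i → ι (B i t) ℚ.* v j i ℚ.+ ι (B i t) ℚ.* v j i)   ≡⟨ Q.∑-cong (λ i → trans (sym (ℚP.*-distribˡ-+ (ι (B i t)) (v j i) (v j i))) (cong (ι (B i t) ℚ.*_) (v-double j i))) ⟩
      sumℚ (λ i → ι (B i t) ℚ.* ι (T.κℤ j i))                    ≡⟨ ι-∑-* (λ i → B i t) (T.κℤ j) ⟨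
      ι (∂ Δ k (T.κℤ j) t)                                       ≡⟨ cong ι (T.∂κ j t) ⟩
      ι (w j t ℤ.+ w j t)                                        ≡⟨ ι-+ (w j t) (w j t) ⟩
      ι (w j t) ℚ.+ ι (w j t) ∎)
      where
      ℚ-cancel-double : ∀ {x y} → x ℚ.+ x ≡ y ℚ.+ y → x ≡ y
      ℚ-cancel-double {x} {y} e = Q.*-cancelˡ (1ℚ ℚ.+ 1ℚ) (λ ()) (trans (lem x) (trans e (sym (lem y))))
        where lem : ∀ x → (1ℚ ℚ.+ 1ℚ) ℚ.* x ≡ x ℚ.+ x
              lem = RingSolver.solve-∀ ℚ-ring

    torsion : ∀ j → IsTorsion Δ k (w j)
    torsion j = T.cls-cycle j , 1 , T.doubled j

    -- The coefficients are the bits of ψ z. Modulo 2, `pair z` and Σ a_j κ_j have the same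
    -- coordinates in the kernel of `C`, so their difference is even; its half has boundary z - Σ
    -- a_j w_j.
    generates : ∀ z → IsTorsion Δ k z → Σ (Fin K₃.nullity → ℤ) λ a → IsBoundary Δ k (λ t → z t ℤ.- sumℤ (λ j → a j ℤ.* w j t))
    generates z (cyc , N , bd) = a , half-boundary _ g halves (λ i → par-difference (pair z i) (K i) (sym (par-K i)))
      where
      sp : Spanned z
      sp = torsion⇒spanned (+ suc N) z (λ ()) bd
      a : Fin K₃.nullity → ℤ
      a j = ⌜ ψ z j ⌝
      K g : Fin s → ℤ
      K i = sumℤ (λ j → T.κℤ j i ℤ.* a j)
      g i = pair z i ℤ.- K i

      κ-G : ∀ j i → T.κ j i ≡ K₃.G i j
      κ-G j i = begin
        T.κ j i                                           ≡⟨ K₃.recon (T.κ j) (K₃.α-γ _ (F.unit j)) i ⟩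
        sum𝔽₂ (λ l → K₃.G i l ∧ K₃.β (T.κ j) l)           ≡⟨ F.∑-cong (λ l → trans (cong (K₃.G i l ∧_) (K₃.β-γ (λ _ → false) (F.unit j) l)) (BoolP.∧-comm (K₃.G i l) (F.unit j l))) ⟩
        sum𝔽₂ (λ l → F.unit j l ∧ K₃.G i l)               ≡⟨ F.∑-unit j (K₃.G i) ⟩
        K₃.G i j ∎

      par-K : ∀ i → par (K i) ≡ par (pair z i)
      par-K i = begin
        par (K i)                                         ≡⟨ par-∑-* (λ j → T.κℤ j i) a ⟩
        sum𝔽₂ (λ j → par (T.κℤ j i) ∧ par (a j))          ≡⟨ F.∑-cong (λ j → cong₂ _∧_ (trans (par-⌜⌝ (T.κ j i)) (κ-G j i)) (par-⌜⌝ (ψ z j))) ⟩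
        sum𝔽₂ (λ j → K₃.G i j ∧ ψ z j)                    ≡⟨ K₃.recon (χ z) (χ-kernel z sp) i ⟨
        χ z i ∎

      halves : ∀ t → z t ℤ.- sumℤ (λ j → a j ℤ.* w j t) ℤ.+ (z t ℤ.- sumℤ (λ j → a j ℤ.* w j t)) ≡ ∂ Δ k g t
      halves t = sym (begin
        ∂ Δ k g t
          ≡⟨ Z.∑-cong (λ i → distrib (B i t) (pair z i) (K i)) ⟩
        sumℤ (λ i → B i t ℤ.* pair z i ℤ.+ -1ℤ ℤ.* (B i t ℤ.* K i))
          ≡⟨ trans (Z.∑-+ (λ i → B i t ℤ.* pair z i) (λ i → -1ℤ ℤ.* (B i t ℤ.* K i))) (cong (λ x → ∂ Δ k (pair z) t ℤ.+ x) (Z.∑-*ˡ -1ℤ (λ i → B i t ℤ.* K i))) ⟩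
        ∂ Δ k (pair z) t ℤ.+ -1ℤ ℤ.* sumℤ (λ i → B i t ℤ.* K i)
          ≡⟨ cong₂ (λ x y → x ℤ.+ -1ℤ ℤ.* y) (sym (sp t)) part ⟩
        z t ℤ.+ z t ℤ.+ -1ℤ ℤ.* (W ℤ.+ W)
          ≡⟨ lem (z t) W ⟩
        z t ℤ.- W ℤ.+ (z t ℤ.- W) ∎)
        where
        W = sumℤ (λ j → a j ℤ.* w j t)
        distrib : ∀ b p q → b ℤ.* (p ℤ.- q) ≡ b ℤ.* p ℤ.+ -1ℤ ℤ.* (b ℤ.* q)
        distrib = ℤS.solve-∀
        lem : ∀ z W → z ℤ.+ z ℤ.+ -1ℤ ℤ.* (W ℤ.+ W) ≡ z ℤ.- W ℤ.+ (z ℤ.- W)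
        lem = ℤS.solve-∀
        lem₂ : ∀ w a → (w ℤ.+ w) ℤ.* a ≡ a ℤ.* w ℤ.+ a ℤ.* w
        lem₂ = ℤS.solve-∀
        part : sumℤ (λ i → B i t ℤ.* K i) ≡ W ℤ.+ W
        part = begin
          sumℤ (λ i → B i t ℤ.* K i)                       ≡⟨ Z.∑-assoc (λ i → B i t) (λ i j → T.κℤ j i) a ⟩
          sumℤ (λ j → ∂ Δ k (T.κℤ j) t ℤ.* a j)            ≡⟨ Z.∑-cong (λ j → trans (cong (ℤ._* a j) (T.∂κ j t)) (lem₂ (w j t) (a j))) ⟩
          sumℤ (λ j → a j ℤ.* w j t ℤ.+ a j ℤ.* w j t)     ≡⟨ ∑-double (λ j → a j ℤ.* w j t) ⟩
          W ℤ.+ W ∎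

  conditions : Cond1 Δ k ⊎ Cond2 Δ k ⊎ Cond3 Δ k
  conditions with evenN-oddN (suc k)
  ... | inj₁ even = inj₂ (inj₁ (even , K₂.rank , K₃.nullity , homologyIso))
  ... | inj₂ odd = inj₂ (inj₂ (cond3 odd))

theorem6p7 : (Δ : SimplicialComplex) (k : ℕ) → IsDim Δ (suc k) → TopHomologyVanishes Δ k →
    Reflexive Δ k ⇔ (Cond1 Δ k ⊎ Cond2 Δ k ⊎ Cond3 Δ k)
theorem6p7 Δ k dim top = mk⇔
  (λ reflexive → Converse.conditions Δ k (reflexive⇒signSolvable reflexive))
  (λ cond → signSolvable⇒reflexive (evenHalf⇒signSolvable top (conditions⇒evenHalf cond)))
  where
  open Facets Δ k dim top
  open Chains Δ k using (evenHalf⇒signSolvable; conditions⇒evenHalf)
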